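{- Let $l \ge 3$ and $k \ge 1$ be integers, and define \[ f(l,k) = \begin{cases} 6kl + 10k\log_2 k + 40k + 10k\log_2\log_2 k & \text{if } k \ge 2,\\ 0 & \text{if } k = 1.\end{cases} \] Then every finite graph $G$ either contains $k$ pairwise vertex-disjoint cycles each of length at least $l$, or contains a set $X \subseteq V(G)$ with $|X| \le f(l,k)$ such that the graph $G - X$ contains no cycle of length at least $l$.
   Context: Graphs are finite and simple. $G - X$ denotes the graph obtained from $G$ by deleting the vertices in $X$ (and all incident edges). The length of a cycle is its number of edges (equivalently, vertices). -}

module Defs where

open import Algebra.Definitions.RawSemiring using (_^_)
open import Data.Fin.Base using (Fin)
open import Data.Fin.Subset using (Subset; _∈_; ∁)
open import Data.Integer.Base using (ℤ; +_; -[1+_])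
open import Data.List.Base using (List; _∷_; _∷ʳ_)
import Data.List.Base as List
open import Data.List.Relation.Binary.Disjoint.Propositional using (Disjoint)
open import Data.List.Relation.Unary.Linked using (Linked)
open import Data.List.Relation.Unary.Unique.Propositional using (Unique)
open import Data.Nat.Base using (ℕ; zero; suc; _≤_; _*_)
open import Data.Product.Base using (Σ-syntax; ∃-syntax; _×_; proj₁)
open import Data.Rational.Base as ℚ using (ℚ; 0ℚ; ½; ↥_; ↧ₙ_)
open import Level using (0ℓ)
open import Relation.Binary.Core using (Rel)
open import Relation.Binary.Definitions using (Decidable; Irreflexive; Symmetric)
open import Relation.Binary.PropositionalEquality.Core using (_≡_; _≢_)
open import Relation.Unary using (Pred; _⊆_)

-- A real number x is given by its open upper Dedekind cut, the set of
-- rationals q with x < q.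

ℝ : Set₁
ℝ = Pred ℚ 0ℓ

infix  4 _≤ᴿ_
infixl 6 _+ᴿ_
infixr 7 _·_

_≤ᴿ_ : ℝ → ℝ → Set
x ≤ᴿ y = y ⊆ x

fromℕ : ℕ → ℝ
fromℕ n q = + n ℚ./ 1 ℚ.< q

_+ᴿ_ : ℝ → ℝ → ℝ
(x +ᴿ y) q = ∃[ r ] ∃[ s ] x r × y s × r ℚ.+ s ℚ.< q

_·_ : ℕ → ℝ → ℝ
(n · x) q = ∃[ r ] x r × (+ n ℚ./ 1) ℚ.* r ℚ.< q

infixr 8 _^ℚ_

_^ℚ_ : ℚ → ℕ → ℚ
_^ℚ_ = _^_ ℚ.+-*-rawSemiring

2^_ : ℤ → ℚ
2^ (+ n)    = (+ 2 ℚ./ 1) ^ℚ n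
2^ -[1+ n ] = ½ ^ℚ suc n

-- For x > 0, log₂ x < a/b iff x < 2^(a/b), iff some rational r > x has
-- r^b < 2^a.  For x ≤ 0 the cut contains every rational (the value is -∞).

log₂ : ℝ → ℝ
log₂ x q = ∃[ r ] x r × 0ℚ ℚ.< r × r ^ℚ (↧ₙ q) ℚ.< 2^ (↥ q)

-- The value at k = 0 is irrelevant: f is only used for k ≥ 1.

f : ℕ → ℕ → ℝ
f l 0 = fromℕ 0
f l 1 = fromℕ 0
f l k@(suc (suc _)) =
  fromℕ (6 * k * l) +ᴿ (10 * k) · log₂ (fromℕ k) +ᴿ fromℕ (40 * k)
    +ᴿ (10 * k) · log₂ (log₂ (fromℕ k))

-- Simple graphs with vertex set V; finite ones are those with V = Fin n.

record Graph (V : Set) : Set₁ where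
  field
    Adj    : Rel V 0ℓ
    adj?   : Decidable Adj
    sym    : Symmetric Adj
    irrefl : Irreflexive _≡_ Adj

infixl 6 _-_

-- v ∈ ∁ X is proof-irrelevant, so the vertices of G - X are exactly the
-- vertices of G outside X, without repetition.

_-_ : ∀ {n} → Graph (Fin n) → (X : Subset n) → Graph (∃[ v ] v ∈ ∁ X)
G - X = record
  { Adj    = λ u v → Adj (proj₁ u) (proj₁ v)
  ; adj?   = λ u v → adj? (proj₁ u) (proj₁ v)
  ; sym    = sym
  ; irrefl = λ { _≡_.refl → irrefl _≡_.refl }
  }
  where open Graph G

-- The cycle root, rest₁, …, restₘ, root.

record Cycle {V : Set} (G : Graph V) : Set where
  open Graph G
  field
    root : V
    rest : List V

  vertices : List V
  vertices = root ∷ rest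

  length : ℕ
  length = List.length vertices

  field
    unique   : Unique vertices
    closed   : Linked Adj (vertices ∷ʳ root)
    length≥3 : 3 ≤ length

open Cycle using (vertices; length) public

HasCycle≥ : ∀ {V} → ℕ → Graph V → Set
HasCycle≥ l G = Σ[ C ∈ Cycle G ] l ≤ length C

HasDisjointCycles≥ : ∀ {V} → ℕ → ℕ → Graph V → Set
HasDisjointCycles≥ k l G =
  Σ[ C ∈ (Fin k → Cycle G) ]
    (∀ i → l ≤ length (C i)) ×
    (∀ i j → i ≢ j → Disjoint (vertices (C i)) (vertices (C j)))

{-# OPTIONS --safe #-}

-- Induct on k. If some cycle has length between l and 6l, delete it. Otherwise
-- every cycle has length less than l (short) or more than 6l (long). Call two
-- edges linked if they are equal or lie on a common short cycle. By the gap this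
-- is an equivalence relation, and a cycle inside one class is short: on a
-- shortest long cycle of the class, distances in the class are distances along
-- the cycle, yet two opposite edges lie on a common short cycle.
--
-- Let H be a subgraph with degrees 2 and 3, all of whose cycles are long, grown
-- from disjoint long cycles by adding ears. If H has many vertices of degree 3,
-- it contains k disjoint cycles: by the Moore bound there is a cycle through
-- O(log k) such vertices, and deleting it reduces |E| - |V| only by that much.
-- Otherwise the process stops, which means that every ear of H between vertices
-- of degree 2 closes up to a short cycle. Then delete
--   the vertices of degree 3,
--   vertices of degree 2 whose two edges are not linked, chosen one by one on
--   cycles of the remaining graph as long as possible; the cyclomatic number
--   of H bounds their number,
--   the vertices in which a long cycle meets H just once; these cycles are
--   disjoint for distinct vertices, so there are fewer than k of them.
-- A surviving long cycle has two consecutive edges that are not linked. They meet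
-- in a vertex v of H. The ears of the cycle can be replaced by linked paths of H,
-- and these reconnect the two neighbours of v in what is left of H, so v should
-- have been deleted.

module Submission where

open import Defs hiding (length)
open import Data.Bool.Base using (Bool; true; false; not; _∧_; _∨_; if_then_else_)
open import Data.Empty using (⊥; ⊥-elim)
open import Data.Fin.Base using (Fin; zero; suc)
import Data.Fin.Properties as Fin
open import Data.Fin.Subset using (Subset; ∣_∣)
open import Data.List.Base using (List; []; _∷_; _++_; [_]; length; map)
open import Data.List.Properties using (length-++; ++-assoc; ++-identityʳ)
open import Data.List.Membership.Propositional using (_∈_; _∉_)
open import Data.List.Membership.Propositional.Properties using (∈-++⁺ˡ; ∈-++⁺ʳ; ∈-++⁻)
open import Data.List.Relation.Binary.Disjoint.Propositional using (Disjoint)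
open import Data.List.Relation.Binary.Permutation.Propositional using (_↭_; ↭-refl; ↭-sym; ↭-trans; ↭-prep; ↭-reflexive)
open import Data.List.Relation.Binary.Permutation.Propositional.Properties using (↭-length; ∈-resp-↭; ++-commutativeMonoid)
open import Data.List.Relation.Binary.Sublist.Propositional as Sublist using ([]; _∷_; _∷ʳ_) renaming (_⊆_ to _⊑_)
import Data.List.Relation.Binary.Sublist.Propositional.Properties as Sublistₚ
open import Data.List.Relation.Unary.All as All using (All; []; _∷_)
open import Data.List.Relation.Unary.AllPairs as AllPairs using (AllPairs; []; _∷_)
open import Data.List.Relation.Unary.Any as Any using (Any; here; there)
open import Data.List.Relation.Unary.Unique.Propositional using (Unique)
import Data.List.Relation.Unary.Unique.Propositional.Properties as Unique
open import Data.List.Relation.Unary.All.Properties using (anti-mono)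
open import Data.Nat.Base
open import Data.Nat.Logarithm using (⌊log₂_⌋; ⌊log₂⌋-mono-≤; ⌊log₂⌊n/2⌋⌋≡⌊log₂n⌋∸1; ⌊log₂[2^n]⌋≡n)
open import Data.Nat.Properties
open import Data.Nat.Tactic.RingSolver using (solve-∀)
open import Data.Product.Base using (Σ-syntax; ∃; ∃₂; ∃-syntax; _×_; _,_; proj₁; proj₂)
open import Data.Sum.Base using (_⊎_; inj₁; inj₂; [_,_]′)
open import Function.Base using (_∘_; id; case_of_; _on_)
open import Relation.Binary.Definitions using (DecidableEquality; Symmetric)
open import Relation.Binary.PropositionalEquality hiding ([_])
open import Relation.Nullary.Decidable using (Dec; yes; no; does; ¬?; _×-dec_; _⊎-dec_; map′)
open import Relation.Nullary.Negation using (¬_; contradiction)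

-- Walks

-- The obstacle is that `H` may have arbitrarily many vertices of degree 2, so only counts that do
-- not see subdivisions are affordable. Since all degrees are 2 and 3, the number of vertices of
-- degree 3 is 2(|E| - |V|). This one quantity pays for the disjoint cycles, for the vertices of
-- degree 3 and, together with the number of components, for the cut vertices. Only vertices whose
-- two edges are not linked are cut, so that paths of `H` inside one class survive: an inner vertex
-- of such a path has two linked edges.
--
-- The term 6kl pays for the deleted cycles of length between l and 6l. The rest comes from 3t + 2k,
-- where 2t vertices of degree 3 force k disjoint cycles: fewer than 2t vertices of degree 3, at
-- most t + k cut vertices and fewer than k vertices that are the only contact of a long cycle with
-- `H`. Each of the k rounds of packing costs about 2 log t in |E| - |V|, and t is itself of order k
-- log k, whence the double logarithm.

infixr 5 _◅_

-- The index lists the vertices after the start, so that indices concatenate by `++` and the length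
-- is the number of edges. Simplicity of a walk is a separate condition `Unique (x ∷ xs)`.
data Walk {V : Set} (R : V → V → Set) : V → List V → V → Set where
  ε   : ∀ {x} → Walk R x [] x
  _◅_ : ∀ {x z zs y} → R x z → Walk R z zs y → Walk R x (z ∷ zs) y

module _ where

  infixr 5 _◅◅_

  private variable
    V : Set
    R R′ : V → V → Set
    P : V → Set
    u v w x y z : V
    as bs xs ys zs : List V

  _◅◅_ : Walk R x xs y → Walk R y ys z → Walk R x (xs ++ ys) z
  ε       ◅◅ w′ = w′
  (r ◅ w) ◅◅ w′ = r ◅ (w ◅◅ w′)

  mapʷ : (∀ {u v} → R u v → R′ u v) → Walk R x xs y → Walk R′ x xs y
  mapʷ f ε       = ε
  mapʷ f (r ◅ w) = f r ◅ mapʷ f w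

  cast : xs ≡ ys → Walk R x xs y → Walk R x ys y
  cast refl w = w

  Unique-resp-↭ : {xs ys : List V} → xs ↭ ys → Unique xs → Unique ys
  Unique-resp-↭ _↭_.refl         u                        = u
  Unique-resp-↭ (_↭_.prep x p)   (px ∷ u)                 = anti-mono (∈-resp-↭ (↭-sym p)) px ∷ Unique-resp-↭ p u
  Unique-resp-↭ (_↭_.swap x y p) ((x≢y ∷ px) ∷ (py ∷ u)) =
    (x≢y ∘ sym ∷ anti-mono (∈-resp-↭ (↭-sym p)) py) ∷ (anti-mono (∈-resp-↭ (↭-sym p)) px ∷ Unique-resp-↭ p u)
  Unique-resp-↭ (_↭_.trans p q)  u                        = Unique-resp-↭ q (Unique-resp-↭ p u)

  Unique-resp-⊑ : {xs ys : List V} → xs ⊑ ys → Unique ys → Unique xs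
  Unique-resp-⊑ []         []       = []
  Unique-resp-⊑ (_ ∷ʳ s)   (_ ∷ u)  = Unique-resp-⊑ s u
  Unique-resp-⊑ (refl ∷ s) (px ∷ u) = anti-mono (Sublist.lookup s) px ∷ Unique-resp-⊑ s u

  Unique-++⁻ : (xs : List V) {ys : List V} → Unique (xs ++ ys) → Unique xs × Unique ys × Disjoint xs ys
  Unique-++⁻ []       u        = [] , u , λ ()
  Unique-++⁻ (x ∷ xs) (px ∷ u) with Unique-++⁻ xs u
  ... | uxs , uys , dj =
    anti-mono ∈-++⁺ˡ px ∷ uxs , uys ,
    λ { (here refl , q) → All.lookup px (∈-++⁺ʳ xs q) refl ; (there p , q) → dj (p , q) }

  ∉-head : {xs : List V} → Unique (x ∷ xs) → x ∉ xs
  ∉-head = Unique.Unique[x∷xs]⇒x∉xs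

  ∉⇒Unique : {xs : List V} → x ∉ xs → Unique xs → Unique (x ∷ xs)
  ∉⇒Unique x∉ u = All.tabulate (λ { q refl → x∉ q }) ∷ u

  last∈ : Walk R x xs y → y ∈ x ∷ xs
  last∈ ε       = here refl
  last∈ (r ◅ w) = there (last∈ w)

  -- The reversed list is known only up to permutation, which is all that lengths, membership and
  -- `Unique` depend on.
  reverseʷ : Symmetric R → Walk R x xs y → ∃ λ ys → Walk R y ys x × y ∷ ys ↭ x ∷ xs
  reverseʷ sy ε = [] , ε , ↭-refl
  reverseʷ {x = x} sy (_◅_ {zs = zs} r w) with reverseʷ sy w
  ... | ys , w′ , p =
    ys ++ [ x ] , w′ ◅◅ (sy r ◅ ε) ,
    ↭-trans (++-comm (_ ∷ ys) [ x ]) (↭-prep x p)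
    where open import Data.List.Relation.Binary.Permutation.Propositional.Properties using (++-comm)

  tail-↭ : {x y : V} {xs ys : List V} → y ∷ ys ↭ x ∷ xs → length ys ≡ length xs
  tail-↭ p = suc-injective (↭-length p)

  splitʷ : Walk R x xs y → v ∈ x ∷ xs →
           ∃₂ λ as bs → xs ≡ as ++ bs × Walk R x as v × Walk R v bs y
  splitʷ w (here refl) = [] , _ , refl , ε , w
  splitʷ (r ◅ w) (there p) with splitʷ w p
  ... | as , bs , eq , w₁ , w₂ = _ ∷ as , bs , cong (_ ∷_) eq , r ◅ w₁ , w₂

  unsnocʷ : Walk R x xs y → x ≢ y →
            ∃₂ λ as u → xs ≡ as ++ [ y ] × Walk R x as u × R u y
  unsnocʷ ε x≢y = contradiction refl x≢y
  unsnocʷ (r ◅ ε) x≢y = [] , _ , refl , ε , r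
  unsnocʷ {R = R} (r ◅ (r′ ◅ w)) x≢y = case snoc r′ w of λ where
      (as , u , eq , w₁ , s) → _ ∷ as , u , cong (_ ∷_) eq , r ◅ w₁ , s
    where
    snoc : ∀ {x z zs y} → R x z → Walk R z zs y →
           ∃₂ λ as u → z ∷ zs ≡ as ++ [ y ] × Walk R x as u × R u y
    snoc r ε = [] , _ , refl , ε , r
    snoc r (r′ ◅ w) with snoc r′ w
    ... | as , u , eq , w₁ , s = _ ∷ as , u , cong (_ ∷_) eq , r ◅ w₁ , s

  suffix⊑ : Walk R x xs y → y ∷ zs ⊑ x ∷ xs ++ zs
  suffix⊑ ε       = Sublist.⊆-refl
  suffix⊑ (_ ◅ w) = _ ∷ʳ suffix⊑ w

  skip⊑ : Walk R x xs y → x ≢ y → y ∷ zs ⊑ xs ++ zs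
  skip⊑ {zs = zs} w x≢y with unsnocʷ w x≢y
  ... | as , _ , refl , _ , _ =
    subst (_ ⊑_) (sym (++-assoc as [ _ ] zs)) (Sublistₚ.++⁺ˡ as Sublist.⊆-refl)

  ++⁺⊑ : (xs : List V) → ys ⊑ zs → xs ++ ys ⊑ xs ++ zs
  ++⁺⊑ xs = Sublistₚ.++⁺ (Sublist.⊆-refl {x = xs})

  -- What remains of a walk after the stretch from `p` to `q` is cut out. A detour from `p` to `q`
  -- can be put in its place, and `shorter` keeps the result simple.
  record Between {V : Set} (R : V → V → Set) (x : V) (xs : List V) (y p q : V) : Set where
    constructor between
    field
      {before after} : List V
      prefix  : Walk R x before p
      suffix  : Walk R q after y
      shorter : (x ∷ before) ++ (q ∷ after) ⊑ x ∷ xs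

  splitBetween : Walk R x xs y → ∀ {p q} → p ∈ x ∷ xs → q ∈ x ∷ xs → p ≢ q →
                 Between R x xs y p q ⊎ Between R x xs y q p
  splitBetween {x = x} w {p} p∈ q∈ p≢q with splitʷ w p∈
  ... | as , bs , refl , w₁ , w₂ with ∈-++⁻ (x ∷ as) q∈
  ... | inj₂ q∈bs with splitʷ w₂ (there q∈bs)
  ... | ms , cs , refl , m , w₃ = inj₁ (between w₁ w₃ (++⁺⊑ (x ∷ as) (skip⊑ m p≢q)))
  splitBetween {x = x} w {p} p∈ q∈ p≢q | as , bs , refl , w₁ , w₂ | inj₁ q∈as with splitʷ w₁ q∈as
  ... | cs , ms , refl , w₀ , m = inj₂ (between w₀ w₂
    (subst (x ∷ cs ++ p ∷ bs ⊑_) (cong (x ∷_) (sym (++-assoc cs ms bs))) (++⁺⊑ (x ∷ cs) (skip⊑ m (p≢q ∘ sym)))))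

  lastHit : (∀ v → Dec (P v)) → Walk R x xs y → P x →
            ∃ λ p → ∃₂ λ as bs → xs ≡ as ++ bs × Walk R x as p × Walk R p bs y × P p × All (¬_ ∘ P) bs
  lastHit P? ε px = _ , [] , [] , refl , ε , ε , px , []
  lastHit {P = P} {R = R} P? (r ◅ w) px with lastHit′ w
    where
    lastHit′ : ∀ {z zs y} → Walk R z zs y → All (¬_ ∘ P) (z ∷ zs) ⊎
      (∃ λ p → ∃₂ λ as bs → zs ≡ as ++ bs × Walk R z as p × Walk R p bs y × P p × All (¬_ ∘ P) bs)
    lastHit′ {z} ε with P? z
    ... | yes pz = inj₂ (z , [] , [] , refl , ε , ε , pz , [])
    ... | no ¬pz = inj₁ (¬pz ∷ [])
    lastHit′ {z} (r ◅ w) with lastHit′ w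
    ... | inj₂ (p , as , bs , eq , w₁ , w₂ , pp , n) =
      inj₂ (p , _ ∷ as , bs , cong (_ ∷_) eq , r ◅ w₁ , w₂ , pp , n)
    ... | inj₁ n with P? z
    ... | yes pz = inj₂ (z , [] , _ , refl , ε , r ◅ w , pz , n)
    ... | no ¬pz = inj₁ (¬pz ∷ n)
  ... | inj₁ n = _ , [] , _ , refl , ε , r ◅ w , px , n
  ... | inj₂ (p , as , bs , eq , w₁ , w₂ , pp , n) =
    p , _ ∷ as , bs , cong (_ ∷_) eq , r ◅ w₁ , w₂ , pp , n

  module _ {V : Set} (_≟_ : DecidableEquality V) where

    open import Data.List.Membership.DecPropositional _≟_ using (_∈?_)

    -- Loop erasure. A sublist, and not just a bound on the length, is what bounds arbitrary weights
    -- of the result.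
    simplify : {R : V → V → Set} {x y : V} {xs : List V} → Walk R x xs y →
               ∃ λ ys → Walk R x ys y × Unique (x ∷ ys) × x ∷ ys ⊑ x ∷ xs
    simplify ε = [] , ε , [] ∷ [] , Sublist.⊆-refl
    simplify {x = x} (r ◅ w) with simplify w
    ... | ys , w′ , u , s with x ∈? (_ ∷ ys)
    ... | no x∉ = _ ∷ ys , r ◅ w′ , ∉⇒Unique x∉ u , refl ∷ s
    ... | yes x∈ with splitʷ w′ x∈
    ... | as , bs , refl , w₁ , w₂ = bs , w₂ , Unique-resp-⊑ (suffix⊑ w₁) u , x ∷ʳ Sublist.⊆-trans (suffix⊑ w₁) s

    walk? : {R : V → V → Set} → (∀ u v → Dec (R u v)) → ∀ x xs y → Dec (Walk R x xs y)
    walk? R? x []       y = map′ (λ { refl → ε }) (λ { ε → refl }) (x ≟ y)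
    walk? R? x (z ∷ zs) y =
      map′ (λ (r , w) → r ◅ w) (λ { (r ◅ w) → r , w }) (R? x z ×-dec walk? R? z zs y)

-- The closing edge is a field of its own, so that the rest is an ordinary walk; `nontrivial` rules
-- out an edge traversed back and forth.
record Cyc {V : Set} (R : V → V → Set) : Set where
  constructor cyc
  field
    {start}    : V
    {rest}     : List V
    {end}      : V
    walk       : Walk R start rest end
    close      : R end start
    simple     : Unique (start ∷ rest)
    nontrivial : 2 ≤ length rest

  support : List V
  support = start ∷ rest

open Cyc using (support)

size : {V : Set} {R : V → V → Set} → Cyc R → ℕ
size C = length (support C)

splitLength : ∀ {V : Set} {R : V → V → Set} {x xs y} i → i ≤ length xs → Walk R x xs y →
              ∃ λ v → ∃₂ λ as bs → xs ≡ as ++ bs × length as ≡ i × Walk R x as v × Walk R v bs y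
splitLength zero    _          w       = _ , [] , _ , refl , refl , ε , w
splitLength (suc i) (s≤s i≤) (r ◅ w) with splitLength i i≤ w
... | v , as , bs , eq , len , w₁ , w₂ = v , _ ∷ as , bs , cong (_ ∷_) eq , cong suc len , r ◅ w₁ , w₂

closed-trivial : ∀ {V : Set} {R : V → V → Set} {x xs} → Walk R x xs x → Unique (x ∷ xs) → xs ≡ []
closed-trivial ε       u = refl
closed-trivial (r ◅ w) u = contradiction (last∈ w) (∉-head u)

module ↭-Solver {V : Set} where
  open import Algebra.Solver.CommutativeMonoid (++-commutativeMonoid {A = V}) public

-- Classes of linked edges

module EdgeClasses
  {V : Set} (_≟_ : DecidableEquality V)
  {R : V → V → Set} (R-sym : Symmetric R) (R-irrefl : ∀ {x} → ¬ R x x)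
  (l : ℕ) (3≤l : 3 ≤ l)
  (gap : (C : Cyc R) → size C ≤ 6 * l → size C < l)
  where

  open import Data.List.Membership.DecPropositional _≟_ using (_∈?_)
  open ↭-Solver {V}

  -- A cycle of length less than l through the edges ab and uw, in the cyclic
  -- order a b … u w …; the degenerate cycle a b a is included.
  record Joined (a b u w : V) : Set where
    constructor joined
    field
      {fore aft} : List V
      edge₁ : R a b
      walk₁ : Walk R b fore u
      edge₂ : R u w
      walk₂ : Walk R w aft a
      simple : Unique ((b ∷ fore) ++ (w ∷ aft))
      short  : length fore + length aft + 2 < l

  swapJ : ∀ {a b u w} → Joined a b u w → Joined u w a b
  swapJ (joined {as} {bs} e₁ w₁ e₂ w₂ u s) =
    joined e₂ w₂ e₁ w₁ (Unique-resp-↭ (solve 2 (λ p q → p ⊕ q ⊜ q ⊕ p) ↭-refl (_ ∷ as) (_ ∷ bs)) u)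
      (subst (λ n → n + 2 < l) (+-comm (length as) (length bs)) s)

  flipJ : ∀ {a b u w} → Joined a b u w → Joined b a w u
  flipJ (joined {as} {bs} e₁ w₁ e₂ w₂ u s) with reverseʷ R-sym w₁ | reverseʷ R-sym w₂
  ... | as′ , w₁′ , p₁ | bs′ , w₂′ , p₂ =
    joined (R-sym e₁) w₂′ (R-sym e₂) w₁′
      (Unique-resp-↭ (↭-trans (++-comm (_ ∷ as) (_ ∷ bs)) (++⁺ (↭-sym p₂) (↭-sym p₁))) u)
      (subst₂ (λ m n → m + n + 2 < l) (sym (tail-↭ p₂)) (sym (tail-↭ p₁))
        (subst (λ n → n + 2 < l) (+-comm (length as) (length bs)) s))
    where open import Data.List.Relation.Binary.Permutation.Propositional.Properties using (++-comm; ++⁺)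

  loopJ : ∀ {a b} → R a b → Joined a b b a
  loopJ e = joined e ε (R-sym e) ε (((λ { refl → R-irrefl e }) ∷ []) ∷ ([] ∷ [])) 3≤l

  -- A bound of 6l on the number of vertices, `length as + length bs + 2`, improves to less than l
  -- by the gap. With both lists empty there is no `Cyc`, but 2 < l.
  joinByGap : ∀ {a b u w as bs} → R a b → Walk R b as u → R u w → Walk R w bs a →
              Unique ((b ∷ as) ++ (w ∷ bs)) → length as + length bs + 2 ≤ 6 * l → Joined a b u w
  joinByGap {as = []}    {[]}   e₁ w₁ e₂ w₂ u s = joined e₁ w₁ e₂ w₂ u 3≤l
  joinByGap {b = b} {w = w} {as = as@(_ ∷ as′)} {bs} e₁ w₁ e₂ w₂ u s =
    joined e₁ w₁ e₂ w₂ u (subst (_< l) len (gap C (subst (_≤ 6 * l) (sym len) s)))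
    where
    len : length ((b ∷ as) ++ (w ∷ bs)) ≡ length as + length bs + 2
    len = trans (length-++ (b ∷ as)) (arith (length as) (length bs))
      where
      arith : ∀ m n → suc m + suc n ≡ m + n + 2
      arith = solve-∀
    C = cyc (w₁ ◅◅ (e₂ ◅ w₂)) e₁ u
      (s≤s (subst (1 ≤_) (sym (length-++ as′ {w ∷ bs})) (≤-trans (s≤s z≤n) (m≤n+m (suc (length bs)) (length as′)))))
  joinByGap {b = b} {w = w} {as = []} {bs@(_ ∷ _)} e₁ w₁ e₂ w₂ u s =
    joined e₁ w₁ e₂ w₂ u (subst (_< l) len (gap C (subst (_≤ 6 * l) (sym len) s)))
    where
    len : length (b ∷ w ∷ bs) ≡ length bs + 2
    len = +-comm 2 (length bs)
    C = cyc (w₁ ◅◅ (e₂ ◅ w₂)) e₁ u (s≤s (s≤s z≤n))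

  private
    -- The new cycle follows the first one from b to p, runs along the ear through cd, and returns
    -- along the first one from q to a. Its two ingredients, part of `L` and `t₁ ++ t₂`, have fewer
    -- than l vertices each, so the gap applies.
    assemble : ∀ {a b c d p q B A t₁ t₂ L} → R a b → Walk R b B p → Walk R p t₁ c → R c d →
               Walk R q t₂ d → Walk R q A a → (b ∷ B) ++ (q ∷ A) ⊑ L → Unique L →
               Unique (t₁ ++ t₂) → Disjoint L (t₁ ++ t₂) →
               length L < l → length (t₁ ++ t₂) < l → Joined a b c d
    assemble {b = b} {d = d} {q = q} {B} {A} {t₁} {t₂} {L} e w₁ w₂ f w₃ w₄ sub uL ut dj L< t<
      with reverseʷ R-sym w₃
    ... | t₂′ , w₃′ , p₃ =
      joinByGap e (w₁ ◅◅ w₂) f (w₃′ ◅◅ w₄) (Unique-resp-↭ perm u) bound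
      where
      u : Unique (((b ∷ B) ++ (q ∷ A)) ++ (t₁ ++ t₂))
      u = Unique.++⁺ (Unique-resp-⊑ sub uL) ut (λ (i , j) → dj (Sublist.lookup sub i , j))
      perm : ((b ∷ B) ++ (q ∷ A)) ++ (t₁ ++ t₂) ↭ (b ∷ B ++ t₁) ++ (d ∷ t₂′ ++ A)
      perm = ↭-trans
        (solve 4 (λ b q∷A t s → (b ⊕ q∷A) ⊕ (t ⊕ s) ⊜ (b ⊕ t) ⊕ (s ⊕ q∷A)) ↭-refl (b ∷ B) (q ∷ A) t₁ t₂)
        (↭ₚ.++⁺ˡ (b ∷ B ++ t₁)
          (↭-trans (solve 3 (λ s q A → s ⊕ (q ⊕ A) ⊜ (q ⊕ s) ⊕ A) ↭-refl t₂ [ q ] A)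
                   (↭ₚ.++⁺ʳ A (↭-sym p₃))))
        where import Data.List.Relation.Binary.Permutation.Propositional.Properties as ↭ₚ
      arith : ∀ n → n + n ≤ 6 * n
      arith n = subst (n + n ≤_) (eq n) (m≤m+n (n + n) (4 * n))
        where
        eq : ∀ n → n + n + 4 * n ≡ 6 * n
        eq = solve-∀
      size-eq : ∀ m n → suc m + suc n ≡ m + n + 2
      size-eq = solve-∀
      bound : length (B ++ t₁) + length (t₂′ ++ A) + 2 ≤ 6 * l
      bound = begin
        length (B ++ t₁) + length (t₂′ ++ A) + 2  ≡⟨ size-eq (length (B ++ t₁)) (length (t₂′ ++ A)) ⟨
        length (b ∷ B ++ t₁) + length (d ∷ t₂′ ++ A)  ≡⟨ length-++ (b ∷ B ++ t₁) ⟨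
        length ((b ∷ B ++ t₁) ++ (d ∷ t₂′ ++ A))  ≡⟨ ↭-length perm ⟨
        length (((b ∷ B) ++ (q ∷ A)) ++ (t₁ ++ t₂))  ≡⟨ length-++ ((b ∷ B) ++ (q ∷ A)) ⟩
        length ((b ∷ B) ++ (q ∷ A)) + length (t₁ ++ t₂)  ≤⟨ +-mono-≤ (≤-trans (Sublistₚ.length-mono-≤ sub) (<⇒≤ L<)) (<⇒≤ t<) ⟩
        l + l  ≤⟨ arith l ⟩
        6 * l  ∎
        where open ≤-Reasoning

  -- The maximal subpath of the second cycle through cd with interior off the
  -- first cycle is an ear of the first cycle.
  theta : ∀ {a b u w c d} → Joined a b u w → Joined u w c d → Joined a b c d ⊎ Joined a b d c
  theta {b = b} {u} {w} {d = d} (joined {as₁} {bs₁} e w₁ _ w₂ u₁ s₁) (joined {as₂} {bs₂} r x₁ f x₂ u₂ s₂)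
    with reverseʷ R-sym x₂
  ... | rs , x₂′ , perm
    with lastHit (_∈? (b ∷ as₁ ++ w ∷ bs₁)) x₁ (∈-++⁺ʳ (b ∷ as₁) (here refl))
       | lastHit (_∈? (b ∷ as₁ ++ w ∷ bs₁)) x₂′ (∈-++⁺ˡ (last∈ w₁))
  ... | p , h₁ , t₁ , refl , y₁ , z₁ , p∈ , off₁ | q , h₂ , t₂ , refl , y₂ , z₂ , q∈ , off₂
    with splitBetween (w₁ ◅◅ (r ◅ w₂)) p∈ q∈ p≢q
    where
    p≢q : p ≢ q
    p≢q refl = proj₂ (proj₂ (Unique-++⁻ (w ∷ h₁ ++ t₁) u₂))
      (∈-++⁺ˡ {xs = w ∷ h₁} (last∈ y₁) , ∈-resp-↭ perm (∈-++⁺ˡ {xs = u ∷ h₂} (last∈ y₂)))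
  ... | bt = case bt of λ where
      -- The direction in which the new cycle traverses cd depends on which end of the ear comes
      -- first on the first cycle after ab.
      (inj₁ (between b₁ b₂ sub)) → inj₁ (assemble e b₁ z₁ f z₂ b₂ sub u₁ ut dj L< t<)
      (inj₂ (between b₁ b₂ sub)) → inj₂ (assemble e b₁ z₂ (R-sym f) z₁ b₂ sub u₁
        (Unique-resp-↭ (++-comm t₁ t₂) ut) (λ (i , j) → dj (i , ∈-resp-↭ (++-comm t₂ t₁) j)) L<
        (subst (_< l) (↭-length (++-comm t₁ t₂)) t<))
    where
    open import Data.List.Relation.Binary.Permutation.Propositional.Properties using (++-comm; ++⁺ˡ)
    size-eq : ∀ m n → suc m + suc n ≡ m + n + 2
    size-eq = solve-∀
    sub-t : t₁ ++ t₂ ⊑ (w ∷ h₁ ++ t₁) ++ (u ∷ h₂ ++ t₂)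
    sub-t = Sublistₚ.++⁺ (w ∷ʳ Sublistₚ.++⁺ˡ h₁ Sublist.⊆-refl) (u ∷ʳ Sublistₚ.++⁺ˡ h₂ Sublist.⊆-refl)
    permU : (w ∷ h₁ ++ t₁) ++ (d ∷ bs₂) ↭ (w ∷ h₁ ++ t₁) ++ (u ∷ h₂ ++ t₂)
    permU = ++⁺ˡ (w ∷ h₁ ++ t₁) (↭-sym perm)
    ut : Unique (t₁ ++ t₂)
    ut = Unique-resp-⊑ sub-t (Unique-resp-↭ permU u₂)
    dj : Disjoint (b ∷ as₁ ++ w ∷ bs₁) (t₁ ++ t₂)
    dj (i , j) with ∈-++⁻ t₁ j
    ... | inj₁ j₁ = All.lookup off₁ j₁ i
    ... | inj₂ j₂ = All.lookup off₂ j₂ i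
    L< : length (b ∷ as₁ ++ w ∷ bs₁) < l
    L< = subst (_< l) (sym (trans (length-++ (b ∷ as₁)) (size-eq (length as₁) (length bs₁)))) s₁
    t< : length (t₁ ++ t₂) < l
    t< = ≤-<-trans (Sublistₚ.length-mono-≤ sub-t)
      (subst (_< l) (sym (trans (↭-length (↭-sym permU))
        (trans (length-++ (w ∷ h₁ ++ t₁)) (size-eq (length (h₁ ++ t₁)) (length bs₂))))) s₂)

  -- Edges are ordered pairs here, hence both directions. `Joined a b a b` is impossible, since b
  -- would occur twice on the cycle, so reflexivity needs `same`.
  data Link (a b u w : V) : Set where
    same : R a b → a ≡ u → b ≡ w → Link a b u w
    fwd  : Joined a b u w → Link a b u w
    bwd  : Joined a b w u → Link a b u w

  Link-flipʳ : ∀ {a b u w} → Link a b u w → Link a b w u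
  Link-flipʳ (same r refl refl) = fwd (loopJ r)
  Link-flipʳ (fwd j)            = bwd j
  Link-flipʳ (bwd j)            = fwd j

  Link-sym : ∀ {a b u w} → Link a b u w → Link u w a b
  Link-sym (same r refl refl) = same r refl refl
  Link-sym (fwd j)            = fwd (swapJ j)
  Link-sym (bwd j)            = bwd (flipJ (swapJ j))

  Link-trans : ∀ {a b u w c d} → Link a b u w → Link u w c d → Link a b c d
  Link-trans (same _ refl refl) q = q
  Link-trans p (same _ refl refl) = p
  Link-trans (fwd j) (fwd k) = [ fwd , bwd ]′ (theta j k)
  Link-trans (fwd j) (bwd k) = [ bwd , fwd ]′ (theta j k)
  Link-trans (bwd j) (fwd k) = [ bwd , fwd ]′ (theta j (flipJ k))
  Link-trans (bwd j) (bwd k) = [ fwd , bwd ]′ (theta j (flipJ k))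

  LinkedTo : V → V → V → V → Set
  LinkedTo a b u w = R u w × Link a b u w

  LinkedTo-sym : ∀ {a b} → Symmetric (LinkedTo a b)
  LinkedTo-sym (r , k) = R-sym r , Link-flipʳ k

  linkWalk : ∀ {x y u v as bs cs} → R y x → Walk R x as u → Walk R u bs v → Walk R v cs y →
             Unique (x ∷ as ++ bs ++ cs) → suc (length (as ++ bs ++ cs)) < l →
             Walk (LinkedTo y x) u bs v
  linkWalk e pre ε suf u s = ε
  linkWalk {x} {as = as} {z ∷ bs} {cs} e pre (r ◅ mid) suf u s =
    (r , fwd (joined e pre r (mid ◅◅ suf) u
      (subst (_< l) (trans (cong suc (length-++ as)) (arith (length as) (length (bs ++ cs)))) s)))
    ◅ linkWalk e (pre ◅◅ (r ◅ ε)) mid suf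
      (subst (λ ys → Unique (x ∷ ys)) (sym (++-assoc as [ z ] (bs ++ cs))) u)
      (subst (λ ys → suc (length ys) < l) (sym (++-assoc as [ z ] (bs ++ cs))) s)
    where
    arith : ∀ m n → suc (m + suc n) ≡ m + n + 2
    arith = solve-∀

  linkCycle : ∀ {x y zs} → R y x → Walk R x zs y → Unique (x ∷ zs) → suc (length zs) < l →
              Walk (LinkedTo y x) x zs y
  linkCycle {x} {zs = zs} e w u s = linkWalk e ε w ε
    (subst (λ ys → Unique (x ∷ ys)) (sym (++-identityʳ zs)) u)
    (subst (λ ys → suc (length ys) < l) (sym (++-identityʳ zs)) s)

  module _ {α β : V} where

    private
      K : V → V → Set
      K = LinkedTo α β

      -- The induction hypothesis in contrapositive form: cycles of the class with fewer edges on
      -- `zs` than `m` are short, so the long ones only begin at `m`.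
      LongCyclesFrom : ℕ → Set
      LongCyclesFrom m = ∀ {x y zs} → length zs < m → Walk K x zs y → K y x → Unique (x ∷ zs) →
                         2 ≤ length zs → suc (length zs) < l

      -- The cycle through the detour stays in the class and is smaller than the given one, hence
      -- short; but the arcs `B` and `A` alone already contribute l vertices.
      detour : ∀ {x y zs B A p c gs ls} → LongCyclesFrom (length zs) → K y x → Unique (x ∷ zs) →
               Walk K x B p → Walk K p gs c → gs ↭ ls ++ [ c ] → Walk K c A y →
               (x ∷ B) ++ (c ∷ A) ⊑ x ∷ zs → Unique ls → All (_∉ x ∷ zs) ls →
               length B + (suc (length ls) + length A) < length zs → l ≤ length B + length A → ⊥
      detour {x} {B = B} {A} {c = c} {gs} {ls} IH e uz w₁ w₂ perm w₃ sub uls off s< l≤ =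
        <⇒≱ (IH (subst (_< _) (sym len) s<) (w₁ ◅◅ (w₂ ◅◅ w₃)) e uniq (≤-trans (n≤1+n 2) (≤-trans 3≤l (≤-trans l≤ ≤len))))
            (m≤n⇒m≤1+n (≤-trans l≤ ≤len))
        where
        len : length (B ++ gs ++ A) ≡ length B + (suc (length ls) + length A)
        len = trans (length-++ B) (cong (length B +_) (trans (length-++ gs)
          (cong (_+ length A) (trans (↭-length perm) (trans (length-++ ls) (+-comm (length ls) 1))))))
        ≤len : length B + length A ≤ length (B ++ gs ++ A)
        ≤len = subst (length B + length A ≤_) (sym len) (+-monoʳ-≤ (length B) (m≤n+m (length A) (suc (length ls))))
        uniq : Unique (x ∷ B ++ gs ++ A)
        uniq = Unique-resp-↭
          (↭-trans (solve 4 (λ B c A ls → (B ⊕ (c ⊕ A)) ⊕ ls ⊜ B ⊕ ((ls ⊕ c) ⊕ A)) ↭-refl (x ∷ B) [ c ] A ls)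
                   (↭ₚ.++⁺ˡ (x ∷ B) (↭ₚ.++⁺ʳ A (↭-sym perm))))
          (Unique.++⁺ (Unique-resp-⊑ sub uz) uls (λ (i , j) → All.lookup off j (Sublist.lookup sub i)))
          where import Data.List.Relation.Binary.Permutation.Propositional.Properties as ↭ₚ

    -- A walk inside the class starting at p moves along the cycle no faster than
    -- its length: a shortcut would give a shorter long cycle in the class.
    confined : ∀ {x y zs} → LongCyclesFrom (length zs) → Walk K x zs y → K y x → Unique (x ∷ zs) →
               ∀ {p ys zs′} → zs ≡ ys ++ zs′ → Walk K x ys p → Walk K p zs′ y →
               ∀ {c ls ts} → Walk K p ls c → All (_∉ x ∷ zs) ls → Walk K c ts x → Unique (p ∷ ls ++ ts) →
               l + (length ls + length ts) ≤ length ys → l + (length ls + length ts) ≤ length zs′ → ⊥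
    confined {x = x} IH cw ce cu {ys = ys} refl pre suf leg off ε u b₁ b₂ with last∈ leg
    ... | there i = All.lookup off i (here refl)
    ... | here refl with closed-trivial pre (proj₁ (Unique-++⁻ (x ∷ ys) cu))
    ... | refl = contradiction (≤-trans (m≤m+n l _) b₁) (<⇒≱ (≤-trans (s≤s z≤n) 3≤l))
    confined {x} {y} {zs} IH cw ce cu {p} {ys} {zs′} refl pre suf {c} {ls} {c′ ∷ ts} leg off (r ◅ rest) u b₁ b₂
      with c′ ∈? (x ∷ zs)
    ... | no c′∉ = confined IH cw ce cu refl pre suf (leg ◅◅ (r ◅ ε))
      (All.tabulate λ i → [ All.lookup off , (λ { (here refl) → c′∉ }) ]′ (∈-++⁻ ls i))
      rest (subst (λ ls → Unique (p ∷ ls)) (sym (++-assoc ls [ c′ ] ts)) u)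
      (subst (λ n → l + n ≤ length ys) move b₁) (subst (λ n → l + n ≤ length zs′) move b₂)
      where
      move : length ls + suc (length ts) ≡ length (ls ++ [ c′ ]) + length ts
      move = trans (arith (length ls) (length ts)) (cong (_+ length ts) (sym (length-++ ls)))
        where
        arith : ∀ m n → m + suc n ≡ m + 1 + n
        arith = solve-∀
    ... | yes c′∈ = hit (∈-++⁻ (x ∷ ys) c′∈)
      where
      ut : Unique (c′ ∷ ts)
      ut = proj₁ (proj₂ (Unique-++⁻ (p ∷ ls) u))
      uls : Unique ls
      uls = AllPairs.tail (proj₁ (Unique-++⁻ (p ∷ ls) u))
      p≢c′ : p ≢ c′
      p≢c′ refl = proj₂ (proj₂ (Unique-++⁻ (p ∷ ls) u)) (here refl , here refl)
      leg′ : Walk K p (ls ++ [ c′ ]) c′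
      leg′ = leg ◅◅ (r ◅ ε)
      weaken : ∀ {n} → l + (length ls + suc (length ts)) ≤ n → l + length ts ≤ n
      weaken = ≤-trans (+-monoʳ-≤ l (≤-trans (n≤1+n _) (m≤n+m _ (length ls))))
      l≤ : ∀ {n} → l + (length ls + suc (length ts)) ≤ n → l ≤ n
      l≤ = ≤-trans (m≤m+n l _)
      shrink : ∀ {M N} → M ≤ suc (length ls) → l + (length ls + suc (length ts)) ≤ M + N → l + length ts ≤ N
      shrink {M} {N} M≤ b = +-cancelˡ-≤ (suc (length ls)) _ _ (≤-trans (≤-reflexive (arith l (length ls) (length ts)))
        (≤-trans b (+-monoˡ-≤ N M≤)))
        where
        arith : ∀ l m n → suc m + (l + n) ≡ l + (m + suc n)
        arith = solve-∀
      hit : c′ ∈ x ∷ ys ⊎ c′ ∈ zs′ → ⊥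
      hit (inj₂ i) with splitʷ suf (there i)
      -- If the cycle reaches c′ from p at least as fast as the walk does, the remaining budget
      -- still suffices at c′. Otherwise the excursion is a shortcut, and `detour` applies.
      ... | ms , A , refl , mid , suf′ with length ms ≤? suc (length ls)
      ... | yes short =
        confined IH cw ce cu (sym (++-assoc ys ms A)) (pre ◅◅ mid) suf′ ε [] rest ut
          (≤-trans (weaken b₁) (≤-trans (m≤m+n _ _) (≤-reflexive (sym (length-++ ys)))))
          (shrink short (subst (_ ≤_) (length-++ ms) b₂))
      ... | no ¬short = detour IH ce cu pre leg′ ↭-refl suf′ (++⁺⊑ (x ∷ ys) (skip⊑ mid p≢c′)) uls off
        (subst (_ <_) (sym (trans (length-++ ys) (cong (length ys +_) (length-++ ms))))
          (+-monoʳ-< (length ys) (+-monoˡ-< (length A) (≰⇒> ¬short))))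
        (≤-trans (l≤ b₁) (m≤m+n _ _))
      hit (inj₁ i) with splitʷ pre i
      ... | B , ms , refl , pre′ , mid with length ms ≤? suc (length ls)
      ... | yes short =
        confined IH cw ce cu (++-assoc B ms zs′) pre′ (mid ◅◅ suf) ε [] rest ut
          (shrink short (subst (_ ≤_) (trans (length-++ B) (+-comm (length B) (length ms))) b₁))
          (≤-trans (weaken b₂) (≤-trans (m≤n+m _ _) (≤-reflexive (sym (length-++ ms)))))
      ... | no ¬short with reverseʷ LinkedTo-sym leg′
      ... | gs , back , perm = detour IH ce cu pre′ back
        (drop-∷ (↭-trans perm (solve 3 (λ p ls c → p ⊕ (ls ⊕ c) ⊜ c ⊕ (ls ⊕ p)) ↭-refl [ p ] ls [ c′ ])))
        suf (subst (x ∷ B ++ p ∷ zs′ ⊑_) (cong (x ∷_) (sym (++-assoc B ms zs′))) (++⁺⊑ (x ∷ B) (skip⊑ mid (p≢c′ ∘ sym))))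
        uls off
        (subst (_ <_) (sym (trans (length-++ (B ++ ms)) (trans (cong (_+ length zs′) (length-++ B)) (+-assoc (length B) _ _))))
          (+-monoʳ-< (length B) (+-monoˡ-< (length zs′) (≰⇒> ¬short))))
        (≤-trans (l≤ b₂) (m≤n+m _ _))
        where open import Data.List.Relation.Binary.Permutation.Propositional.Properties using (drop-∷)

    monochromatic-short : ∀ {x y zs} → Walk K x zs y → K y x → Unique (x ∷ zs) → 2 ≤ length zs →
                          suc (length zs) < l
    monochromatic-short w e u 2≤ = <-rec P step _ refl w e u 2≤
      where
      open import Data.Nat.Induction using (<-rec)
      P : ℕ → Set
      P m = ∀ {x y zs} → length zs ≡ m → Walk K x zs y → K y x → Unique (x ∷ zs) → 2 ≤ length zs → suc (length zs) < l
      step : ∀ m → (∀ {k} → k < m → P k) → P m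
      step m rec {x} {y} {zs} refl w e u 2≤ with suc (length zs) <? l
      ... | yes p = p
      ... | no p = ⊥-elim (opposite (splitLength (3 * l) 3l≤ w))
        where
        IH : LongCyclesFrom (length zs)
        IH s< = rec s< refl
        6l≤ : 6 * l ≤ length zs
        6l≤ = ≮⇒≥ λ s< → p (gap (cyc (mapʷ proj₁ w) (proj₁ e) u 2≤) s<)
        3l≤ : 3 * l ≤ length zs
        3l≤ = ≤-trans (*-monoˡ-≤ l {3} {6} (s≤s (s≤s (s≤s z≤n)))) 6l≤
        -- The edge vz is opposite to yx on the cycle, yet lies with it on a short cycle.
        opposite : (∃ λ v → ∃₂ λ as bs → zs ≡ as ++ bs × length as ≡ 3 * l × Walk K x as v × Walk K v bs y) → ⊥
        opposite (v , as , bs , refl , len , w₁ , w₂) = far w₂ bs≥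
          where
          bs≥ : 3 * l ≤ length bs
          bs≥ = +-cancelˡ-≤ (3 * l) _ _ (≤-trans (≤-reflexive (arith l)) (≤-trans 6l≤ (≤-reflexive (trans (length-++ as) (cong (_+ length bs) len)))))
            where
            arith : ∀ n → 3 * n + 3 * n ≡ 6 * n
            arith = solve-∀
          fore< : ∀ {c d} (j : Joined y x c d) → suc (length (Joined.fore j)) < l
          fore< j = ≤-<-trans (≤-trans (m≤m+n _ (suc (length (Joined.aft j))))
            (≤-reflexive (arith (length (Joined.fore j)) (length (Joined.aft j))))) (Joined.short j)
            where
            arith : ∀ m n → suc m + suc n ≡ m + n + 2
            arith = solve-∀
          forePath : ∀ {c d} (j : Joined y x c d) → Walk K x (Joined.fore j) c
          forePath (joined {fore} {aft} e₁ x₁ e₂ x₂ ux sx) =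
            mapʷ (λ (r , k) → r , Link-trans (proj₂ e) k)
              (linkWalk e₁ ε x₁ (e₂ ◅ x₂) ux (subst (_< l) (sym (trans (cong suc (length-++ fore)) (arith (length fore) (length aft)))) sx))
            where
            arith : ∀ m n → suc (m + suc n) ≡ m + n + 2
            arith = solve-∀
          -- The short cycle through yx and the opposite edge yields a walk of the class with fewer
          -- than l edges between x and `t`, while at least 3l - 1 edges of the long cycle lie on
          -- either side of `t`. Read from `t` back to x, it contradicts `confined`, which asks for
          -- l edges more than the walk has on either side.
          near : ∀ {t fore} → Walk K x fore t → Unique (x ∷ fore) → suc (length fore) < l →
                 ∀ {ys zs′} → zs ≡ ys ++ zs′ → Walk K x ys t → Walk K t zs′ y → 3 * l ≤ length ys → 3 * l ≤ suc (length zs′) → ⊥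
          near {t} {fore} T uT T< {ys} {zs′} eq pre suf ys≥ zs≥ with reverseʷ LinkedTo-sym T
          ... | ts , T′ , perm = confined IH w e u eq pre suf ε [] T′ (Unique-resp-↭ (↭-sym perm) uT)
            (≤-trans (m≤n+m _ 2) (≤-trans bound ys≥)) (≤-trans (n≤1+n _) (≤-pred (≤-trans bound zs≥)))
            where
            bound : suc (suc (l + length ts)) ≤ 3 * l
            bound = begin
              suc (suc (l + length ts))  ≡⟨ arith₁ l (length ts) ⟩
              l + suc (suc (length ts))  ≡⟨ cong (λ n → l + suc (suc n)) (tail-↭ perm) ⟩
              l + suc (suc (length fore)) ≤⟨ +-monoʳ-≤ l T< ⟩
              l + l      ≤⟨ m≤m+n (l + l) l ⟩
              l + l + l  ≡⟨ arith₂ l ⟩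
              3 * l      ∎
              where
              open ≤-Reasoning
              arith₁ : ∀ l n → suc (suc (l + n)) ≡ l + suc (suc n)
              arith₁ = solve-∀
              arith₂ : ∀ l → l + l + l ≡ 3 * l
              arith₂ = solve-∀
          far : Walk K v bs y → 3 * l ≤ length bs → ⊥
          far ε b = contradiction (≤-trans (m≤m+n l _) b) (<⇒≱ (≤-trans (s≤s z≤n) 3≤l))
          far (_◅_ {z = z} {zs = bs′} k w₂′) b with Link-trans (Link-sym (proj₂ e)) (proj₂ k)
          ... | same _ _ refl = ∉-head u (∈-++⁺ʳ as (here refl))
          ... | fwd j = near (forePath j) (proj₁ (Unique-++⁻ (x ∷ Joined.fore j) (Joined.simple j))) (fore< j)
                          refl w₁ (k ◅ w₂′) (≤-reflexive (sym len)) (m≤n⇒m≤1+n b)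
          ... | bwd j = near (forePath j) (proj₁ (Unique-++⁻ (x ∷ Joined.fore j) (Joined.simple j))) (fore< j)
                          (sym (++-assoc as [ z ] bs′)) (w₁ ◅◅ (k ◅ ε)) w₂′
                          (subst (3 * l ≤_) (sym (length-++ as)) (≤-trans (≤-reflexive (sym len)) (m≤m+n _ 1))) b

-- Counting in finite graphs

import Algebra.Properties.CommutativeMonoid.Sum +-0-commutativeMonoid as Sum
open import Algebra.Properties.Semiring.Sum +-*-semiring using (*-distribˡ-sum)

ind : Bool → ℕ
ind true  = 1
ind false = 0

infix 9 ⁅_⁆
⁅_⁆ : ∀ {n} → Fin n → Fin n → Bool
⁅ v ⁆ u = does (u Fin.≟ v)

⁅⁆-refl : ∀ {n} (v : Fin n) → ⁅ v ⁆ v ≡ true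
⁅⁆-refl v with v Fin.≟ v
... | yes _ = refl
... | no ≢  = contradiction refl ≢

⁅⁆⇒≡ : ∀ {n} {u v : Fin n} → ⁅ v ⁆ u ≡ true → u ≡ v
⁅⁆⇒≡ {u = u} {v} eq with u Fin.≟ v
... | yes p = p

⁅⁆-≢ : ∀ {n} {u v : Fin n} → u ≢ v → ⁅ v ⁆ u ≡ false
⁅⁆-≢ {u = u} {v} u≢v with u Fin.≟ v
... | yes p = contradiction p u≢v
... | no _  = refl

⁅⁆-suc : ∀ {n} (v u : Fin n) → ⁅ suc v ⁆ (suc u) ≡ ⁅ v ⁆ u
⁅⁆-suc v u with u Fin.≟ v
... | yes _ = refl
... | no _  = refl

-- Opaque, so that unification can invert it.
opaque

  sum : ∀ {n} → (Fin n → ℕ) → ℕ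
  sum = Sum.sum

  sum-cong : ∀ {n} {f g : Fin n → ℕ} → (∀ i → f i ≡ g i) → sum f ≡ sum g
  sum-cong = Sum.sum-cong-≗

  sum-+ : ∀ {n} (f g : Fin n → ℕ) → sum (λ i → f i + g i) ≡ sum f + sum g
  sum-+ = Sum.∑-distrib-+

  sum-swap : ∀ {m n} (f : Fin m → Fin n → ℕ) → sum (λ i → sum (f i)) ≡ sum (λ j → sum (λ i → f i j))
  sum-swap = Sum.∑-comm

  *-distribˡ-∑ : ∀ {n} k (f : Fin n → ℕ) → k * sum f ≡ sum (λ i → k * f i)
  *-distribˡ-∑ = *-distribˡ-sum

  sum-mono : ∀ {n} {f g : Fin n → ℕ} → (∀ i → f i ≤ g i) → sum f ≤ sum g
  sum-mono {zero}  f≤g = z≤n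
  sum-mono {suc n} f≤g = +-mono-≤ (f≤g zero) (sum-mono (f≤g ∘ suc))

  sum-zero : ∀ {n} {f : Fin n → ℕ} → (∀ i → f i ≡ 0) → sum f ≡ 0
  sum-zero {zero}  f≡0 = refl
  sum-zero {suc n} f≡0 = cong₂ _+_ (f≡0 zero) (sum-zero (f≡0 ∘ suc))

  term≤sum : ∀ {n} (f : Fin n → ℕ) i → f i ≤ sum f
  term≤sum f zero    = m≤m+n _ _
  term≤sum f (suc i) = ≤-trans (term≤sum (f ∘ suc) i) (m≤n+m _ _)

  positive-term : ∀ {n} {f : Fin n → ℕ} → 1 ≤ sum f → ∃ λ i → 1 ≤ f i
  positive-term {suc n} {f} p with f zero in eq
  ... | suc m = zero , subst (1 ≤_) (sym eq) (s≤s z≤n)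
  ... | zero with positive-term p
  ... | i , q = suc i , q

  sum-⁅⁆ : ∀ {n} (v : Fin n) (f : Fin n → ℕ) → sum (λ u → ind (⁅ v ⁆ u) * f u) ≡ f v
  sum-⁅⁆ zero    f = trans (cong₂ _+_ (+-identityʳ (f zero)) (sum-zero {f = λ u → ind (⁅ zero ⁆ (suc u)) * f (suc u)} λ _ → refl)) (+-identityʳ _)
  sum-⁅⁆ (suc v) f = trans (sum-cong λ u → cong (λ b → ind b * f (suc u)) (⁅⁆-suc v u)) (sum-⁅⁆ v (f ∘ suc))

_⊆ᵇ_ : ∀ {n} → (Fin n → Bool) → (Fin n → Bool) → Set
S ⊆ᵇ T = ∀ v → S v ≡ true → T v ≡ true

_∖_ : ∀ {n} → (Fin n → Bool) → Fin n → Fin n → Bool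
(S ∖ v) u = S u ∧ not (⁅ v ⁆ u)

∖⊆ : ∀ {n} {S : Fin n → Bool} {v} → (S ∖ v) ⊆ᵇ S
∖⊆ {S = S} u p with S u
... | true = refl

∖-self : ∀ {n} (S : Fin n → Bool) v → (S ∖ v) v ≡ false
∖-self S v rewrite ⁅⁆-refl v with S v
... | true  = refl
... | false = refl

∖-other : ∀ {n} (S : Fin n → Bool) {u v} → u ≢ v → (S ∖ v) u ≡ S u
∖-other S {u} u≢v rewrite ⁅⁆-≢ u≢v with S u
... | true  = refl
... | false = refl

ind-mono : ∀ {n} {S T : Fin n → Bool} → S ⊆ᵇ T → ∀ v → ind (S v) ≤ ind (T v)
ind-mono {S = S} {T} S⊆T v with S v in eq
... | false = z≤n
... | true rewrite S⊆T v eq = ≤-refl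

ind-pos : ∀ {b} → 1 ≤ ind b → b ≡ true
ind-pos {true} _ = refl

true≢false : ∀ {b} → b ≡ true → b ≡ false → ⊥
true≢false refl ()

card : ∀ {n} → (Fin n → Bool) → ℕ
card S = sum (ind ∘ S)

card-mono : ∀ {n} {S T : Fin n → Bool} → S ⊆ᵇ T → card S ≤ card T
card-mono {S = S} {T} S⊆T = sum-mono (ind-mono {S = S} {T} S⊆T)

card-⁅⁆ : ∀ {n} (v : Fin n) → card ⁅ v ⁆ ≡ 1
card-⁅⁆ v = trans (sum-cong λ u → sym (*-identityʳ (ind (⁅ v ⁆ u)))) (sum-⁅⁆ v (λ _ → 1))

∖-split : ∀ {n} {S : Fin n → Bool} {v} → S v ≡ true → ∀ u → ind (S u) ≡ ind (⁅ v ⁆ u) + ind ((S ∖ v) u)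
∖-split {S = S} {v} Sv u with u Fin.≟ v
... | yes refl rewrite Sv = refl
... | no _ with S u
... | true  = refl
... | false = refl

card-∖ : ∀ {n} {S : Fin n → Bool} {v} → S v ≡ true → card S ≡ suc (card (S ∖ v))
card-∖ {S = S} {v} Sv = trans (sum-cong (∖-split {S = S} Sv)) (trans (sum-+ (ind ∘ ⁅ v ⁆) (ind ∘ (S ∖ v))) (cong (_+ card (S ∖ v)) (card-⁅⁆ v)))

module Counting {n : ℕ} (H : Graph (Fin n)) where
  open Graph H renaming (sym to adj-sym)

  edge : Fin n → Fin n → ℕ
  edge u v = ind (does (adj? u v))

  edge-adj : ∀ {u v} → Adj u v → edge u v ≡ 1
  edge-adj {u} {v} a with adj? u v
  ... | yes _ = refl
  ... | no ¬a = contradiction a ¬a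

  adj-edge : ∀ {u v} → 1 ≤ edge u v → Adj u v
  adj-edge {u} {v} p with adj? u v
  ... | yes a = a

  edge-sym : ∀ u v → edge u v ≡ edge v u
  edge-sym u v with adj? u v | adj? v u
  ... | yes _ | yes _ = refl
  ... | no _  | no _  = refl
  ... | yes a | no ¬a = contradiction (adj-sym a) ¬a
  ... | no ¬a | yes a = contradiction (adj-sym a) ¬a

  edge-irrefl : ∀ u → edge u u ≡ 0
  edge-irrefl u with adj? u u
  ... | yes a = contradiction a (irrefl refl)
  ... | no _  = refl

  degree : (Fin n → ℕ) → Fin n → ℕ
  degree t u = sum λ w → t w * edge u w

  -- The bilinear form of the adjacency matrix. On indicator functions it counts ordered adjacent
  -- pairs.
  ⟨_,_⟩ : (Fin n → ℕ) → (Fin n → ℕ) → ℕ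
  ⟨ s , t ⟩ = sum λ u → s u * degree t u

  degree-cong : ∀ s t → (∀ v → s v ≡ t v) → ∀ u → degree s u ≡ degree t u
  degree-cong s t s≡t u = sum-cong λ w → cong (_* edge u w) (s≡t w)

  degree-mono : ∀ {s t} → (∀ v → s v ≤ t v) → ∀ u → degree s u ≤ degree t u
  degree-mono s≤t u = sum-mono λ w → *-monoˡ-≤ (edge u w) (s≤t w)

  degree-+ : ∀ s t u → degree (λ v → s v + t v) u ≡ degree s u + degree t u
  degree-+ s t u = trans (sum-cong λ w → *-distribʳ-+ (edge u w) (s w) (t w)) (sum-+ _ _)

  degree-⁅⁆ : ∀ v u → degree (ind ∘ ⁅ v ⁆) u ≡ edge u v
  degree-⁅⁆ v u = sum-⁅⁆ v (edge u)

  ⟨⟩-cong : ∀ s t → (∀ v → s v ≡ t v) → ⟨ s , s ⟩ ≡ ⟨ t , t ⟩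
  ⟨⟩-cong s t s≡t = sum-cong λ u → cong₂ _*_ (s≡t u) (degree-cong s t s≡t u)

  ⟨⟩-sym : ∀ s t → ⟨ s , t ⟩ ≡ ⟨ t , s ⟩
  ⟨⟩-sym s t = begin
    (sum λ u → s u * sum λ w → t w * edge u w)  ≡⟨ sum-cong (λ u → *-distribˡ-∑ (s u) (λ w → t w * edge u w)) ⟩
    (sum λ u → sum λ w → s u * (t w * edge u w)) ≡⟨ sum-swap (λ u w → s u * (t w * edge u w)) ⟩
    (sum λ w → sum λ u → s u * (t w * edge u w)) ≡⟨ sum-cong (λ w → sum-cong λ u → trans (arith (s u) (t w) (edge u w)) (cong (λ e → t w * (s u * e)) (edge-sym u w))) ⟩
    (sum λ w → sum λ u → t w * (s u * edge w u)) ≡⟨ sum-cong (λ w → *-distribˡ-∑ (t w) (λ u → s u * edge w u)) ⟨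
    (sum λ w → t w * sum λ u → s u * edge w u)  ∎
    where
    open ≡-Reasoning
    arith : ∀ a b c → a * (b * c) ≡ b * (a * c)
    arith = solve-∀

  ⟨⟩-+ˡ : ∀ s s′ t → ⟨ (λ v → s v + s′ v) , t ⟩ ≡ ⟨ s , t ⟩ + ⟨ s′ , t ⟩
  ⟨⟩-+ˡ s s′ t = trans (sum-cong λ u → *-distribʳ-+ (degree t u) (s u) (s′ u)) (sum-+ _ _)

  ⟨⟩-+ʳ : ∀ s t t′ → ⟨ s , (λ v → t v + t′ v) ⟩ ≡ ⟨ s , t ⟩ + ⟨ s , t′ ⟩
  ⟨⟩-+ʳ s t t′ = trans (⟨⟩-sym s (λ v → t v + t′ v)) (trans (⟨⟩-+ˡ t t′ s) (cong₂ _+_ (⟨⟩-sym t s) (⟨⟩-sym t′ s)))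

  ⟨⟩-square : ∀ s t → ⟨ (λ v → s v + t v) , (λ v → s v + t v) ⟩ ≡ ⟨ s , s ⟩ + 2 * ⟨ t , s ⟩ + ⟨ t , t ⟩
  ⟨⟩-square s t = begin
    ⟨ (λ v → s v + t v) , (λ v → s v + t v) ⟩              ≡⟨ ⟨⟩-+ˡ s t (λ v → s v + t v) ⟩
    ⟨ s , (λ v → s v + t v) ⟩ + ⟨ t , (λ v → s v + t v) ⟩  ≡⟨ cong₂ _+_ (⟨⟩-+ʳ s s t) (⟨⟩-+ʳ t s t) ⟩
    ⟨ s , s ⟩ + ⟨ s , t ⟩ + (⟨ t , s ⟩ + ⟨ t , t ⟩)        ≡⟨ cong (λ x → ⟨ s , s ⟩ + x + (⟨ t , s ⟩ + ⟨ t , t ⟩)) (⟨⟩-sym s t) ⟩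
    ⟨ s , s ⟩ + ⟨ t , s ⟩ + (⟨ t , s ⟩ + ⟨ t , t ⟩)        ≡⟨ arith ⟨ s , s ⟩ ⟨ t , s ⟩ ⟨ t , t ⟩ ⟩
    ⟨ s , s ⟩ + 2 * ⟨ t , s ⟩ + ⟨ t , t ⟩                  ∎
    where
    open ≡-Reasoning
    arith : ∀ a b c → a + b + (b + c) ≡ a + 2 * b + c
    arith = solve-∀

  deg : (Fin n → Bool) → Fin n → ℕ
  deg S = degree (ind ∘ S)

  -- Twice the number of edges inside S.
  vol : (Fin n → Bool) → ℕ
  vol S = ⟨ ind ∘ S , ind ∘ S ⟩

  deg-mono : ∀ {S T} → S ⊆ᵇ T → ∀ v → deg S v ≤ deg T v
  deg-mono {S} {T} S⊆T = degree-mono (ind-mono {S = S} {T} S⊆T)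

  deg-∖ : ∀ {S u} → S u ≡ true → ∀ v → deg S v ≡ edge v u + deg (S ∖ u) v
  deg-∖ {S} {u} Su v = trans (degree-cong (ind ∘ S) (λ w → ind (⁅ u ⁆ w) + ind ((S ∖ u) w)) (∖-split {S = S} Su) v)
    (trans (degree-+ (ind ∘ ⁅ u ⁆) (ind ∘ (S ∖ u)) v) (cong (_+ deg (S ∖ u) v) (degree-⁅⁆ u v)))

  deg-∖-self : ∀ {S v} → S v ≡ true → deg S v ≡ deg (S ∖ v) v
  deg-∖-self {S} {v} Sv = trans (deg-∖ {S} Sv v) (cong (_+ deg (S ∖ v) v) (edge-irrefl v))

  vol-∖ : ∀ {S v} → S v ≡ true → vol S ≡ vol (S ∖ v) + 2 * deg S v
  vol-∖ {S} {v} Sv = begin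
    vol S  ≡⟨ ⟨⟩-cong (ind ∘ S) (λ u → δ u + s u) (∖-split {S = S} Sv) ⟩
    ⟨ (λ u → δ u + s u) , (λ u → δ u + s u) ⟩  ≡⟨ ⟨⟩-square δ s ⟩
    ⟨ δ , δ ⟩ + 2 * ⟨ s , δ ⟩ + ⟨ s , s ⟩  ≡⟨ cong₂ (λ a b → a + 2 * b + ⟨ s , s ⟩) δδ (trans (⟨⟩-sym s δ) (trans (sum-⁅⁆ v (degree s)) (sym (deg-∖-self {S} Sv)))) ⟩
    2 * deg S v + ⟨ s , s ⟩  ≡⟨ +-comm (2 * deg S v) _ ⟩
    ⟨ s , s ⟩ + 2 * deg S v  ∎
    where
    open ≡-Reasoning
    δ = ind ∘ ⁅ v ⁆
    s = ind ∘ (S ∖ v)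
    δδ : ⟨ δ , δ ⟩ ≡ 0
    δδ = trans (sum-⁅⁆ v (degree δ)) (trans (degree-⁅⁆ v v) (edge-irrefl v))

  neighbour : ∀ {S v} → 1 ≤ deg S v → ∃ λ u → S u ≡ true × Adj v u
  neighbour {S} {v} p with positive-term p
  ... | u , q with S u in eq
  ... | true = u , eq , adj-edge (subst (1 ≤_) (+-identityʳ _) q)

  deg-adj : ∀ {S u v} → S u ≡ true → Adj v u → deg S v ≡ suc (deg (S ∖ u) v)
  deg-adj {S} {u} {v} Su a = trans (deg-∖ {S} Su v) (cong (_+ deg (S ∖ u) v) (edge-adj a))

  neighbour₂ : ∀ {S v} → 2 ≤ deg S v → ∃₂ λ u w → u ≢ w × S u ≡ true × S w ≡ true × Adj v u × Adj v w
  neighbour₂ {S} {v} p with neighbour {S} (≤-trans (n≤1+n 1) p)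
  ... | u , Su , a with neighbour {S ∖ u} {v} (≤-pred (subst (2 ≤_) (deg-adj {S} Su a) p))
  ... | w , S∖w , b = u , w , (λ { refl → true≢false S∖w (∖-self S u) }) , Su , ∖⊆ {S = S} w S∖w , a , b

weight : {V : Set} → (V → ℕ) → List V → ℕ
weight c []       = 0
weight c (x ∷ xs) = c x + weight c xs

module _ {V : Set} (c : V → ℕ) where

  weight-++ : ∀ xs {ys} → weight c (xs ++ ys) ≡ weight c xs + weight c ys
  weight-++ []       = refl
  weight-++ (x ∷ xs) = trans (cong (c x +_) (weight-++ xs)) (sym (+-assoc (c x) _ _))

  weight-⊑ : ∀ {xs ys} → xs ⊑ ys → weight c xs ≤ weight c ys
  weight-⊑ []         = z≤n
  weight-⊑ (y ∷ʳ s)   = ≤-trans (weight-⊑ s) (m≤n+m _ (c y))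
  weight-⊑ (refl ∷ s) = +-monoʳ-≤ _ (weight-⊑ s)

  weight-↭ : ∀ {xs ys} → xs ↭ ys → weight c xs ≡ weight c ys
  weight-↭ _↭_.refl          = refl
  weight-↭ (_↭_.prep x p)    = cong (c x +_) (weight-↭ p)
  weight-↭ (_↭_.swap x y p)  = trans (cong (λ w → c x + (c y + w)) (weight-↭ p)) (arith (c x) (c y) _)
    where
    arith : ∀ a b d → a + (b + d) ≡ b + (a + d)
    arith = solve-∀
  weight-↭ (_↭_.trans p q)   = trans (weight-↭ p) (weight-↭ q)

module _ {n : ℕ} {P : Fin n → Set} (P? : ∀ v → Dec (P v)) where

  ⟦_⟧ : Fin n → Bool
  ⟦ v ⟧ = does (P? v)

  holds : ∀ {v} → ⟦ v ⟧ ≡ true → P v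
  holds {v} eq with P? v
  ... | yes p = p

  ⟦⟧-true : ∀ {v} → P v → ⟦ v ⟧ ≡ true
  ⟦⟧-true {v} p with P? v
  ... | yes _ = refl
  ... | no ¬p = contradiction p ¬p

_≟ᵇ_ : (a b : Bool) → Dec (a ≡ b)
_≟ᵇ_ = Bool._≟_
  where import Data.Bool.Properties as Bool

ind-∨ : ∀ {a b} → (b ≡ true → a ≡ false) → ind (a ∨ b) ≡ ind a + ind b
ind-∨ {false}        f = refl
ind-∨ {true} {false} f = refl
ind-∨ {true} {true}  f = contradiction (f refl) λ ()

sum-∨ : ∀ {n} (T M : Fin n → Bool) (f : Fin n → ℕ) → (∀ v → M v ≡ true → T v ≡ false) →
        sum (λ v → ind (T v ∨ M v) * f v) ≡ sum (λ v → ind (T v) * f v) + sum (λ v → ind (M v) * f v)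
sum-∨ T M f dj = trans (sum-cong λ v → trans (cong (_* f v) (ind-∨ (dj v))) (*-distribʳ-+ (f v) (ind (T v)) (ind (M v)))) (sum-+ _ _)

card-∨ : ∀ {n} (T M : Fin n → Bool) → (∀ v → M v ≡ true → T v ≡ false) →
         card (λ v → T v ∨ M v) ≡ card T + card M
card-∨ T M dj = trans (sum-cong λ v → ind-∨ (dj v)) (sum-+ (ind ∘ T) (ind ∘ M))

-- A Moore bound that ignores subdivisions

module Moore {n : ℕ} (H : Graph (Fin n)) (S : Fin n → Bool) where
  open Graph H renaming (sym to adj-sym)
  open Counting H

  Within : (Fin n → Bool) → Fin n → Fin n → Set
  Within T u v = Adj u v × T u ≡ true × T v ≡ true

  Within-sym : ∀ {T} → Symmetric (Within T)
  Within-sym (a , p , q) = adj-sym a , q , p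

  Within-all : ∀ {T x xs y} → T x ≡ true → Walk (Within T) x xs y → All (λ v → T v ≡ true) (x ∷ xs)
  Within-all p ε                 = p ∷ []
  Within-all p ((_ , _ , q) ◅ w) = p ∷ Within-all q w

  -- With degrees 2 and 3 this is the indicator of the vertices of degree 3. Weighing paths by it
  -- amounts to suppressing the vertices of degree 2.
  excess : Fin n → ℕ
  excess v = deg S v ∸ 2

  LightCycle : ℕ → Set
  LightCycle W = Σ[ C ∈ Cyc Adj ] All (λ v → S v ≡ true) (support C) × weight excess (support C) ≤ W

  module _ (deg≥2 : ∀ v → S v ≡ true → 2 ≤ deg S v) (deg≤3 : ∀ v → S v ≡ true → deg S v ≤ 3) where

    excess≤1 : ∀ v → S v ≡ true → excess v ≤ 1
    excess≤1 v Sv = ∸-monoˡ-≤ 2 (deg≤3 v Sv)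

    deg≡ : ∀ v → S v ≡ true → deg S v ≡ 2 + excess v
    deg≡ v Sv = sym (m+[n∸m]≡n (deg≥2 v Sv))

    total : (Fin n → Bool) → ℕ
    total T = sum λ v → ind (T v) * excess v

    sum-deg : ∀ {T} → T ⊆ᵇ S → ⟨ ind ∘ T , ind ∘ S ⟩ ≡ 2 * card T + total T
    sum-deg {T} T⊆S = trans (sum-cong pointwise) (trans (sum-+ (λ v → 2 * ind (T v)) (λ v → ind (T v) * excess v))
      (cong (_+ total T) (sym (*-distribˡ-∑ 2 (ind ∘ T)))))
      where
      pointwise : ∀ v → ind (T v) * deg S v ≡ 2 * ind (T v) + ind (T v) * excess v
      pointwise v with T v in eq
      ... | false = refl
      ... | true  = trans (+-identityʳ _) (trans (deg≡ v (T⊆S v eq)) (cong (2 +_) (sym (+-identityʳ _))))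

    -- By reach and tree, T is connected with at most |T| − 1 edges; lengths and
    -- sizes only count the vertices of degree 3.
    record Ball (W N : ℕ) : Set where
      field
        T     : Fin n → Bool
        T⊆S   : T ⊆ᵇ S
        root  : Fin n
        root∈ : T root ≡ true
        tree  : vol T + 2 ≤ 2 * card T
        reach : ∀ u → T u ≡ true → ∃ λ us → Walk (Within T) u us root × weight excess (u ∷ us) ≤ W
        large : N ≤ total T

    module _ {W N : ℕ} (B : Ball W N) where
      open Ball B

      link : ∀ {u v} → T u ≡ true → T v ≡ true → ∃ λ us → Walk (Within T) u us v × Unique (u ∷ us) × weight excess (u ∷ us) ≤ W + W
      link {u} {v} Tu Tv with reach u Tu | reach v Tv
      ... | us , w , b | vs , w′ , b′ with reverseʷ Within-sym w′
      ... | ys , w″ , p with simplify Fin._≟_ (w ◅◅ w″)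
      ... | zs , z , uz , sub = zs , z , uz , (begin
        weight excess (u ∷ zs)  ≤⟨ weight-⊑ excess sub ⟩
        weight excess (u ∷ us ++ ys)  ≡⟨ weight-++ excess (u ∷ us) ⟩
        weight excess (u ∷ us) + weight excess ys  ≤⟨ +-mono-≤ b (≤-trans (m≤n+m _ (excess root)) (≤-trans (≤-reflexive (weight-↭ excess p)) b′)) ⟩
        W + W  ∎)
        where open ≤-Reasoning

      outside : ∀ {v xs} → T v ≡ false → All (λ v → T v ≡ true) xs → v ∉ xs
      outside Tv all i = true≢false (All.lookup all i) Tv

      -- The path through the root between two neighbours of v weighs at most 2W, and v adds at most
      -- 1.
      cycle₁ : ∀ {v} → S v ≡ true → T v ≡ false → 2 ≤ deg T v → LightCycle (2 * W + 2)
      cycle₁ {v} Sv Tv 2≤ with neighbour₂ {T} 2≤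
      ... | u , u′ , u≢u′ , Tu , Tu′ , a , a′ with link Tu Tu′
      ... | [] , ε , _ , _ = contradiction refl u≢u′
      ... | zs@(_ ∷ _) , w , uz , b =
        cyc (a ◅ mapʷ proj₁ w) (adj-sym a′) (∉⇒Unique (outside Tv (Within-all Tu w)) uz) (s≤s (s≤s z≤n)) ,
        Sv ∷ All.map (λ {x} → T⊆S x) (Within-all Tu w) ,
        (begin
          excess v + weight excess (u ∷ zs)  ≤⟨ +-mono-≤ (excess≤1 v Sv) b ⟩
          1 + (W + W)                        ≤⟨ n≤1+n _ ⟩
          2 + (W + W)                        ≡⟨ arith W ⟩
          2 * W + 2                          ∎)
        where
        open ≤-Reasoning
        arith : ∀ w → 2 + (w + w) ≡ 2 * w + 2
        arith = solve-∀

      -- Two outside vertices are added to a path of weight at most 2W; this case accounts for the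
      -- bound 2W + 2.
      cycle₂ : ∀ {v v′} → S v ≡ true → T v ≡ false → 1 ≤ deg T v → S v′ ≡ true → T v′ ≡ false → 1 ≤ deg T v′ →
               Adj v v′ → LightCycle (2 * W + 2)
      cycle₂ {v} {v′} Sv Tv 1≤ Sv′ Tv′ 1≤′ e with neighbour {T} 1≤ | neighbour {T} 1≤′
      ... | u , Tu , a | u′ , Tu′ , a′ with link Tu Tu′
      ... | zs , w , uz , b =
        cyc (a ◅ (mapʷ proj₁ w ◅◅ (adj-sym a′ ◅ ε))) (adj-sym e)
          (∉⇒Unique v∉ (Unique.++⁺ uz ([] ∷ []) λ { (i , here refl) → outside Tv′ all i }))
          (s≤s (subst (1 ≤_) (sym (length-++ zs)) (m≤n+m 1 (length zs)))) ,
        Sv ∷ ++⁺ (All.map (λ {x} → T⊆S x) all) (Sv′ ∷ []) ,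
        (begin
          excess v + weight excess (u ∷ zs ++ [ v′ ])  ≡⟨ cong (excess v +_) (weight-++ excess (u ∷ zs)) ⟩
          excess v + (weight excess (u ∷ zs) + (excess v′ + 0))  ≤⟨ +-mono-≤ (excess≤1 v Sv) (+-mono-≤ b (+-monoˡ-≤ 0 (excess≤1 v′ Sv′))) ⟩
          1 + (W + W + 1)  ≡⟨ arith W ⟩
          2 * W + 2  ∎)
        where
        open ≤-Reasoning
        open import Data.List.Relation.Unary.All.Properties using (++⁺)
        all = Within-all Tu w
        v∉ : v ∉ u ∷ zs ++ [ v′ ]
        v∉ i with ∈-++⁻ (u ∷ zs) i
        ... | inj₁ j           = outside Tv all j
        ... | inj₂ (here refl) = irrefl refl e
        arith : ∀ w → 1 + (w + w + 1) ≡ 2 * w + 2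
        arith = solve-∀

      SingleNeighbour : Set
      SingleNeighbour = ∀ v → S v ≡ true → T v ≡ false → deg T v ≤ 1

      single? : LightCycle (2 * W + 2) ⊎ SingleNeighbour
      single? with Fin.any? (λ v → (S v ≟ᵇ true) ×-dec (T v ≟ᵇ false) ×-dec (2 ≤? deg T v))
      ... | yes (v , Sv , Tv , 2≤) = inj₁ (cycle₁ Sv Tv 2≤)
      ... | no ¬p = inj₂ λ v Sv Tv → ≤-pred (≰⇒> λ 2≤ → ¬p (v , Sv , Tv , 2≤))

      module _ (single : SingleNeighbour) (M : Fin n → Bool)
        (M-spec : ∀ v → M v ≡ true → S v ≡ true × T v ≡ false × 1 ≤ deg T v)
        (ε-max : ℕ) (excess≤ : ∀ v → M v ≡ true → excess v ≤ ε-max) where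

        -- Every vertex of `M` has exactly one neighbour in `T`, and `M` is independent unless
        -- `cycle₂` applies. So `T` together with `M` gains as many edges as vertices and remains a
        -- tree. The radius grows by 0 for a layer of vertices of degree 2 and by 1 for a layer of
        -- vertices of degree 3.
        expand : LightCycle (2 * W + 2) ⊎ Σ[ B ∈ Ball (W + ε-max) (N + total M) ] card (Ball.T B) ≡ card T + card M
        expand with Fin.any? (λ v → Fin.any? λ v′ → (M v ≟ᵇ true) ×-dec (M v′ ≟ᵇ true) ×-dec adj? v v′)
        ... | yes (v , v′ , Mv , Mv′ , a) with M-spec v Mv | M-spec v′ Mv′
        ... | Sv , Tv , 1≤ | Sv′ , Tv′ , 1≤′ = inj₁ (cycle₂ Sv Tv 1≤ Sv′ Tv′ 1≤′ a)
        expand | no independent = inj₂ (record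
          { T     = T′
          ; T⊆S   = T′⊆S
          ; root  = root
          ; root∈ = T⊆T′ root root∈
          ; tree  = tree′
          ; reach = reach′
          ; large = ≤-trans (+-monoˡ-≤ (total M) large) (≤-reflexive (sym (sum-∨ T M excess disjoint)))
          } , card-∨ T M disjoint)
          where
          disjoint : ∀ v → M v ≡ true → T v ≡ false
          disjoint v Mv = proj₁ (proj₂ (M-spec v Mv))
          T′ : Fin n → Bool
          T′ v = T v ∨ M v
          T⊆T′ : T ⊆ᵇ T′
          T⊆T′ v Tv rewrite Tv = refl
          M⊆T′ : M ⊆ᵇ T′
          M⊆T′ v Mv rewrite Mv with T v
          ... | true  = refl
          ... | false = refl
          T′⊆S : T′ ⊆ᵇ S
          T′⊆S v p with T v in eq
          ... | true  = T⊆S v eq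
          ... | false = proj₁ (M-spec v p)
          widen : ∀ {u v} → Within T u v → Within T′ u v
          widen (a , p , q) = a , T⊆T′ _ p , T⊆T′ _ q
          reach′ : ∀ u → T′ u ≡ true → ∃ λ us → Walk (Within T′) u us root × weight excess (u ∷ us) ≤ W + ε-max
          reach′ u p with T u in eq
          ... | true with reach u eq
          ... | us , w , b = us , mapʷ widen w , ≤-trans b (m≤m+n _ _)
          reach′ u p | false with neighbour {T} (proj₂ (proj₂ (M-spec u p)))
          ... | x , Tx , a with reach x Tx
          ... | us , w , b = x ∷ us , (a , M⊆T′ u p , T⊆T′ x Tx) ◅ mapʷ widen w ,
            ≤-trans (+-mono-≤ (excess≤ u p) b) (≤-reflexive (+-comm ε-max W))
          MT : ⟨ ind ∘ M , ind ∘ T ⟩ ≤ card M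
          MT = sum-mono pointwise
            where
            pointwise : ∀ v → ind (M v) * deg T v ≤ ind (M v)
            pointwise v with M v in eq
            ... | false = z≤n
            ... | true  = subst (_≤ 1) (sym (+-identityʳ _)) (single v (proj₁ (M-spec v eq)) (disjoint v eq))
          MM : vol M ≡ 0
          MM = sum-zero pointwise
            where
            pointwise : ∀ v → ind (M v) * deg M v ≡ 0
            pointwise v with M v in eq
            ... | false = refl
            ... | true with 1 ≤? deg M v
            ... | no ¬1 = trans (+-identityʳ _) (n<1⇒n≡0 (≰⇒> ¬1))
            ... | yes 1≤ with neighbour {M} 1≤
            ... | v′ , Mv′ , a = contradiction (v , v′ , eq , Mv′ , a) independent
          tree′ : vol T′ + 2 ≤ 2 * card T′
          tree′ = begin
            vol T′ + 2  ≡⟨ cong (_+ 2) (⟨⟩-cong (ind ∘ T′) (λ v → ind (T v) + ind (M v)) (λ v → ind-∨ (disjoint v))) ⟩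
            ⟨ (λ v → ind (T v) + ind (M v)) , (λ v → ind (T v) + ind (M v)) ⟩ + 2
                                                                      ≡⟨ cong (_+ 2) (⟨⟩-square (ind ∘ T) (ind ∘ M)) ⟩
            vol T + 2 * ⟨ ind ∘ M , ind ∘ T ⟩ + vol M + 2  ≤⟨ +-monoˡ-≤ 2 (+-mono-≤ (+-monoʳ-≤ (vol T) (*-monoʳ-≤ 2 MT)) (≤-reflexive MM)) ⟩
            vol T + 2 * card M + 0 + 2  ≡⟨ arith (vol T) (card M) ⟩
            vol T + 2 + 2 * card M  ≤⟨ +-monoˡ-≤ (2 * card M) tree ⟩
            2 * card T + 2 * card M  ≡⟨ *-distribˡ-+ 2 (card T) (card M) ⟨
            2 * (card T + card M)  ≡⟨ cong (2 *_) (card-∨ T M disjoint) ⟨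
            2 * card T′  ∎
            where
            open ≤-Reasoning
            arith : ∀ a m → a + 2 * m + 0 + 2 ≡ a + 2 + 2 * m
            arith = solve-∀

      Closed : Set
      Closed = ∀ v → S v ≡ true → T v ≡ false → 1 ≤ deg T v → 1 ≤ excess v

    open Ball

    -- Neighbouring vertices of excess 0 are absorbed layer by layer. They do not change the radius,
    -- and `m` bounds the number of vertices still outside.
    close-up : ∀ {W N} m (B : Ball W N) → card S ≤ card (T B) + m →
               LightCycle (2 * W + 2) ⊎ Σ[ B ∈ Ball W N ] SingleNeighbour B × Closed B
    close-up {W} {N} m B fuel with single? B
    ... | inj₁ C = inj₁ C
    ... | inj₂ single = step (Fin.any? M?)
      where
      M? : ∀ v → Dec (S v ≡ true × T B v ≡ false × 1 ≤ deg (T B) v × excess v ≡ 0)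
      M? v = (S v ≟ᵇ true) ×-dec (T B v ≟ᵇ false) ×-dec (1 ≤? deg (T B) v) ×-dec (excess v ≟ 0)
      M = ⟦ M? ⟧
      step : Dec (∃ λ v → S v ≡ true × T B v ≡ false × 1 ≤ deg (T B) v × excess v ≡ 0) →
             LightCycle (2 * W + 2) ⊎ Σ[ B ∈ Ball W N ] SingleNeighbour B × Closed B
      step (no none) = inj₂ (B , single , λ v Sv Tv 1≤ → n≢0⇒n>0 λ z → none (v , Sv , Tv , 1≤ , z))
      step (yes (v , p)) with expand B single M (λ v Mv → let Sv , Tv , 1≤ , _ = holds M? Mv in Sv , Tv , 1≤) 0
                                (λ v Mv → ≤-reflexive (proj₂ (proj₂ (proj₂ (holds M? Mv)))))
      ... | inj₁ C = inj₁ C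
      ... | inj₂ (B′ , eq) = next m fuel
        where
        1≤M : 1 ≤ card M
        1≤M = ≤-trans (≤-reflexive (sym (cong ind (⟦⟧-true M? p)))) (term≤sum (ind ∘ M) v)
        B″ : Ball W N
        B″ = record { Ball B′ ; large = ≤-trans (m≤m+n N (total M)) (large B′)
                    ; reach = λ u Tu → let us , w , b = reach B′ u Tu in us , w , subst (_ ≤_) (+-identityʳ W) b }
        next : ∀ m → card S ≤ card (T B) + m → LightCycle (2 * W + 2) ⊎ Σ[ B ∈ Ball W N ] SingleNeighbour B × Closed B
        next zero    f = contradiction (≤-trans (card-mono (T⊆S B′)) (≤-trans f (≤-reflexive (+-identityʳ _))))
          (<⇒≱ (≤-trans (≤-reflexive (+-comm 1 _)) (≤-trans (+-monoʳ-≤ (card (T B)) 1≤M) (≤-reflexive (sym eq)))))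
        next (suc m) f = close-up m B″ (≤-trans f (≤-trans (≤-reflexive (+-suc (card (T B)) m))
          (+-monoˡ-≤ m (≤-trans (≤-reflexive (+-comm 1 _)) (≤-trans (+-monoʳ-≤ (card (T B)) 1≤M) (≤-reflexive (sym eq)))))))

    frontier? : ∀ {W N} (B : Ball W N) v → Dec (S v ≡ true × T B v ≡ false × 1 ≤ deg (T B) v)
    frontier? B v = (S v ≟ᵇ true) ×-dec (T B v ≟ᵇ false) ×-dec (1 ≤? deg (T B) v)

    -- The degrees in `T` sum to `2 * card T + total T`, of which the tree uses at most `2 * card T`
    -- minus 2. So at least N + 2 edges leave `T`; they end in distinct vertices by `single`, each
    -- of excess 1 by `closed`.
    boundary : ∀ {W N} (B : Ball W N) → SingleNeighbour B → Closed B →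
               LightCycle (2 * W + 2) ⊎ Ball (suc W) (2 * N + 2)
    boundary {W} {N} B single closed with expand B single ⟦ frontier? B ⟧
        (λ v Mv → holds (frontier? B) {v} Mv) 1 (λ v Mv → excess≤1 v (proj₁ (holds (frontier? B) {v} Mv)))
    ... | inj₁ C = inj₁ C
    ... | inj₂ (B′ , _) = inj₂ (record { Ball B′ ; reach = λ u Tu → let us , w , b = reach B′ u Tu in us , w , subst (weight excess (u ∷ us) ≤_) (+-comm W 1) b
                                       ; large = ≤-trans (≤-trans (≤-reflexive (arith₀ N)) (+-monoʳ-≤ N M-large)) (large B′) })
      where
      M? = frontier? B
      M = ⟦ M? ⟧
      arith₀ : ∀ n → 2 * n + 2 ≡ n + (n + 2)
      arith₀ = solve-∀
      rest : Fin n → Bool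
      rest v = S v ∧ not (T B v)
      rest-spec : ∀ {v} → rest v ≡ true → S v ≡ true × T B v ≡ false
      rest-spec {v} p with S v | T B v
      ... | true | false = refl , refl
      S-split : ∀ v → ind (S v) ≡ ind (T B v) + ind (rest v)
      S-split v with T B v in eq
      ... | true rewrite T⊆S B v eq = refl
      ... | false with S v
      ... | true  = refl
      ... | false = refl
      total-M : card M ≡ total M
      total-M = sum-cong pointwise
        where
        pointwise : ∀ v → ind (M v) ≡ ind (M v) * excess v
        pointwise v with M v in eq
        ... | false = refl
        ... | true with holds M? {v} eq
        ... | Sv , Tv , 1≤ = sym (trans (+-identityʳ _) (≤-antisym (excess≤1 v Sv) (closed v Sv Tv 1≤)))
      outgoing : ⟨ ind ∘ T B , ind ∘ rest ⟩ ≤ card M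
      outgoing = ≤-trans (≤-reflexive (⟨⟩-sym (ind ∘ T B) (ind ∘ rest))) (sum-mono pointwise)
        where
        pointwise : ∀ v → ind (rest v) * deg (T B) v ≤ ind (M v)
        pointwise v with rest v in eq
        ... | false = z≤n
        ... | true  = subst (_≤ ind (M v)) (sym (+-identityʳ _)) (bound (1 ≤? deg (T B) v))
          where
          bound : Dec (1 ≤ deg (T B) v) → deg (T B) v ≤ ind (M v)
          bound (yes 1≤) = ≤-trans (single v (proj₁ (rest-spec eq)) (proj₂ (rest-spec eq)))
            (≤-reflexive (sym (cong ind (⟦⟧-true M? {v} (proj₁ (rest-spec eq) , proj₂ (rest-spec eq) , 1≤)))))
          bound (no ¬1) = ≤-trans (≤-reflexive (n<1⇒n≡0 (≰⇒> ¬1))) z≤n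
      M-large : N + 2 ≤ total M
      M-large = +-cancelˡ-≤ (2 * card (T B)) _ _ (begin
        2 * card (T B) + (N + 2)  ≤⟨ +-monoʳ-≤ (2 * card (T B)) (+-monoˡ-≤ 2 (large B)) ⟩
        2 * card (T B) + (total (T B) + 2)  ≡⟨ +-assoc (2 * card (T B)) (total (T B)) 2 ⟨
        2 * card (T B) + total (T B) + 2  ≡⟨ cong (_+ 2) (sum-deg (T⊆S B)) ⟨
        ⟨ ind ∘ T B , ind ∘ S ⟩ + 2  ≡⟨ cong (_+ 2) (sum-cong λ v → cong (ind (T B v) *_) (degree-cong (ind ∘ S) (λ v → ind (T B v) + ind (rest v)) S-split v)) ⟩
        ⟨ ind ∘ T B , (λ v → ind (T B v) + ind (rest v)) ⟩ + 2  ≡⟨ cong (_+ 2) (⟨⟩-+ʳ (ind ∘ T B) (ind ∘ T B) (ind ∘ rest)) ⟩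
        vol (T B) + ⟨ ind ∘ T B , ind ∘ rest ⟩ + 2  ≤⟨ +-monoˡ-≤ 2 (+-monoʳ-≤ (vol (T B)) outgoing) ⟩
        vol (T B) + card M + 2  ≡⟨ arith (vol (T B)) (card M) ⟩
        vol (T B) + 2 + card M  ≤⟨ +-monoˡ-≤ (card M) (tree B) ⟩
        2 * card (T B) + card M  ≡⟨ cong (2 * card (T B) +_) total-M ⟩
        2 * card (T B) + total M  ∎)
        where
        open ≤-Reasoning
        arith : ∀ a m → a + m + 2 ≡ a + 2 + m
        arith = solve-∀

    total-mono : ∀ {T} → T ⊆ᵇ S → total T ≤ total S
    total-mono {T} T⊆S = sum-mono λ v → *-monoˡ-≤ (excess v) (ind-mono {S = T} {S} T⊆S v)

    -- One round takes N to 2N + 2 and so doubles N + 2. A single vertex of degree 3 starts with N +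
    -- 2 = 3, which explains the 3 * 2 ^ j. After ρ rounds the ball would hold more vertices of
    -- degree 3 than there are.
    climb : ∀ {ρ} i j {N} → i + j ≡ ρ → Ball (suc j) N → 3 * 2 ^ j ≤ N + 2 → total S + 2 < 3 * 2 ^ ρ →
            LightCycle (2 * ρ + 2)
    climb zero j refl B big few = contradiction few (≤⇒≯ (≤-trans big (+-monoˡ-≤ 2 (≤-trans (large B) (total-mono (T⊆S B))))))
    climb {ρ} (suc i) j {N} eq B big few with close-up (card S) B (m≤n+m _ _)
    ... | inj₁ C = weaken C
      where
      weaken : LightCycle (2 * suc j + 2) → LightCycle (2 * ρ + 2)
      weaken (C , inS , light) = C , inS , ≤-trans light (+-monoˡ-≤ 2 (*-monoʳ-≤ 2 (subst (suc j ≤_) (trans (+-suc i j) eq) (m≤n+m _ i))))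
    ... | inj₂ (B′ , single , closed) with boundary B′ single closed
    ... | inj₁ (C , inS , light) = C , inS , ≤-trans light (+-monoˡ-≤ 2 (*-monoʳ-≤ 2 (subst (suc j ≤_) (trans (+-suc i j) eq) (m≤n+m _ i))))
    ... | inj₂ B″ = climb i (suc j) (trans (+-suc i j) eq) B″ (begin
        3 * (2 * 2 ^ j)  ≡⟨ arith₁ (2 ^ j) ⟩
        2 * (3 * 2 ^ j)  ≤⟨ *-monoʳ-≤ 2 big ⟩
        2 * (N + 2)      ≡⟨ arith₂ N ⟩
        2 * N + 2 + 2    ∎) few
        where
        open ≤-Reasoning
        arith₁ : ∀ p → 3 * (2 * p) ≡ 2 * (3 * p)
        arith₁ = solve-∀
        arith₂ : ∀ n → 2 * (n + 2) ≡ 2 * n + 2 + 2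
        arith₂ = solve-∀

    moore : ∀ ρ → 1 ≤ total S → total S + 2 < 3 * 2 ^ ρ → LightCycle (2 * ρ + 2)
    moore ρ 1≤ few with positive-term 1≤
    ... | v , p with S v in Sv
    ... | true = climb ρ 0 (+-identityʳ ρ) B ≤-refl few
      where
      B : Ball 1 1
      B = record
        { T     = ⁅ v ⁆
        ; T⊆S   = λ u p → subst (λ u → S u ≡ true) (sym (⁅⁆⇒≡ p)) Sv
        ; root  = v
        ; root∈ = ⁅⁆-refl v
        ; tree  = ≤-reflexive (trans (cong (_+ 2) (trans (sum-⁅⁆ v (deg ⁅ v ⁆)) (trans (degree-⁅⁆ v v) (edge-irrefl v))))
                    (cong (2 *_) (sym (card-⁅⁆ v))))
        ; reach = λ u p → [] , subst (λ u → Walk (Within ⁅ v ⁆) u [] v) (sym (⁅⁆⇒≡ p)) ε ,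
                    ≤-trans (≤-reflexive (+-identityʳ _)) (excess≤1 u (subst (λ u → S u ≡ true) (sym (⁅⁆⇒≡ p)) Sv))
        ; large = subst (1 ≤_) (sym (sum-⁅⁆ v excess)) (subst (1 ≤_) (+-identityʳ _) p)
        }

-- Disjoint cycles in graphs of maximum degree 3

module Packing {n : ℕ} (H : Graph (Fin n)) where
  open Graph H renaming (sym to adj-sym)
  open Counting H
  open Moore H using (excess; LightCycle; moore; sum-deg; total)

  -- Deleting the vertices of a path one by one, all but the first lose an edge
  -- to their deleted predecessor.
  removePath : ∀ S {p z zs y} T → T ⊆ᵇ S → S p ≡ true → T p ≡ false → Adj p z →
               Walk Adj z zs y → Unique (z ∷ zs) → All (λ v → T v ≡ true) (z ∷ zs) →
               ∃ λ T′ → T′ ⊆ᵇ T × All (λ v → T′ v ≡ false) (z ∷ zs) ×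
               vol T + 2 * card T′ ≤ vol T′ + 2 * card T + 2 * weight (excess S) (z ∷ zs)
  removePath S {p} {z} {zs} T T⊆S Sp Tp a w u (Tz ∷ Tzs) = next w u Tzs
    where
    d≤ : deg T z ≤ suc (excess S z)
    d≤ = ≤-pred (≤-trans (≤-trans (s≤s (deg-mono T⊆S∖p z)) (≤-reflexive (sym (deg-adj {S} Sp (adj-sym a))))) (m≤n+m∸n _ 2))
      where
      T⊆S∖p : T ⊆ᵇ (S ∖ p)
      T⊆S∖p v Tv = trans (∖-other S {v} {p} λ { refl → true≢false Tv Tp }) (T⊆S v Tv)
    T₁ = T ∖ z
    step : vol T + 2 * card T₁ ≤ vol T₁ + 2 * card T + 2 * excess S z
    step = begin
      vol T + 2 * card T₁  ≡⟨ cong (_+ 2 * card T₁) (vol-∖ {T} Tz) ⟩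
      vol T₁ + 2 * deg T z + 2 * card T₁  ≤⟨ +-monoˡ-≤ (2 * card T₁) (+-monoʳ-≤ (vol T₁) (*-monoʳ-≤ 2 d≤)) ⟩
      vol T₁ + 2 * suc (excess S z) + 2 * card T₁  ≡⟨ arith (vol T₁) (excess S z) (card T₁) ⟩
      vol T₁ + 2 * suc (card T₁) + 2 * excess S z  ≡⟨ cong (λ c → vol T₁ + 2 * c + 2 * excess S z) (card-∖ Tz) ⟨
      vol T₁ + 2 * card T + 2 * excess S z  ∎
      where
      open ≤-Reasoning
      arith : ∀ v e c → v + 2 * suc e + 2 * c ≡ v + 2 * suc c + 2 * e
      arith = solve-∀
    next : ∀ {zs y} → Walk Adj z zs y → Unique (z ∷ zs) → All (λ v → T v ≡ true) zs →
           ∃ λ T′ → T′ ⊆ᵇ T × All (λ v → T′ v ≡ false) (z ∷ zs) ×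
           vol T + 2 * card T′ ≤ vol T′ + 2 * card T + 2 * weight (excess S) (z ∷ zs)
    next ε _ _ = T₁ , ∖⊆ {S = T} , (∖-self T z ∷ []) ,
      subst (λ e → vol T + 2 * card T₁ ≤ vol T₁ + 2 * card T + 2 * e) (sym (+-identityʳ (excess S z))) step
    next (a ◅ w) (z∉ ∷ u) all with removePath S T₁ (λ v → T⊆S v ∘ ∖⊆ {S = T} v) (T⊆S z Tz) (∖-self T z) a w u
        (All.tabulate λ {v} i → trans (∖-other T {v} {z} λ { refl → All.lookup z∉ i refl }) (All.lookup all i))
    ... | T′ , T′⊆ , gone , b = T′ , (λ v → ∖⊆ {S = T} v ∘ T′⊆ v) , (absent ∷ gone) ,
      combine (vol T) (card T₁) (vol T₁) (card T) (excess S z) (card T′) (vol T′) step b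
      where
      absent : T′ z ≡ false
      absent with T′ z in eq
      ... | false = refl
      ... | true  = ⊥-elim (true≢false (T′⊆ z eq) (∖-self T z))
      combine : ∀ V C₁ V₁ C e C′ V′ {W} → V + 2 * C₁ ≤ V₁ + 2 * C + 2 * e → V₁ + 2 * C′ ≤ V′ + 2 * C₁ + 2 * W →
                V + 2 * C′ ≤ V′ + 2 * C + 2 * (e + W)
      combine V C₁ V₁ C e C′ V′ {W} p q = +-cancelˡ-≤ (V₁ + 2 * C₁) _ _ (≤-trans (≤-reflexive (l V C₁ V₁ C′))
        (≤-trans (+-mono-≤ p q) (≤-reflexive (r V₁ C e V′ C₁ W))))
        where
        l : ∀ V C₁ V₁ C′ → V₁ + 2 * C₁ + (V + 2 * C′) ≡ V + 2 * C₁ + (V₁ + 2 * C′)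
        l = solve-∀
        r : ∀ V₁ C e V′ C₁ W → V₁ + 2 * C + 2 * e + (V′ + 2 * C₁ + 2 * W) ≡ V₁ + 2 * C₁ + (V′ + 2 * C + 2 * (e + W))
        r = solve-∀

  -- The inequality says, doubled and without subtraction, by how much |E| - |V| drops. The first
  -- vertex has no deleted predecessor with which to share an edge, so it costs one more than its
  -- excess; this is the `suc`.
  removeCycle : ∀ S (C : Cyc Adj) → All (λ v → S v ≡ true) (support C) →
                ∃ λ T → T ⊆ᵇ S × All (λ v → T v ≡ false) (support C) ×
                vol S + 2 * card T ≤ vol T + 2 * card S + 2 * suc (weight (excess S) (support C))
  removeCycle S (cyc {x} {z ∷ zs} (a ◅ w) _ (x∉ ∷ u) _) (Sx ∷ all)
    with removePath S (S ∖ x) (∖⊆ {S = S}) Sx (∖-self S x) a w u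
      (All.tabulate λ {v} i → trans (∖-other S {v} {x} λ { refl → All.lookup x∉ i refl }) (All.lookup all i))
  ... | T , T⊆ , gone , b = T , (λ v → ∖⊆ {S = S} v ∘ T⊆ v) , (absent ∷ gone) , (begin
    vol S + 2 * card T  ≡⟨ cong (_+ 2 * card T) (vol-∖ {S} Sx) ⟩
    vol S₁ + 2 * deg S x + 2 * card T  ≤⟨ +-monoˡ-≤ (2 * card T) (+-monoʳ-≤ (vol S₁) (*-monoʳ-≤ 2 (m≤n+m∸n (deg S x) 2))) ⟩
    vol S₁ + 2 * (2 + excess S x) + 2 * card T  ≡⟨ arith₁ (vol S₁) (excess S x) (card T) ⟩
    vol S₁ + 2 * card T + 2 * (2 + excess S x)  ≤⟨ +-monoˡ-≤ (2 * (2 + excess S x)) b ⟩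
    vol T + 2 * card S₁ + 2 * W + 2 * (2 + excess S x)  ≡⟨ arith₂ (vol T) (card S₁) W (excess S x) ⟩
    vol T + 2 * suc (card S₁) + 2 * suc (excess S x + W)  ≡⟨ cong (λ c → vol T + 2 * c + 2 * suc (excess S x + W)) (card-∖ Sx) ⟨
    vol T + 2 * card S + 2 * suc (excess S x + W)  ∎)
    where
    open ≤-Reasoning
    S₁ = S ∖ x
    W = weight (excess S) (z ∷ zs)
    absent : T x ≡ false
    absent with T x in eq
    ... | false = refl
    ... | true  = ⊥-elim (true≢false (T⊆ x eq) (∖-self S x))
    arith₁ : ∀ v e c → v + 2 * (2 + e) + 2 * c ≡ v + 2 * c + 2 * (2 + e)
    arith₁ = solve-∀
    arith₂ : ∀ t c w e → t + 2 * c + 2 * w + 2 * (2 + e) ≡ t + 2 * suc c + 2 * suc (e + w)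
    arith₂ = solve-∀

  Disjoint-family : (Fin n → Bool) → ℕ → Set
  Disjoint-family S k = ∃ λ (Cs : List (Cyc Adj)) → length Cs ≡ k ×
    AllPairs (Disjoint on support) Cs × All (λ C → All (λ v → S v ≡ true) (support C)) Cs

  module _ (max-degree : ∀ v → deg (λ _ → true) v ≤ 3) where

    deg≤3 : ∀ {S} v → deg S v ≤ 3
    deg≤3 {S} v = ≤-trans (deg-mono {S} (λ _ _ → refl) v) (max-degree v)

    -- Vertices of degree at most 1, and any vertices while the excess is large,
    -- can be deleted.
    core : ∀ m t S → card S ≡ m → 2 * card S + 2 * t ≤ vol S →
           ∃ λ S′ → S′ ⊆ᵇ S × 2 * card S′ + 2 * t ≤ vol S′ × vol S′ ≤ 2 * card S′ + 2 * t + 3 ×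
           (∀ v → S′ v ≡ true → 2 ≤ deg S′ v)
    core m t S eq b with Fin.any? (λ v → (S v ≟ᵇ true) ×-dec ((deg S v ≤? 1) ⊎-dec (2 * card S + 2 * t + 4 ≤? vol S)))
    ... | no none = S , (λ _ → id) , b ,
      ≮⇒≥ (λ big → let v , Sv = inhabited (≤-trans (m≤n+m 4 _) (few big)) in none (v , Sv , inj₂ (few big))) ,
      λ v Sv → ≰⇒> λ d≤1 → none (v , Sv , inj₁ d≤1)
      where
      few : 2 * card S + 2 * t + 3 < vol S → 2 * card S + 2 * t + 4 ≤ vol S
      few = ≤-trans (≤-reflexive (+-suc _ 3))
      inhabited : 4 ≤ vol S → ∃ λ v → S v ≡ true
      inhabited 4≤ with positive-term (≤-trans (s≤s z≤n) 4≤)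
      ... | v , p with S v in Sv
      ... | true = v , Sv
    core zero    t S eq b | yes (v , Sv , _) = contradiction (trans (sym eq) (card-∖ Sv)) λ ()
    core (suc m) t S eq b | yes (v , Sv , why) with core m t (S ∖ v) (suc-injective (trans (sym (card-∖ Sv)) eq)) (removed why)
      where
      V = vol (S ∖ v)
      c = card (S ∖ v)
      removed : deg S v ≤ 1 ⊎ 2 * card S + 2 * t + 4 ≤ vol S → 2 * c + 2 * t ≤ V
      removed (inj₁ d≤1) = +-cancelˡ-≤ 2 _ _ (begin
        2 + (2 * c + 2 * t)  ≡⟨ arith c t ⟩
        2 * suc c + 2 * t    ≡⟨ cong (λ c → 2 * c + 2 * t) (card-∖ Sv) ⟨
        2 * card S + 2 * t   ≤⟨ b ⟩
        vol S                ≡⟨ vol-∖ {S} Sv ⟩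
        V + 2 * deg S v      ≤⟨ +-monoʳ-≤ V (*-monoʳ-≤ 2 d≤1) ⟩
        V + 2                ≡⟨ +-comm V 2 ⟩
        2 + V                ∎)
        where
        open ≤-Reasoning
        arith : ∀ c t → 2 + (2 * c + 2 * t) ≡ 2 * suc c + 2 * t
        arith = solve-∀
      -- A vertex of degree at most 3 takes at most 6 from `vol` and exactly 2 from `2 * card`, a
      -- net loss of at most 4. Hence the 4 in the test and the slack 3 when it fails.
      removed (inj₂ big) = +-cancelˡ-≤ 6 _ _ (begin
        6 + (2 * c + 2 * t)     ≡⟨ arith c t ⟩
        2 * suc c + 2 * t + 4   ≡⟨ cong (λ c → 2 * c + 2 * t + 4) (card-∖ Sv) ⟨
        2 * card S + 2 * t + 4  ≤⟨ big ⟩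
        vol S                   ≡⟨ vol-∖ {S} Sv ⟩
        V + 2 * deg S v         ≤⟨ +-monoʳ-≤ V (*-monoʳ-≤ 2 (deg≤3 {S} v)) ⟩
        V + 6                   ≡⟨ +-comm V 6 ⟩
        6 + V                   ∎)
        where
        open ≤-Reasoning
        arith : ∀ c t → 6 + (2 * c + 2 * t) ≡ 2 * suc c + 2 * t + 4
        arith = solve-∀
    ... | S′ , S′⊆ , lo , hi , d = S′ , (λ v → ∖⊆ {S = S} v ∘ S′⊆ v) , lo , hi , d

    module _ (t ρ : ℕ → ℕ)
      (t-step : ∀ k → t k + (2 * ρ k + 3) ≤ t (suc k))
      (ρ-large : ∀ k → 2 * t (suc k) + 5 < 3 * 2 ^ ρ k) where

      -- The Moore cycle is logarithmic in the total excess, so `core` first trims that to between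
      -- 2t and 2t + 3, with t = `t (suc k)`; adding 2 gives the left side of `ρ-large`. The cycle
      -- found weighs at most 2ρ + 2, its removal costs 2ρ + 3, and `t-step` provides for this.
      disjointCycles : ∀ k S → 2 * card S + 2 * t k ≤ vol S → Disjoint-family S k
      disjointCycles zero    S b = [] , refl , [] , []
      disjointCycles (suc k) S b with core (card S) (t (suc k)) S refl b
      ... | S′ , S′⊆ , lo , hi , d≥2 with moore S′ d≥2 (λ v _ → deg≤3 {S′} v) (ρ k) 1≤total few
        where
        total′ = total S′ d≥2 (λ v _ → deg≤3 {S′} v) S′
        vol≡ : vol S′ ≡ 2 * card S′ + total′
        vol≡ = sum-deg S′ d≥2 (λ v _ → deg≤3 {S′} v) (λ _ → id)
        1≤total : 1 ≤ total′
        1≤total = ≤-trans (≤-trans (≤-trans (s≤s z≤n) (m≤n+m 3 (t k + 2 * ρ k)))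
            (≤-trans (≤-reflexive (+-assoc (t k) (2 * ρ k) 3)) (≤-trans (t-step k) (m≤m+n (t (suc k)) _))))
          (+-cancelˡ-≤ (2 * card S′) _ _ (≤-trans lo (≤-reflexive vol≡)))
        few : total′ + 2 < 3 * 2 ^ ρ k
        few = ≤-<-trans (≤-trans (+-monoˡ-≤ 2 (+-cancelˡ-≤ (2 * card S′) _ _
          (≤-trans (≤-reflexive (sym vol≡)) (≤-trans hi (≤-reflexive (+-assoc (2 * card S′) (2 * t (suc k)) 3))))))
          (≤-reflexive (+-assoc (2 * t (suc k)) 3 2))) (ρ-large k)
      ... | C , inS , light with removeCycle S′ C inS
      ... | T , T⊆ , gone , b′ with disjointCycles k T bound
        where
        bound : 2 * card T + 2 * t k ≤ vol T
        bound = +-cancelˡ-≤ (2 * card S′ + 2 * suc (2 * ρ k + 2)) _ _ (begin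
          2 * card S′ + 2 * suc (2 * ρ k + 2) + (2 * card T + 2 * t k)  ≡⟨ arith₁ (card S′) (ρ k) (card T) (t k) ⟩
          2 * card S′ + 2 * (t k + (2 * ρ k + 3)) + 2 * card T  ≤⟨ +-monoˡ-≤ (2 * card T) (+-monoʳ-≤ (2 * card S′) (*-monoʳ-≤ 2 (t-step k))) ⟩
          2 * card S′ + 2 * t (suc k) + 2 * card T  ≤⟨ +-monoˡ-≤ (2 * card T) lo ⟩
          vol S′ + 2 * card T  ≤⟨ b′ ⟩
          vol T + 2 * card S′ + 2 * suc (weight (excess S′) (support C))  ≤⟨ +-monoʳ-≤ (vol T + 2 * card S′) (*-monoʳ-≤ 2 (s≤s light)) ⟩
          vol T + 2 * card S′ + 2 * suc (2 * ρ k + 2)  ≡⟨ arith₂ (vol T) (card S′) (2 * suc (2 * ρ k + 2)) ⟩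
          2 * card S′ + 2 * suc (2 * ρ k + 2) + vol T  ∎)
          where
          open ≤-Reasoning
          arith₁ : ∀ s r c t → 2 * s + 2 * suc (2 * r + 2) + (2 * c + 2 * t) ≡ 2 * s + 2 * (t + (2 * r + 3)) + 2 * c
          arith₁ = solve-∀
          arith₂ : ∀ v s x → v + 2 * s + x ≡ 2 * s + x + v
          arith₂ = solve-∀
      ... | Cs , len , dj , inT = C ∷ Cs , cong suc len ,
        (All.map (λ {D} D⊆T {v} (i , j) → true≢false (All.lookup D⊆T j) (All.lookup gone i)) inT ∷ dj) ,
        (All.map (λ {v} → S′⊆ v) inS ∷ All.map (All.map λ {v} → S′⊆ v ∘ T⊆ v) inT)

-- Exhaustive search over duplicate-free lists

module _ {n : ℕ} where

  boundedSearch : ∀ N {P : List (Fin n) → Set} → (∀ xs → Dec (P xs)) → Dec (∃ λ xs → length xs ≤ N × P xs)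
  boundedSearch zero P? = map′ (λ p → [] , z≤n , p) (λ { ([] , _ , p) → p }) (P? [])
  boundedSearch (suc N) P? = map′
    (λ { (inj₁ p) → [] , z≤n , p ; (inj₂ (i , xs , b , p)) → i ∷ xs , s≤s b , p })
    (λ { ([] , _ , p) → inj₁ p ; (i ∷ xs , s≤s b , p) → inj₂ (i , xs , b , p) })
    (P? [] ⊎-dec Fin.any? λ i → boundedSearch N (P? ∘ (i ∷_)))

  Unique⇒length≤ : ∀ {xs : List (Fin n)} → Unique xs → length xs ≤ n
  Unique⇒length≤ {xs} u = Fin.injective⇒≤ {f = lookup xs} (λ {i} {j} → lookup-injective u i j)
    where
    open import Data.List.Base using (lookup)
    lookup-injective : ∀ {xs : List (Fin n)} → Unique xs → ∀ i j → lookup xs i ≡ lookup xs j → i ≡ j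
    lookup-injective (p ∷ u) zero    zero    eq = refl
    lookup-injective (p ∷ u) zero    (suc j) eq = contradiction eq (All.lookup p (∈-lookup j))
      where open import Data.List.Membership.Propositional.Properties using (∈-lookup)
    lookup-injective (p ∷ u) (suc i) zero    eq = contradiction (sym eq) (All.lookup p (∈-lookup i))
      where open import Data.List.Membership.Propositional.Properties using (∈-lookup)
    lookup-injective (p ∷ u) (suc i) (suc j) eq = cong suc (lookup-injective u i j eq)

  -- Lists without repetition have length at most `n`, so the search is finite. Such decisions let
  -- the greedy constructions proceed by cases.
  search : {P : List (Fin n) → Set} → (∀ xs → Dec (P xs)) → (∀ {xs} → P xs → Unique xs) → Dec (∃ P)
  search P? uniq = map′ (λ (xs , _ , p) → xs , p) (λ (xs , p) → xs , Unique⇒length≤ (uniq p) , p) (boundedSearch n P?)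

  unique? : (xs : List (Fin n)) → Dec (Unique xs)
  unique? = DecU.unique?
    where import Data.List.Relation.Unary.Unique.DecPropositional Fin._≟_ as DecU

  simplePath? : ∀ {R : Fin n → Fin n → Set} → (∀ u v → Dec (R u v)) → ∀ x y {Q : List (Fin n) → Set} → (∀ xs → Dec (Q xs)) →
                Dec (∃ λ xs → Walk R x xs y × Unique (x ∷ xs) × Q xs)
  simplePath? R? x y Q? = search (λ xs → walk? Fin._≟_ R? x xs y ×-dec unique? (x ∷ xs) ×-dec Q? xs)
    (λ { (_ , _ ∷ u , _) → u })

-- Attaching edges and ears

module _ {n : ℕ} where
  open Graph hiding (sym)

  New : Fin n → Fin n → Fin n → Fin n → Set
  New x y u v = (u ≡ x × v ≡ y) ⊎ (u ≡ y × v ≡ x)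

  New-sym : ∀ {x y} → Symmetric (New x y)
  New-sym (inj₁ (p , q)) = inj₂ (q , p)
  New-sym (inj₂ (p , q)) = inj₁ (q , p)

  addEdge : (H : Graph (Fin n)) (x y : Fin n) → x ≢ y → Graph (Fin n)
  addEdge H x y x≢y = record
    { Adj    = λ u v → Adj H u v ⊎ New x y u v
    ; adj?   = λ u v → adj? H u v ⊎-dec ((u Fin.≟ x ×-dec v Fin.≟ y) ⊎-dec (u Fin.≟ y ×-dec v Fin.≟ x))
    ; sym    = λ { (inj₁ a) → inj₁ (Graph.sym H a) ; (inj₂ e) → inj₂ (New-sym e) }
    ; irrefl = λ { refl (inj₁ a) → irrefl H refl a
                 ; refl (inj₂ (inj₁ (p , q))) → x≢y (trans (sym p) q)
                 ; refl (inj₂ (inj₂ (p , q))) → x≢y (trans (sym q) p) }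
    }

  valency : Graph (Fin n) → Fin n → ℕ
  valency H = Counting.deg H (λ _ → true)

  Isolated : Graph (Fin n) → Fin n → Set
  Isolated H v = ∀ {u} → ¬ Adj H v u

  valency≡0 : ∀ H {v} → valency H v ≡ 0 → Isolated H v
  valency≡0 H {v} eq {u} a = contradiction (trans (sym (Counting.deg-adj H {λ _ → true} {u} {v} refl a)) eq) λ ()

  valency-addEdge : ∀ H {x y} (x≢y : x ≢ y) → ¬ Adj H x y → ∀ v →
                    valency (addEdge H x y x≢y) v ≡ valency H v + (ind (⁅ x ⁆ v) + ind (⁅ y ⁆ v))
  valency-addEdge H {x} {y} x≢y ¬xy u = begin
    sum (λ w → 1 * e′ w)  ≡⟨ sum-cong pointwise ⟩
    sum (λ w → 1 * e w + (ind (⁅ y ⁆ w) * ind (⁅ x ⁆ u) + ind (⁅ x ⁆ w) * ind (⁅ y ⁆ u))) ≡⟨ sum-+ _ _ ⟩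
    valency H u + sum (λ w → ind (⁅ y ⁆ w) * ind (⁅ x ⁆ u) + ind (⁅ x ⁆ w) * ind (⁅ y ⁆ u)) ≡⟨ cong (valency H u +_) (sum-+ _ _) ⟩
    valency H u + (sum (λ w → ind (⁅ y ⁆ w) * ind (⁅ x ⁆ u)) + sum (λ w → ind (⁅ x ⁆ w) * ind (⁅ y ⁆ u)))
      ≡⟨ cong₂ (λ a b → valency H u + (a + b)) (sum-⁅⁆ y (λ _ → ind (⁅ x ⁆ u))) (sum-⁅⁆ x (λ _ → ind (⁅ y ⁆ u))) ⟩
    valency H u + (ind (⁅ x ⁆ u) + ind (⁅ y ⁆ u))  ∎
    where
    open ≡-Reasoning
    e e′ : Fin n → ℕ
    e  = Counting.edge H u
    e′ = Counting.edge (addEdge H x y x≢y) u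
    ind-∧ : ∀ a b → ind (a ∧ b) ≡ ind b * ind a
    ind-∧ true  b = sym (*-identityʳ (ind b))
    ind-∧ false b = sym (*-zeroʳ (ind b))
    ∧-true : ∀ {a b} → a ∧ b ≡ true → a ≡ true × b ≡ true
    ∧-true {true} {true} _ = refl , refl
    ∨-true : ∀ {a b} → a ∨ b ≡ true → a ≡ true ⊎ b ≡ true
    ∨-true {true}  _ = inj₁ refl
    ∨-true {false} p = inj₂ p
    not-adj : ∀ {p q} → ¬ Adj H p q → does (adj? H p q) ≡ false
    not-adj {p} {q} ¬a with adj? H p q
    ... | yes a = contradiction a ¬a
    ... | no _  = refl
    pointwise : ∀ w → 1 * e′ w ≡ 1 * e w + (ind (⁅ y ⁆ w) * ind (⁅ x ⁆ u) + ind (⁅ x ⁆ w) * ind (⁅ y ⁆ u))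
    pointwise w = begin
      1 * e′ w  ≡⟨ +-identityʳ (e′ w) ⟩
      e′ w      ≡⟨ ind-∨ new⇒¬old ⟩
      e w + ind ((⁅ x ⁆ u ∧ ⁅ y ⁆ w) ∨ (⁅ y ⁆ u ∧ ⁅ x ⁆ w)) ≡⟨ cong₂ _+_ (sym (+-identityʳ (e w))) (trans (ind-∨ exclusive) (cong₂ _+_ (ind-∧ (⁅ x ⁆ u) (⁅ y ⁆ w)) (ind-∧ (⁅ y ⁆ u) (⁅ x ⁆ w)))) ⟩
      1 * e w + (ind (⁅ y ⁆ w) * ind (⁅ x ⁆ u) + ind (⁅ x ⁆ w) * ind (⁅ y ⁆ u)) ∎
      where
      exclusive : ⁅ y ⁆ u ∧ ⁅ x ⁆ w ≡ true → ⁅ x ⁆ u ∧ ⁅ y ⁆ w ≡ false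
      exclusive p with ⁅⁆⇒≡ {u = u} {y} (proj₁ (∧-true p))
      ... | refl rewrite ⁅⁆-≢ (x≢y ∘ sym) = refl
      new⇒¬old : (⁅ x ⁆ u ∧ ⁅ y ⁆ w) ∨ (⁅ y ⁆ u ∧ ⁅ x ⁆ w) ≡ true → does (adj? H u w) ≡ false
      new⇒¬old p with ∨-true p
      ... | inj₁ q with ⁅⁆⇒≡ {u = u} {x} (proj₁ (∧-true q)) | ⁅⁆⇒≡ {u = w} {y} (proj₂ (∧-true {⁅ x ⁆ u} q))
      ... | refl | refl = not-adj ¬xy
      new⇒¬old p | inj₂ q with ⁅⁆⇒≡ {u = u} {y} (proj₁ (∧-true q)) | ⁅⁆⇒≡ {u = w} {x} (proj₂ (∧-true {⁅ y ⁆ u} q))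
      ... | refl | refl = not-adj (¬xy ∘ Graph.sym H)

  module _ (H : Graph (Fin n)) {x y : Fin n} (x≢y : x ≢ y) where

    private
      H⁺ = addEdge H x y x≢y

    -- Traversing the new edge in either direction would visit its end q.
    oldWalk : ∀ {p q} → New x y p q → ∀ {u xs v} → Walk (Adj H⁺) u xs v → q ∉ u ∷ xs → Walk (Adj H) u xs v
    oldWalk new ε q∉ = ε
    oldWalk new (inj₁ a ◅ w) q∉ = a ◅ oldWalk new w (q∉ ∘ there)
    oldWalk (inj₁ (refl , refl)) (inj₂ (inj₁ (refl , refl)) ◅ w) q∉ = contradiction (there (here refl)) q∉
    oldWalk (inj₁ (refl , refl)) (inj₂ (inj₂ (refl , refl)) ◅ w) q∉ = contradiction (here refl) q∉
    oldWalk (inj₂ (refl , refl)) (inj₂ (inj₁ (refl , refl)) ◅ w) q∉ = contradiction (here refl) q∉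
    oldWalk (inj₂ (refl , refl)) (inj₂ (inj₂ (refl , refl)) ◅ w) q∉ = contradiction (there (here refl)) q∉

    oldCycle : ∀ {p q zs} → New x y p q → Walk (Adj H⁺) q zs p → Unique (q ∷ zs) → 2 ≤ length zs → Walk (Adj H) q zs p
    oldCycle new (inj₁ a ◅ w) u 2≤ = a ◅ oldWalk new w (∉-head u)
    oldCycle (inj₁ (refl , refl)) (inj₂ (inj₁ (refl , refl)) ◅ w) u 2≤ = contradiction refl x≢y
    oldCycle (inj₁ (refl , refl)) (inj₂ (inj₂ (refl , refl)) ◅ w) (_ ∷ u) 2≤ with closed-trivial w u
    ... | refl = contradiction 2≤ λ { (s≤s ()) }
    oldCycle (inj₂ (refl , refl)) (inj₂ (inj₂ (refl , refl)) ◅ w) u 2≤ = contradiction refl x≢y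
    oldCycle (inj₂ (refl , refl)) (inj₂ (inj₁ (refl , refl)) ◅ w) (_ ∷ u) 2≤ with closed-trivial w u
    ... | refl = contradiction 2≤ λ { (s≤s ()) }

    findNew : ∀ {u xs v} → Walk (Adj H⁺) u xs v → Walk (Adj H) u xs v ⊎
              (∃₂ λ as bs → ∃₂ λ p q → xs ≡ as ++ q ∷ bs × Walk (Adj H⁺) u as p × New x y p q × Walk (Adj H⁺) q bs v)
    findNew ε = inj₁ ε
    findNew (inj₂ e ◅ w) = inj₂ ([] , _ , _ , _ , refl , ε , e , w)
    findNew (inj₁ a ◅ w) with findNew w
    ... | inj₁ w′ = inj₁ (a ◅ w′)
    ... | inj₂ (as , bs , p , q , eq , w₁ , e , w₂) = inj₂ (_ ∷ as , bs , p , q , cong (_ ∷_) eq , inj₁ a ◅ w₁ , e , w₂)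

    module _ (l : ℕ) (long : (C : Cyc (Adj H)) → l ≤ size C)
             (far : ∀ {qs} → Walk (Adj H) y qs x → Unique (y ∷ qs) → l ≤ suc (length qs)) where

      private
        closing : ∀ {p q zs} → New x y p q → Walk (Adj H⁺) q zs p → Unique (q ∷ zs) → 2 ≤ length zs → l ≤ suc (length zs)
        closing new w u 2≤ with oldCycle new w u 2≤
        closing (inj₁ (refl , refl)) w u 2≤ | w′ = far w′ u
        closing (inj₂ (refl , refl)) w u 2≤ | w′ with reverseʷ (Graph.sym H) w′
        ... | ys , w″ , p = subst (λ m → l ≤ suc m) (tail-↭ p) (far w″ (Unique-resp-↭ (↭-sym p) u))

      -- A cycle through the new edge is rotated until it closes with that edge. The rest of it is
      -- then a path of the old graph between the ends, and `far` applies.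
      addEdge-long : (C : Cyc (Adj H⁺)) → l ≤ size C
      addEdge-long (cyc w (inj₂ e) u 2≤) = closing e w u 2≤
      addEdge-long (cyc w c@(inj₁ a) u 2≤) with findNew w
      ... | inj₁ w′ = long (cyc w′ a u 2≤)
      ... | inj₂ (as , bs , p , q , refl , w₁ , e , w₂) =
        subst (l ≤_) (sym (↭-length perm))
          (closing e (w₂ ◅◅ (c ◅ w₁)) (Unique-resp-↭ perm u)
            (subst (2 ≤_) (suc-injective (↭-length perm)) 2≤))
        where
        open import Data.List.Relation.Binary.Permutation.Propositional.Properties using (++-comm)
        perm = ++-comm (_ ∷ as) (q ∷ bs)

module Ears {n : ℕ} (G : Graph (Fin n)) (l : ℕ) (3≤l : 3 ≤ l) where
  open Graph hiding (sym)

  occurrences : Fin n → List (Fin n) → ℕ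
  occurrences v = weight (λ u → ind (⁅ u ⁆ v))

  record Subgraph : Set₁ where
    field
      graph  : Graph (Fin n)
      within : ∀ {u v} → Adj graph u v → Adj G u v
      long   : (C : Cyc (Adj graph)) → l ≤ size C

  open Subgraph

  record Extension (H : Subgraph) (a b : Fin n) (is : List (Fin n)) : Set₁ where
    field
      result   : Subgraph
      extends  : ∀ {u v} → Adj (graph H) u v → Adj (graph result) u v
      path     : Walk (Adj (graph result)) a (is ++ [ b ]) b
      valency≡ : ∀ v → valency (graph result) v ≡ valency (graph H) v + (ind (⁅ a ⁆ v) + ind (⁅ b ⁆ v)) + 2 * occurrences v is

  -- The ear is attached edge by edge from a. Once the isolated vertex p hangs at a, every path from
  -- p to b starts with the step to a, so the distance to b grows by one while the remaining ear
  -- loses one: `far` is preserved, and the final edge closes only long cycles.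
  addEar : ∀ is {a b} (H : Subgraph) → Walk (Adj G) a (is ++ [ b ]) b → Unique (a ∷ is ++ [ b ]) → All (Isolated (graph H)) is →
           (∀ {qs} → Walk (Adj (graph H)) a qs b → Unique (a ∷ qs) → l ≤ length qs + suc (length is)) → Extension H a b is
  addEar [] {a} {b} H (g ◅ ε) u iso far = record
    { result   = record
      { graph  = addEdge (graph H) a b a≢b
      ; within = λ { (inj₁ h) → within H h ; (inj₂ (inj₁ (refl , refl))) → g ; (inj₂ (inj₂ (refl , refl))) → Graph.sym G g }
      ; long   = addEdge-long (graph H) a≢b l (long H) far′
      }
    ; extends  = inj₁
    ; path     = inj₂ (inj₁ (refl , refl)) ◅ ε
    ; valency≡ = λ v → trans (valency-addEdge (graph H) a≢b ¬ab v) (sym (+-identityʳ _))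
    }
    where
    a≢b : a ≢ b
    a≢b refl = ∉-head u (here refl)
    ¬ab : ¬ Adj (graph H) a b
    ¬ab h = contradiction (far (h ◅ ε) u) (<⇒≱ 3≤l)
    far′ : ∀ {qs} → Walk (Adj (graph H)) b qs a → Unique (b ∷ qs) → l ≤ suc (length qs)
    far′ w uq with reverseʷ (Graph.sym (graph H)) w
    ... | ys , w′ , p = subst (l ≤_) (trans (+-comm (length ys) 1) (cong suc (tail-↭ p))) (far w′ (Unique-resp-↭ (↭-sym p) uq))
  addEar (p ∷ is) {a} {b} H (g ◅ w) u@(a∉ ∷ u′) (isoₚ ∷ iso) far = record
    { result   = result E
    ; extends  = extends E ∘ inj₁
    ; path     = extends E (inj₂ (inj₁ (refl , refl))) ◅ path E
    ; valency≡ = λ v → trans (valency≡ E v) (trans (cong (λ d → d + (ind (⁅ p ⁆ v) + ind (⁅ b ⁆ v)) + 2 * occurrences v is)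
                   (valency-addEdge (graph H) a≢p ¬ap v))
                   (arith (valency (graph H) v) (ind (⁅ a ⁆ v)) (ind (⁅ p ⁆ v)) (ind (⁅ b ⁆ v)) (occurrences v is)))
    }
    where
    open Extension
    arith : ∀ d x y z o → d + (x + y) + (y + z) + 2 * o ≡ d + (x + z) + 2 * (y + o)
    arith = solve-∀
    a≢p : a ≢ p
    a≢p refl = ∉-head u (here refl)
    ¬ap : ¬ Adj (graph H) a p
    ¬ap h = isoₚ (Graph.sym (graph H) h)
    H₁ : Subgraph
    H₁ = record
      { graph  = addEdge (graph H) a p a≢p
      ; within = λ { (inj₁ h) → within H h ; (inj₂ (inj₁ (refl , refl))) → g ; (inj₂ (inj₂ (refl , refl))) → Graph.sym G g }
      -- No path of the old graph joins the isolated vertex p to a, so a pendant edge closes no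
      -- cycle.
      ; long   = addEdge-long (graph H) a≢p l (long H) λ { ε _ → contradiction refl a≢p ; (h ◅ _) _ → contradiction h isoₚ }
      }
    iso₁ : All (Isolated (graph H₁)) is
    iso₁ = All.tabulate λ { i (inj₁ h) → All.lookup iso i h
                          ; i (inj₂ (inj₁ (refl , refl))) → ∉-head u (there (∈-++⁺ˡ i))
                          ; i (inj₂ (inj₂ (refl , refl))) → ∉-head u′ (∈-++⁺ˡ i) }
    far₁ : ∀ {qs} → Walk (Adj (graph H₁)) p qs b → Unique (p ∷ qs) → l ≤ length qs + suc (length is)
    far₁ ε _ = contradiction (∈-++⁺ʳ is (here refl)) (∉-head u′)
    far₁ (inj₁ h ◅ _) _ = contradiction h isoₚ
    far₁ (inj₂ (inj₁ (refl , refl)) ◅ _) _ = contradiction refl a≢p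
    far₁ {_ ∷ qs} (inj₂ (inj₂ (refl , refl)) ◅ q) uq@(_ ∷ uq′) =
      subst (l ≤_) (+-suc (length qs) (suc (length is)))
        (far (oldWalk (graph H) a≢p (inj₁ (refl , refl)) q (∉-head uq)) uq′)
    E = addEar is H₁ w u′ iso₁ far₁

mapCyc : {V : Set} {R R′ : V → V → Set} → (∀ {u v} → R u v → R′ u v) → Cyc R → Cyc R′
mapCyc f (cyc w c u 2≤) = cyc (mapʷ f w) (f c) u 2≤

cycle? : ∀ {n} {R : Fin n → Fin n → Set} → (∀ u v → Dec (R u v)) → {Q : List (Fin n) → Set} → (∀ xs → Dec (Q xs)) →
         Dec (Σ[ C ∈ Cyc R ] Q (support C))
cycle? {R = R} R? {Q} Q? = map′
  (λ (x , y , zs , w , u , c , 2≤ , q) → cyc w c u 2≤ , q)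
  (λ (cyc w c u 2≤ , q) → _ , _ , _ , w , u , c , 2≤ , q)
  (Fin.any? λ x → Fin.any? λ y → simplePath? R? x y {λ zs → R y x × 2 ≤ length zs × Q (x ∷ zs)} λ zs → R? y x ×-dec (2 ≤? length zs) ×-dec Q? (x ∷ zs))

occurrences-∉ : ∀ {n} {v : Fin n} xs → v ∉ xs → weight (λ u → ind (⁅ u ⁆ v)) xs ≡ 0
occurrences-∉ []       v∉ = refl
occurrences-∉ (x ∷ xs) v∉ = cong₂ _+_ (cong ind (⁅⁆-≢ (v∉ ∘ here))) (occurrences-∉ xs (v∉ ∘ there))

occurrences-∈ : ∀ {n} {v : Fin n} {xs} → Unique xs → v ∈ xs → weight (λ u → ind (⁅ u ⁆ v)) xs ≡ 1
occurrences-∈ {v = v} {x ∷ xs} u       (here refl) = cong₂ _+_ (cong ind (⁅⁆-refl v)) (occurrences-∉ xs (∉-head u))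
occurrences-∈ {v = v} {x ∷ xs} (p ∷ u) (there i)   =
  cong₂ _+_ (cong ind (⁅⁆-≢ {u = v} {x} λ { refl → All.lookup p i refl })) (occurrences-∈ u i)

-- Growing a subgraph without short cycles

module Construction {n : ℕ} (G : Graph (Fin n)) (l : ℕ) (3≤l : 3 ≤ l) where
  open Graph hiding (sym)
  open Ears G l 3≤l
  open Subgraph
  open import Data.List.Membership.DecPropositional (Fin._≟_ {n}) using (_∈?_)

  LongFamily : ℕ → Set
  LongFamily k = ∃ λ (Cs : List (Cyc (Adj G))) →
    length Cs ≡ k × AllPairs (Disjoint on support) Cs × All (λ C → l ≤ size C) Cs

  -- The graph has all of `Fin n` as vertex set; the vertices outside H are those of valency 0.
  -- `roots` has one vertex of each initial cycle, so by `covered` its length bounds the number of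
  -- components of H.
  record State : Set₁ where
    field
      base    : Subgraph
      degrees : ∀ v → valency (graph base) v ≡ 0 ⊎ valency (graph base) v ≡ 2 ⊎ valency (graph base) v ≡ 3
      roots   : List (Fin n)
      covered : ∀ v → 1 ≤ valency (graph base) v → ∃ λ r → r ∈ roots × ∃ λ xs → Walk (Adj (graph base)) v xs r

    H : Graph (Fin n)
    H = graph base

    d : Fin n → ℕ
    d = valency H

    Active : Fin n → Set
    Active v = 1 ≤ d v

    active? : ∀ v → Dec (Active v)
    active? v = 1 ≤? d v

    branch? : ∀ v → Dec (d v ≡ 3)
    branch? v = d v ≟ 3

    branches : ℕ
    branches = card ⟦ branch? ⟧

    Hitting : Set
    Hitting = (C : Cyc (Adj G)) → l ≤ size C → Any Active (support C)

    Stuck : Set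
    Stuck = ∀ {a b is} → d a ≡ 2 → d b ≡ 2 → Walk (Adj G) a (is ++ [ b ]) b → Unique (a ∷ is ++ [ b ]) →
            All (λ v → d v ≡ 0) is → ∃ λ qs → Walk (Adj H) a qs b × Unique (a ∷ qs) × length qs + suc (length is) < l

    inactive : ∀ {v} → ¬ Active v → d v ≡ 0
    inactive = n<1⇒n≡0 ∘ ≰⇒>

    adj-active : ∀ {u v} → Adj H u v → Active u
    adj-active {u} {v} a = subst (1 ≤_) (sym (Counting.deg-adj H {λ _ → true} {v} {u} refl a)) (s≤s z≤n)

  open State

  suffix∈ : ∀ {R : Fin n → Fin n → Set} {a xs b v} → Walk R a xs b → v ∈ a ∷ xs → ∃ λ bs → Walk R v bs b
  suffix∈ w i with splitʷ w i
  ... | _ , bs , _ , _ , w′ = bs , w′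

  emptyState : State
  emptyState = record
    { base    = record
      { graph  = record { Adj = λ _ _ → ⊥ ; adj? = λ _ _ → no id ; sym = id ; irrefl = λ _ () }
      ; within = λ ()
      ; long   = λ { (cyc _ () _ _) }
      }
    ; degrees = λ v → inj₁ (sum-zero λ _ → refl)
    ; roots   = []
    ; covered = λ v p → contradiction p (<⇒≱ (s≤s (≤-reflexive (sum-zero λ _ → refl))))
    }

  -- A cycle is two ears: the single edge xp between isolated vertices, and then the remaining path
  -- from p back to x. The second ear closes exactly the given long cycle.
  addCycle : (S : State) (C : Cyc (Adj G)) → l ≤ size C → All (λ v → ¬ Active S v) (support C) →
             Σ[ S′ ∈ State ] length (roots S′) ≡ suc (length (roots S)) ×
             (∀ v → Active S v → Active S′ v) × All (Active S′) (support C)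
  addCycle S (cyc {x} {p ∷ is} (a ◅ w) c u 2≤) l≤ off = S′ , refl ,
      (λ v p → ≤-trans p (≤-trans (m≤m+n _ _) (≤-reflexive (sym (d′≡ v))))) ,
      All.tabulate (λ {v} i → subst (1 ≤_) (sym (new i)) (s≤s z≤n))
    where
    open Extension
    off₀ : ∀ {v} → v ∈ x ∷ p ∷ is → d S v ≡ 0
    off₀ i = inactive S (All.lookup off i)
    x≢p : x ≢ p
    x≢p refl = ∉-head u (here refl)
    E₁ : Extension (base S) x p []
    E₁ = addEar [] (base S) (a ◅ ε) ((x≢p ∷ []) ∷ [] ∷ []) [] λ { ε _ → contradiction refl x≢p
           ; (h ◅ _) _ → contradiction h (valency≡0 (H S) (off₀ (here refl))) }
    isolated₁ : All (Isolated (graph (result E₁))) is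
    isolated₁ = All.tabulate λ {v} i → valency≡0 (graph (result E₁)) (trans (valency≡ E₁ v)
      (cong₂ _+_ (cong₂ _+_ (off₀ (there (there i))) (cong₂ _+_ (cong ind (⁅⁆-≢ {u = v} {x} λ { refl → ∉-head u (there i) }))
        (cong ind (⁅⁆-≢ {u = v} {p} λ { refl → ∉-head (AllPairs.tail u) i })))) refl))
    E₂ : Extension (result E₁) p x is
    E₂ = addEar is (result E₁) (w ◅◅ (c ◅ ε))
      (Unique-resp-↭ (↭-Solver.solve 3 (λ x p is → x ⊕ (p ⊕ is) ⊜ p ⊕ (is ⊕ x)) ↭-refl [ x ] [ p ] is) u) isolated₁
      λ { ε _ → contradiction refl x≢p ; (_ ◅ _) _ → ≤-trans l≤ (s≤s (m≤n+m _ _)) }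
      where open ↭-Solver
    d′ : Fin n → ℕ
    d′ = valency (graph (result E₂))
    d′≡ : ∀ v → d′ v ≡ d S v + 2 * occurrences v (x ∷ p ∷ is)
    d′≡ v = trans (valency≡ E₂ v) (trans (cong (λ d → d + (ind (⁅ p ⁆ v) + ind (⁅ x ⁆ v)) + 2 * occurrences v is) (valency≡ E₁ v))
      (arith (d S v) (ind (⁅ x ⁆ v)) (ind (⁅ p ⁆ v)) (occurrences v is)))
      where
      arith : ∀ d x p o → d + (x + p) + 0 + (p + x) + 2 * o ≡ d + 2 * (x + (p + o))
      arith = solve-∀
    new : ∀ {v} → v ∈ x ∷ p ∷ is → d′ v ≡ 2
    new {v} i = trans (d′≡ v) (cong₂ (λ d o → d + 2 * o) (off₀ i) (occurrences-∈ u i))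
    old : ∀ {v} → v ∉ x ∷ p ∷ is → d′ v ≡ d S v
    old {v} v∉ = trans (d′≡ v) (trans (cong (λ o → d S v + 2 * o) (occurrences-∉ (x ∷ p ∷ is) v∉)) (+-identityʳ _))
    S′ : State
    S′ = record
      { base    = result E₂
      ; degrees = λ v → case v ∈? (x ∷ p ∷ is) of λ
          { (yes i) → inj₂ (inj₁ (new i))
          ; (no ¬i) → subst (λ m → m ≡ 0 ⊎ m ≡ 2 ⊎ m ≡ 3) (sym (old ¬i)) (degrees S v) }
      ; roots   = x ∷ roots S
      ; covered = λ v act → case v ∈? (x ∷ p ∷ is) of λ
          { (yes i) → x , here refl , suffix∈ (path E₂)
              (∈-resp-↭ (↭-Solver.solve 3 (λ x p is → x ⊕ (p ⊕ is) ⊜ p ⊕ (is ⊕ x)) ↭-refl [ x ] [ p ] is) i)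
          ; (no ¬i) → let r , r∈ , xs , walk = covered S v (subst (1 ≤_) (old ¬i) act)
                      in r , there r∈ , xs , mapʷ (extends E₂ ∘ extends E₁) walk }
      }
      where open ↭-Solver

  rootPhase : ∀ {k} m (S : State) (Cs : List (Cyc (Adj G))) → m + length Cs ≡ k → length (roots S) ≡ length Cs →
              AllPairs (Disjoint on support) Cs → All (λ C → l ≤ size C) Cs → All (λ C → All (Active S) (support C)) Cs →
              LongFamily k ⊎ Σ[ S ∈ State ] length (roots S) < k × Hitting S
  rootPhase zero S Cs refl len dj long∀ act = inj₁ (Cs , refl , dj , long∀)
  rootPhase (suc m) S Cs refl len dj long∀ act
    with cycle? (adj? G) {λ xs → l ≤ length xs × All (λ v → ¬ Active S v) xs}
           (λ xs → (l ≤? length xs) ×-dec All.all? (λ v → ¬? (active? S v)) xs)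
  ... | no none = inj₂ (S , ≤-trans (≤-reflexive (cong suc len)) (s≤s (m≤n+m _ m)) , hit)
    where
    hit : Hitting S
    hit C l≤ with Any.any? (active? S) (support C)
    ... | yes i = i
    ... | no ¬i = contradiction (C , l≤ , ¬Any⇒All¬ _ ¬i) none
      where open import Data.List.Relation.Unary.All.Properties using (¬Any⇒All¬)
  ... | yes (C , l≤ , off) with addCycle S C l≤ off
  ... | S′ , len′ , mono , actC = rootPhase m S′ (C ∷ Cs) (+-suc m (length Cs)) (trans len′ (cong suc len))
    (All.map (λ {D} actD {v} (i , j) → All.lookup off i (All.lookup actD j)) act ∷ dj) (l≤ ∷ long∀)
    (actC ∷ All.map (All.map λ {v} → mono v) act)

  module _ (S : State) where

    GoodEar : Fin n → Fin n → List (Fin n) → Set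
    GoodEar a b is = d S a ≡ 2 × d S b ≡ 2 × Walk (Adj G) a (is ++ [ b ]) b × Unique (a ∷ is ++ [ b ]) ×
      All (λ v → d S v ≡ 0) is × ¬ ∃ λ qs → Walk (Adj (H S)) a qs b × Unique (a ∷ qs) × length qs + suc (length is) < l

    goodEar? : Dec (∃₂ λ a b → ∃ λ is → GoodEar a b is)
    goodEar? = Fin.any? λ a → Fin.any? λ b → search
      (λ is → (d S a ≟ 2) ×-dec (d S b ≟ 2) ×-dec walk? Fin._≟_ (adj? G) a (is ++ [ b ]) b ×-dec unique? (a ∷ is ++ [ b ]) ×-dec
        All.all? (λ v → d S v ≟ 0) is ×-dec ¬? (simplePath? (adj? (H S)) a b λ qs → length qs + suc (length is) <? l))
      (λ { {is} (_ , _ , _ , _ ∷ u , _) → proj₁ (Unique-++⁻ is u) })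

    attach : ∀ {a b is} → GoodEar a b is →
             Σ[ S′ ∈ State ] roots S′ ≡ roots S × (∀ v → Active S v → Active S′ v) × suc (branches S) ≤ branches S′
    attach {a} {b} {is} (da , db , w , u , off , far) = S′ , refl ,
        (λ v p → ≤-trans p (≤-trans (≤-trans (m≤m+n _ _) (m≤m+n _ _)) (≤-reflexive (sym (valency≡ E v))))) , more
      where
      open Extension
      E : Extension (base S) a b is
      E = addEar is (base S) w u (All.map (λ {v} → valency≡0 (H S)) off) λ {qs} q uq → ≮⇒≥ λ short → far (qs , q , uq , short)
      d′ : Fin n → ℕ
      d′ = valency (graph (result E))
      a≢b : a ≢ b
      a≢b refl = ∉-head u (∈-++⁺ʳ is (here refl))
      a∉ : a ∉ is
      a∉ i = ∉-head u (∈-++⁺ˡ i)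
      b∉ : b ∉ is
      b∉ i = proj₂ (proj₂ (Unique-++⁻ is (AllPairs.tail u))) (i , here refl)
      d′-end : ∀ {v} → (v ≡ a ⊎ v ≡ b) → d′ v ≡ 3
      d′-end (inj₁ refl) = trans (valency≡ E a) (cong₂ (λ x o → x + 2 * o)
        (cong₂ _+_ da (cong₂ (λ x y → ind x + ind y) (⁅⁆-refl a) (⁅⁆-≢ a≢b))) (occurrences-∉ is a∉))
      d′-end (inj₂ refl) = trans (valency≡ E b) (cong₂ (λ x o → x + 2 * o)
        (cong₂ _+_ db (cong₂ (λ x y → ind x + ind y) (⁅⁆-≢ (a≢b ∘ sym)) (⁅⁆-refl b))) (occurrences-∉ is b∉))
      d′-in : ∀ {v} → v ∈ is → d′ v ≡ 2
      d′-in {v} i = trans (valency≡ E v) (cong₂ (λ x o → x + 2 * o)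
        (cong₂ _+_ (All.lookup off i) (cong₂ (λ x y → ind x + ind y) (⁅⁆-≢ {u = v} {a} λ { refl → a∉ i }) (⁅⁆-≢ {u = v} {b} λ { refl → b∉ i })))
        (occurrences-∈ (proj₁ (Unique-++⁻ is (AllPairs.tail u))) i))
      d′-old : ∀ {v} → v ≢ a → v ≢ b → v ∉ is → d′ v ≡ d S v
      d′-old {v} v≢a v≢b v∉ = trans (valency≡ E v) (trans (cong₂ (λ x o → x + 2 * o)
        (cong₂ (λ x y → d S v + (ind x + ind y)) (⁅⁆-≢ v≢a) (⁅⁆-≢ v≢b)) (occurrences-∉ is v∉))
        (trans (+-identityʳ _) (+-identityʳ _)))
      position : ∀ v → (v ≡ a ⊎ v ≡ b) ⊎ v ∈ is ⊎ d′ v ≡ d S v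
      position v with v Fin.≟ a | v Fin.≟ b | v ∈? is
      ... | yes p | _     | _     = inj₁ (inj₁ p)
      ... | no _  | yes p | _     = inj₁ (inj₂ p)
      ... | no _  | no _  | yes i = inj₂ (inj₁ i)
      ... | no p  | no q  | no r  = inj₂ (inj₂ (d′-old p q r))
      to-b : ∀ {v} → v ∈ a ∷ is ++ [ b ] → ∃ λ r → r ∈ roots S × ∃ λ xs → Walk (Adj (graph (result E))) v xs r
      to-b i with suffix∈ (path E) i | covered S b (subst (1 ≤_) (sym db) (s≤s z≤n))
      ... | bs , w₁ | r , r∈ , xs , w₂ = r , r∈ , bs ++ xs , w₁ ◅◅ mapʷ (extends E) w₂
      S′ : State
      S′ = record
        { base    = result E
        ; degrees = λ v → case position v of λ
            { (inj₁ e) → inj₂ (inj₂ (d′-end e))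
            ; (inj₂ (inj₁ i)) → inj₂ (inj₁ (d′-in i))
            ; (inj₂ (inj₂ eq)) → subst (λ m → m ≡ 0 ⊎ m ≡ 2 ⊎ m ≡ 3) (sym eq) (degrees S v) }
        ; roots   = roots S
        ; covered = λ v act → case position v of λ
            { (inj₁ (inj₁ refl)) → to-b (here refl)
            ; (inj₁ (inj₂ refl)) → to-b (there (∈-++⁺ʳ is (here refl)))
            ; (inj₂ (inj₁ i)) → to-b (there (∈-++⁺ˡ i))
            ; (inj₂ (inj₂ eq)) → let r , r∈ , xs , walk = covered S v (subst (1 ≤_) eq act)
                                 in r , r∈ , xs , mapʷ (extends E) walk }
        }
      more : suc (branches S) ≤ branches S′
      more = begin
        suc (branches S)  ≡⟨ cong (_+ branches S) (sym (card-⁅⁆ a)) ⟩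
        card ⁅ a ⁆ + branches S  ≡⟨ sum-+ (ind ∘ ⁅ a ⁆) (ind ∘ ⟦ branch? S ⟧) ⟨
        sum (λ v → ind (⁅ a ⁆ v) + ind (⟦ branch? S ⟧ v))  ≤⟨ sum-mono pointwise ⟩
        branches S′  ∎
        where
        open ≤-Reasoning
        pointwise : ∀ v → ind (⁅ a ⁆ v) + ind (⟦ branch? S ⟧ v) ≤ ind (⟦ branch? S′ ⟧ v)
        pointwise v with v Fin.≟ a
        ... | yes refl = ≤-trans (≤-reflexive (cong (λ x → 1 + ind x) not3)) (≤-reflexive (sym (cong ind (⟦⟧-true (branch? S′) (d′-end (inj₁ refl))))))
          where
          not3 : ⟦ branch? S ⟧ a ≡ false
          not3 rewrite da = refl
        ... | no v≢a = ind-mono {S = ⟦ branch? S ⟧} {⟦ branch? S′ ⟧} (λ v b → ⟦⟧-true (branch? S′) (still (holds (branch? S) {v} b))) v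
          where
          still : ∀ {v} → d S v ≡ 3 → d′ v ≡ 3
          still {v} d3 with position v
          ... | inj₁ e = d′-end e
          ... | inj₂ (inj₁ i) = contradiction (trans (sym d3) (All.lookup off i)) λ ()
          ... | inj₂ (inj₂ eq) = trans eq d3

  -- Each ear creates new vertices of degree 3, so at most `m` further ears reach `t`. Active
  -- vertices stay active, so `Hitting` persists.
  earPhase : ∀ {t} m (S : State) → t ≤ branches S + m → Hitting S →
             Σ[ S′ ∈ State ] roots S′ ≡ roots S × Hitting S′ × (t ≤ branches S′ ⊎ Stuck S′)
  earPhase zero S t≤ hit = S , refl , hit , inj₁ (subst (_ ≤_) (+-identityʳ _) t≤)
  earPhase {t} (suc m) S t≤ hit with goodEar? S
  ... | no none = S , refl , hit , inj₂ λ {a} {b} {is} da db w u off →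
    case simplePath? (adj? (H S)) a b (λ qs → length qs + suc (length is) <? l) of λ
      { (yes bad) → bad ; (no good) → contradiction (a , b , is , da , db , w , u , off , good) none }
  ... | yes (a , b , is , good) with attach S good
  ... | S′ , eq , mono , more with earPhase {t} m S′ (≤-trans t≤ (≤-trans (≤-reflexive (+-suc _ m)) (+-monoˡ-≤ m more)))
                                       (λ C l≤ → Any.map (λ {v} → mono v) (hit C l≤))
  ... | S″ , eq′ , hit′ , end = S″ , trans eq′ eq , hit′ , end

  module _ (S : State) where
    open Counting (H S)

    d≤3 : ∀ v → d S v ≤ 3
    d≤3 v with degrees S v
    ... | inj₁ eq        = ≤-trans (≤-reflexive eq) z≤n
    ... | inj₂ (inj₁ eq) = ≤-trans (≤-reflexive eq) (n≤1+n 2)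
    ... | inj₂ (inj₂ eq) = ≤-reflexive eq

    -- Thus `branches` is 2(|E| - |V|) for H: the quantity on which `disjointCycles` draws, and
    -- which also limits the pruning in `removed-bound`.
    volume : vol ⟦ active? S ⟧ ≡ 2 * card ⟦ active? S ⟧ + branches S
    volume = trans (sum-cong pointwise) (trans (sum-+ (λ v → 2 * ind (A v)) (ind ∘ ⟦ branch? S ⟧))
      (cong (_+ branches S) (sym (*-distribˡ-∑ 2 (ind ∘ A)))))
      where
      A = ⟦ active? S ⟧
      deg-A : ∀ v → deg A v ≡ d S v
      deg-A v = sum-cong λ w → same w
        where
        same : ∀ w → ind (A w) * edge v w ≡ 1 * edge v w
        same w with adj? (H S) v w
        ... | yes a = cong (λ b → ind b * 1) (⟦⟧-true (active? S) (adj-active S (Graph.sym (H S) a)))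
        ... | no _  = *-zeroʳ (ind (A w))
      value : ∀ v → ind (A v) * d S v ≡ 2 * ind (A v) + ind (⟦ branch? S ⟧ v)
      value v with d S v | degrees S v
      ... | _ | inj₁ refl        = refl
      ... | _ | inj₂ (inj₁ refl) = refl
      ... | _ | inj₂ (inj₂ refl) = refl
      pointwise : ∀ v → ind (A v) * deg A v ≡ 2 * ind (A v) + ind (⟦ branch? S ⟧ v)
      pointwise v = trans (cong (ind (A v) *_) (deg-A v)) (value v)

    module _ (t ρ : ℕ → ℕ) (t-step : ∀ k → t k + (2 * ρ k + 3) ≤ t (suc k)) (ρ-large : ∀ k → 2 * t (suc k) + 5 < 3 * 2 ^ ρ k) where

      manyBranches : ∀ k → 2 * t k ≤ branches S → LongFamily k
      manyBranches k enough with Packing.disjointCycles (H S) d≤3 t ρ t-step ρ-large k ⟦ active? S ⟧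
                                   (≤-trans (+-monoʳ-≤ (2 * card ⟦ active? S ⟧) enough) (≤-reflexive (sym volume)))
      ... | Cs , len , dj , _ = map (mapCyc (within (base S))) Cs , trans (length-map _ Cs) len ,
        AllPairsₚ.map⁺ dj , Allₚ.map⁺ (All.tabulate λ {C} _ → long (base S) C)
        where
        open import Data.List.Properties using (length-map)
        import Data.List.Relation.Unary.AllPairs.Properties as AllPairsₚ
        import Data.List.Relation.Unary.All.Properties as Allₚ

-- The hitting set

walk-end : ∀ {V : Set} {R R′ : V → V → Set} {x xs y y′} → Walk R x xs y → Walk R′ x xs y′ → y ≡ y′
walk-end ε       ε        = refl
walk-end (_ ◅ w) (_ ◅ w′) = walk-end w w′

walk-++⁻ : ∀ {V : Set} {R : V → V → Set} {x} xs {ys y} → Walk R x (xs ++ ys) y → ∃ λ m → Walk R x xs m × Walk R m ys y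
walk-++⁻ []       w       = _ , ε , w
walk-++⁻ (_ ∷ xs) (r ◅ w) with walk-++⁻ xs w
... | m , w₁ , w₂ = m , r ◅ w₁ , w₂

zipʷ : ∀ {V : Set} {R R′ : V → V → Set} {x xs y y′} → Walk R x xs y → Walk R′ x xs y′ → Walk (λ u v → R u v × R′ u v) x xs y
zipʷ ε       _        = ε
zipʷ (r ◅ w) (s ◅ w′) = (r , s) ◅ zipʷ w w′

elements : ∀ {n} m (S : Fin n → Bool) → card S ≡ m → ∃ λ xs → length xs ≡ m × (∀ {v} → S v ≡ true → v ∈ xs)
elements {n} m S eq with Fin.any? (λ v → S v ≟ᵇ true)
elements zero S eq | no none = [] , refl , λ Sv → contradiction (_ , Sv) none
elements zero S eq | yes (v , Sv) =
  contradiction (≤-trans (≤-reflexive (sym (cong ind Sv))) (≤-trans (term≤sum (ind ∘ S) v) (≤-reflexive eq))) λ ()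
elements (suc m) S eq | no none with positive-term {f = ind ∘ S} (≤-trans (s≤s z≤n) (≤-reflexive (sym eq)))
... | v , p = contradiction (v , ind-pos p) none
elements {n} (suc m) S eq | yes (v , Sv) with elements m (S ∖ v) (suc-injective (trans (sym (card-∖ Sv)) eq))
... | xs , len , all = v ∷ xs , cong suc len , λ {u} Su → case u Fin.≟ v of λ
  { (yes refl) → here refl
  ; (no u≢v) → there (all (trans (∖-other S u≢v) Su)) }

-- Edges of a spanning forest

module Spanning {n : ℕ} (H : Graph (Fin n)) where
  open Graph H renaming (sym to adj-sym)
  open Counting H
  open Moore H (λ _ → true) using (Within; Within-sym; Within-all) public
  open import Data.List.Membership.DecPropositional (Fin._≟_ {n}) using (_∈?_)

  private
    boundary-step : ∀ {A B : Fin n → Bool} {v xs r} → Walk (Within A) v xs r → A v ≡ true → B v ≡ false → B r ≡ true →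
                    ∃₂ λ u w → A u ≡ true × B u ≡ false × B w ≡ true × Adj u w
    boundary-step ε Av Bv Br = ⊥-elim (true≢false Br Bv)
    boundary-step {B = B} (_◅_ {z = z} (a , _ , Az) w) Av Bv Br with B z in eq
    ... | true  = _ , z , Av , Bv , eq , a
    ... | false = boundary-step w Az eq Br

    grow : ∀ {A : Fin n → Bool} {R : List (Fin n)} m (B : Fin n → Bool) → card A ≤ card B + m → B ⊆ᵇ A →
           (∀ v → A v ≡ true → ∃ λ r → B r ≡ true × ∃ λ xs → Walk (Within A) v xs r) →
           2 * card B ≤ vol B + 2 * length R → 2 * card A ≤ vol A + 2 * length R
    grow {A} {R} m B fuel B⊆A reach b with Fin.any? (λ v → (A v ≟ᵇ true) ×-dec (B v ≟ᵇ false))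
    ... | no none = ≤-trans (*-monoʳ-≤ 2 (card-mono A⊆B)) (≤-trans b (+-monoˡ-≤ _ (≤-reflexive (⟨⟩-cong (ind ∘ B) (ind ∘ A) same))))
      where
      A⊆B : A ⊆ᵇ B
      A⊆B v Av with B v in eq
      ... | true  = refl
      ... | false = contradiction (v , Av , eq) none
      same : ∀ v → ind (B v) ≡ ind (A v)
      same v = ≤-antisym (ind-mono {S = B} {A} B⊆A v) (ind-mono {S = A} {B} A⊆B v)
    ... | yes (v , Av , Bv) with reach v Av
    ... | r , Br , xs , w with boundary-step w Av Bv Br
    ... | u , x , Au , Bu , Bx , a = next m fuel
      where
      B′ : Fin n → Bool
      B′ y = B y ∨ ⁅ u ⁆ y
      B⊆B′ : B ⊆ᵇ B′
      B⊆B′ y By rewrite By = refl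
      disjoint : ∀ y → ⁅ u ⁆ y ≡ true → B y ≡ false
      disjoint y p = trans (cong B (⁅⁆⇒≡ p)) Bu
      card′ : card B′ ≡ suc (card B)
      card′ = trans (card-∨ B ⁅ u ⁆ disjoint) (trans (cong (card B +_) (card-⁅⁆ u)) (+-comm (card B) 1))
      vol′ : vol B + 2 ≤ vol B′
      vol′ = begin
        vol B + 2  ≤⟨ +-monoʳ-≤ (vol B) (*-monoʳ-≤ 2 1≤deg) ⟩
        vol B + 2 * deg B u  ≡⟨ cong (λ m → vol B + 2 * m) (sum-⁅⁆ u (deg B)) ⟨
        vol B + 2 * ⟨ ind ∘ ⁅ u ⁆ , ind ∘ B ⟩  ≤⟨ m≤m+n _ _ ⟩
        vol B + 2 * ⟨ ind ∘ ⁅ u ⁆ , ind ∘ B ⟩ + vol ⁅ u ⁆  ≡⟨ ⟨⟩-square (ind ∘ B) (ind ∘ ⁅ u ⁆) ⟨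
        ⟨ (λ y → ind (B y) + ind (⁅ u ⁆ y)) , (λ y → ind (B y) + ind (⁅ u ⁆ y)) ⟩
                                                                           ≡⟨ ⟨⟩-cong (ind ∘ B′) (λ y → ind (B y) + ind (⁅ u ⁆ y)) (λ y → ind-∨ (disjoint y)) ⟨
        vol B′  ∎
        where
        open ≤-Reasoning
        1≤deg : 1 ≤ deg B u
        1≤deg = ≤-trans (s≤s z≤n) (≤-reflexive (sym (deg-adj {B} Bx a)))
      B′⊆A : B′ ⊆ᵇ A
      B′⊆A y p with B y in eq
      ... | true  = B⊆A y eq
      ... | false = trans (cong A (⁅⁆⇒≡ p)) Au
      bound′ : 2 * card B′ ≤ vol B′ + 2 * length R
      bound′ = begin
        2 * card B′       ≡⟨ cong (2 *_) card′ ⟩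
        2 * suc (card B)  ≡⟨ *-suc 2 (card B) ⟩
        2 + 2 * card B    ≤⟨ +-monoʳ-≤ 2 b ⟩
        2 + (vol B + 2 * length R) ≡⟨ arith (vol B) (2 * length R) ⟩
        vol B + 2 + 2 * length R  ≤⟨ +-monoˡ-≤ (2 * length R) vol′ ⟩
        vol B′ + 2 * length R     ∎
        where
        open ≤-Reasoning
        arith : ∀ a b → 2 + (a + b) ≡ a + 2 + b
        arith = solve-∀
      next : ∀ m → card A ≤ card B + m → 2 * card A ≤ vol A + 2 * length R
      next zero    f = contradiction (≤-trans (card-mono B′⊆A) (≤-trans f (≤-reflexive (+-identityʳ _)))) (<⇒≱ (≤-reflexive (sym card′)))
      next (suc m) f = grow {A} {R} m B′ (≤-trans f (≤-reflexive (trans (+-suc (card B) m) (cong (_+ m) (sym card′))))) B′⊆A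
        (λ v Av → let r , Br , xs , w = reach v Av in r , B⊆B′ r Br , xs , w) bound′

  -- Starting from the roots in `A`, a set is grown to all of `A`, each new vertex bringing an edge,
  -- as in a spanning forest. The inequality is |A| - |R| ≤ |E|, doubled.
  spanning : ∀ (A : Fin n → Bool) (R : List (Fin n)) →
             (∀ v → A v ≡ true → ∃ λ r → r ∈ R × ∃ λ xs → Walk (Within A) v xs r) → 2 * card A ≤ vol A + 2 * length R
  spanning A R reach = grow {A} {R} (card A) B (m≤n+m _ _) (λ v p → proj₂ (holds B? {v} p)) reachB
    (≤-trans (*-monoʳ-≤ 2 cardB) (m≤n+m _ (vol B)))
    where
    B? : ∀ v → Dec (v ∈ R × A v ≡ true)
    B? v = (v ∈? R) ×-dec (A v ≟ᵇ true)
    B = ⟦ B? ⟧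
    reachB : ∀ v → A v ≡ true → ∃ λ r → B r ≡ true × ∃ λ xs → Walk (Within A) v xs r
    reachB v Av with reach v Av
    ... | r , r∈ , xs , w = r , ⟦⟧-true B? (r∈ , All.lookup (Within-all Av w) (last∈ w)) , xs , w
    occ : List (Fin n) → Fin n → ℕ
    occ xs v = weight (λ u → ind (⁅ u ⁆ v)) xs
    occ≥ : ∀ {xs v} → v ∈ xs → 1 ≤ occ xs v
    occ≥ {x ∷ xs} (here refl) = ≤-trans (≤-reflexive (sym (cong ind (⁅⁆-refl x)))) (m≤m+n _ _)
    occ≥ {x ∷ xs} (there i)   = ≤-trans (occ≥ i) (m≤n+m _ _)
    sum-occ : ∀ xs → sum (occ xs) ≡ length xs
    sum-occ []       = sum-zero λ _ → refl
    sum-occ (x ∷ xs) = trans (sum-+ (ind ∘ ⁅ x ⁆) (occ xs)) (cong₂ _+_ (card-⁅⁆ x) (sum-occ xs))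
    cardB : card B ≤ length R
    cardB = ≤-trans (sum-mono pointwise) (≤-reflexive (sum-occ R))
      where
      pointwise : ∀ v → ind (B v) ≤ occ R v
      pointwise v with B v in eq
      ... | false = z≤n
      ... | true  = occ≥ (proj₁ (holds B? {v} eq))

-- Pruning at cut vertices

module Final {n : ℕ} (G : Graph (Fin n)) (l : ℕ) (3≤l : 3 ≤ l)
             (gap : (C : Cyc (Graph.Adj G)) → size C ≤ 6 * l → size C < l)
             (S : Construction.State G l 3≤l) where

  open Graph hiding (sym)
  open Construction G l 3≤l
  open State S
  open EdgeClasses Fin._≟_ (Graph.sym G) (irrefl G refl) l 3≤l gap
  open Spanning H
  open Counting H using (deg; vol; deg-adj; vol-∖)
  open Ears.Subgraph base using (within)
  open import Data.List.Membership.DecPropositional (Fin._≟_ {n}) using (_∈?_)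
  open import Relation.Nullary.Decidable using (_→-dec_)

  link? : ∀ a b u w → Dec (Link a b u w)
  link? a b u w = map′
    (λ { (inj₁ (r , p , q)) → same r p q ; (inj₂ (inj₁ j)) → fwd j ; (inj₂ (inj₂ j)) → bwd j })
    (λ { (same r p q) → inj₁ (r , p , q) ; (fwd j) → inj₂ (inj₁ j) ; (bwd j) → inj₂ (inj₂ j) })
    ((adj? G a b ×-dec (a Fin.≟ u) ×-dec (b Fin.≟ w)) ⊎-dec (joined? a b u w ⊎-dec joined? a b w u))
    where
    joined? : ∀ a b u w → Dec (Joined a b u w)
    joined? a b u w = map′
      (λ (e , f , as , w₁ , _ , bs , w₂ , _ , uq , s) → joined e w₁ f w₂ uq s)
      (λ (joined {as} {bs} e w₁ f w₂ uq s) → e , f , as , w₁ , proj₁ (Unique-++⁻ (b ∷ as) uq) , bs , w₂ , proj₁ (proj₂ (Unique-++⁻ (b ∷ as) uq)) , uq , s)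
      (adj? G a b ×-dec adj? G u w ×-dec simplePath? (adj? G) b u λ as → simplePath? (adj? G) w a λ bs →
        unique? ((b ∷ as) ++ (w ∷ bs)) ×-dec (length as + length bs + 2 <? l))

  -- The edges of H at a cut vertex lie in different classes, so a short path
  -- of H cannot pass through it.
  Cut : Fin n → Set
  Cut x = ∀ c e → Adj H x c → Adj H x e → c ≢ e → ¬ Link x c x e

  cut? : ∀ x → Dec (Cut x)
  cut? x = Fin.all? λ c → Fin.all? λ e → adj? H x c →-dec (adj? H x e →-dec (¬? (c Fin.≟ e) →-dec ¬? (link? x c x e)))

  two-neighbours : ∀ {v a b z} → d v ≡ 2 → Adj H v a → Adj H v b → a ≢ b → Adj H v z → z ≡ a ⊎ z ≡ b
  two-neighbours {v} {a} {b} {z} dv va vb a≢b vz with z Fin.≟ a | z Fin.≟ b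
  ... | yes p | _ = inj₁ p
  ... | _ | yes q = inj₂ q
  ... | no z≢a | no z≢b = contradiction (trans (sym dv) three) λ ()
    where
    full : Fin n → Bool
    full _ = true
    three : d v ≡ suc (suc (suc (deg (((full ∖ a) ∖ b) ∖ z) v)))
    three = trans (deg-adj {full} refl va) (cong suc (trans (deg-adj {full ∖ a} (∖-other full (a≢b ∘ sym)) vb)
      (cong suc (deg-adj {(full ∖ a) ∖ b} (trans (∖-other (full ∖ a) z≢b) (∖-other full z≢a)) vz))))

  Removable : (Fin n → Bool) → Fin n → Set
  Removable A v = d v ≡ 2 × A v ≡ true × Cut v ×
    ∃₂ λ a b → a ≢ b × Adj H v a × Adj H v b × ∃ λ xs → Walk (Within (A ∖ v)) a xs b

  removable? : ∀ A v → Dec (Removable A v)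
  removable? A v = (d v ≟ 2) ×-dec (A v ≟ᵇ true) ×-dec cut? v ×-dec Fin.any? λ a → Fin.any? λ b →
    ¬? (a Fin.≟ b) ×-dec adj? H v a ×-dec adj? H v b ×-dec
    map′ (λ (xs , w , _) → xs , w) (λ (xs , w) → let ys , w′ , u , _ = simplify Fin._≟_ w in ys , w′ , u , _)
      (simplePath? {R = Within (A ∖ v)} (λ x y → adj? H x y ×-dec ((A ∖ v) x ≟ᵇ true) ×-dec ((A ∖ v) y ≟ᵇ true)) a b {λ _ → ⊤} λ _ → yes _)
    where open import Data.Unit.Base using (⊤)

  -- `reps` takes the place of `roots`, some of which may have been removed; only its length matters
  -- for the number of components. The last two fields record one vertex and at least two edges lost
  -- per removal.
  record Pruned (A : Fin n → Bool) : Set where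
    field
      removed  : List (Fin n)
      gone     : ∀ {v} → Active v → A v ≡ false → v ∈ removed
      cut      : ∀ {v} → Active v → A v ≡ false → Cut v
      live     : ∀ {v} → A v ≡ true → Active v
      reps     : List (Fin n)
      reps-len : length reps ≡ length roots
      reach    : ∀ v → A v ≡ true → ∃ λ r → r ∈ reps × ∃ λ xs → Walk (Within A) v xs r
      size≡    : card A + length removed ≡ card ⟦ active? ⟧
      volume≤  : vol A + 4 * length removed ≤ vol ⟦ active? ⟧

  open Pruned

  initial : Pruned ⟦ active? ⟧
  initial = record
    { removed  = []
    ; gone     = λ act off → ⊥-elim (true≢false (⟦⟧-true active? act) off)
    ; cut      = λ act off → ⊥-elim (true≢false (⟦⟧-true active? act) off)
    ; live     = holds active?
    ; reps     = roots
    ; reps-len = refl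
    ; reach    = λ v Av → let r , r∈ , xs , w = covered v (holds active? {v} Av) in r , r∈ , xs , mapʷ inside w
    ; size≡    = +-identityʳ _
    ; volume≤  = ≤-reflexive (+-identityʳ _)
    }
    where
    inside : ∀ {u v} → Adj H u v → Within ⟦ active? ⟧ u v
    inside a = a , ⟦⟧-true active? (adj-active a) , ⟦⟧-true active? (adj-active (Graph.sym H a))

  -- Since v lies on a cycle of what is left, nothing gets disconnected: walks through v are led
  -- round along the path from a to b, and if v was a representative, its neighbour a takes over.
  remove : ∀ {A v} → Pruned A → Removable A v → Pruned (A ∖ v)
  remove {A} {v} P (dv , Av , cv , a , b , a≢b , va , vb , xs , w) = record
    { removed  = v ∷ removed P
    ; gone     = λ {u} act off → case u Fin.≟ v of λ
        { (yes refl) → here refl ; (no u≢v) → there (gone P act (trans (sym (∖-other A u≢v)) off)) }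
    ; cut      = λ {u} act off → case u Fin.≟ v of λ
        { (yes refl) → cv ; (no u≢v) → cut P act (trans (sym (∖-other A u≢v)) off) }
    ; live     = λ {u} Au → live P (∖⊆ {S = A} u Au)
    ; reps     = map replace (reps P)
    ; reps-len = trans (length-map replace (reps P)) (reps-len P)
    ; reach    = λ u Au → let r , r∈ , ys , w = reach P u (∖⊆ {S = A} u Au) in
        replace r , ∈-map⁺ replace r∈ , reroute w λ { refl → true≢false Au (∖-self A u) }
    ; size≡    = trans (+-suc (card (A ∖ v)) _) (trans (cong (_+ length (removed P)) (sym (card-∖ Av))) (size≡ P))
    ; volume≤  = ≤-trans (≤-reflexive (arith (vol (A ∖ v)) (length (removed P))))
        (≤-trans (+-monoˡ-≤ (4 * length (removed P)) (≤-trans (+-monoʳ-≤ (vol (A ∖ v)) (*-monoʳ-≤ 2 2≤deg)) (≤-reflexive (sym (vol-∖ {A} Av))))) (volume≤ P))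
    }
    where
    open import Data.List.Properties using (length-map)
    open import Data.List.Membership.Propositional.Properties using (∈-map⁺)
    arith : ∀ x m → x + 4 * suc m ≡ x + 2 * 2 + 4 * m
    arith = solve-∀
    ends∈ : ∀ {a b xs} → a ≢ b → Walk (Within (A ∖ v)) a xs b → (A ∖ v) a ≡ true × (A ∖ v) b ≡ true
    ends∈ a≢b ε = contradiction refl a≢b
    ends∈ a≢b w@((_ , p , _) ◅ _) = p , All.lookup (Within-all p w) (last∈ w)
    a∈ = proj₁ (ends∈ a≢b w)
    b∈ = proj₂ (ends∈ a≢b w)
    2≤deg : 2 ≤ deg A v
    2≤deg = ≤-trans (s≤s (s≤s z≤n)) (≤-reflexive (sym (trans (deg-adj {A} (∖⊆ {S = A} a a∈) va)
      (cong suc (deg-adj {A ∖ a} (trans (∖-other A (a≢b ∘ sym)) (∖⊆ {S = A} b b∈)) vb)))))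
    Reach : Fin n → Fin n → Set
    Reach x y = ∃ λ xs → Walk (Within (A ∖ v)) x xs y
    _⟫_ : ∀ {x y z} → Reach x y → Reach y z → Reach x z
    (_ , p) ⟫ (_ , q) = _ , p ◅◅ q
    back : ∀ {x y} → Reach x y → Reach y x
    back (_ , p) = let ys , q , _ = reverseʷ Within-sym p in ys , q
    to-a : ∀ {z} → Adj H v z → Reach z a
    to-a vz with two-neighbours dv va vb a≢b vz
    ... | inj₁ refl = [] , ε
    ... | inj₂ refl = back (xs , w)
    replace : Fin n → Fin n
    replace r = if does (r Fin.≟ v) then a else r
    replace-other : ∀ {r} → r ≢ v → replace r ≡ r
    replace-other {r} r≢v with r Fin.≟ v
    ... | yes p = contradiction p r≢v
    ... | no _  = refl
    replace-self : replace v ≡ a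
    replace-self with v Fin.≟ v
    ... | yes _ = refl
    ... | no p  = contradiction refl p
    reroute : ∀ {u ys r} → Walk (Within A) u ys r → u ≢ v → Reach u (replace r)
    reroute ε u≢v = subst (Reach _) (sym (replace-other u≢v)) ([] , ε)
    reroute {u} (_◅_ {z = z} (uz , Au , Az) w) u≢v with z Fin.≟ v
    ... | no z≢v = (_ , (uz , trans (∖-other A u≢v) Au , trans (∖-other A z≢v) Az) ◅ ε) ⟫ reroute w z≢v
    ... | yes refl with w
    ... | ε = subst (Reach u) (sym replace-self) (to-a (Graph.sym H uz))
    ... | _◅_ {z = z′} (vz′ , _ , _) w′ =
      to-a (Graph.sym H uz) ⟫ (back (to-a vz′) ⟫ reroute w′ λ { refl → irrefl H refl vz′ })

  prune : ∀ m A → card A ≤ m → Pruned A → ∃ λ A → Pruned A × ∀ v → ¬ Removable A v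
  prune m A c P with Fin.any? (removable? A)
  ... | no none = A , P , λ v r → none (v , r)
  prune zero A c P | yes (v , _ , Av , _) = contradiction (trans (sym (card-∖ Av)) (n≤0⇒n≡0 c)) λ ()
  prune (suc m) A c P | yes (v , r@(_ , Av , _)) =
    prune m (A ∖ v) (≤-pred (≤-trans (≤-reflexive (sym (card-∖ Av))) c)) (remove P r)

  -- With m removals, `spanning` gives |E(A)| ≥ |A| - |roots|, while H has |A| + m vertices and at
  -- least |E(A)| + 2m edges. So m is at most |E(H)| - |V(H)| + |roots|, and `volume` expresses this
  -- by `branches`.
  removed-bound : ∀ {A} (P : Pruned A) → 2 * length (removed P) ≤ branches + 2 * length roots
  removed-bound {A} P = +-cancelˡ-≤ (2 * card A + (vol A + 2 * m)) _ _ (begin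
    2 * card A + (vol A + 2 * m) + 2 * m           ≡⟨ arith₁ (card A) (vol A) m ⟩
    2 * card A + (vol A + 4 * m)                   ≤⟨ +-mono-≤ (≤-trans (spanning A (reps P) (reach P)) (≤-reflexive (cong (λ r → vol A + 2 * r) (reps-len P)))) (volume≤ P) ⟩
    vol A + 2 * ρ + vol ⟦ active? ⟧                ≡⟨ cong (vol A + 2 * ρ +_) (trans (volume S) (cong (λ c → 2 * c + branches) (sym (size≡ P)))) ⟩
    vol A + 2 * ρ + (2 * (card A + m) + branches)  ≡⟨ arith₂ (card A) (vol A) m ρ branches ⟩
    2 * card A + (vol A + 2 * m) + (branches + 2 * ρ) ∎)
    where
    open ≤-Reasoning
    m = length (removed P)
    ρ = length roots
    arith₁ : ∀ c v m → 2 * c + (v + 2 * m) + 2 * m ≡ 2 * c + (v + 4 * m)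
    arith₁ = solve-∀
    arith₂ : ∀ c v m ρ b → v + 2 * ρ + (2 * (c + m) + b) ≡ 2 * c + (v + 2 * m) + (b + 2 * ρ)
    arith₂ = solve-∀

  module _ (stuck : Stuck) where

    -- Cycles meeting H in a single vertex

    Satellite : List (Fin n) → Set
    Satellite []       = ⊥
    Satellite (x ∷ xs) = d x ≡ 2 × All (λ v → ¬ Active v) xs

    satellite? : ∀ xs → Dec (Satellite xs)
    satellite? []       = no id
    satellite? (x ∷ xs) = (d x ≟ 2) ×-dec All.all? (λ v → ¬? (active? v)) xs

    d2-active : ∀ {v} → d v ≡ 2 → Active v
    d2-active eq = subst (1 ≤_) (sym eq) (s≤s z≤n)

    -- The arc continued to z′ is an ear of H with at least l inner vertices, but `stuck` closes
    -- every ear to a cycle of length less than l.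
    arc-ear : ∀ {z as p ts z′} → d z ≡ 2 → d z′ ≡ 2 → Walk (Adj G) z as p → Unique (z ∷ as) → All (λ v → ¬ Active v) as →
              l ≤ length as → Walk (Adj G) p (ts ++ [ z′ ]) z′ → Unique ts → All (λ v → ¬ Active v) ts →
              Disjoint (z ∷ as) ts → z ≢ z′ → ⊥
    arc-ear {z} {as} {p} {ts} {z′} dz dz′ w₁ u₁ off₁ l≤ w₂ u₂ off₂ dj z≢z′
      with stuck {is = as ++ ts} dz dz′ (cast (sym (++-assoc as ts [ z′ ])) (w₁ ◅◅ w₂))
             (Unique.++⁺ (Unique.++⁺ u₁ u₂ dj) ([] ∷ []) λ { (i , here refl) → z′∉ i })
             (All.map inactive (++⁺ off₁ off₂))
      where
      open import Data.List.Relation.Unary.All.Properties using (++⁺)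
      z′∉ : z′ ∉ z ∷ as ++ ts
      z′∉ (here eq) = z≢z′ (sym eq)
      z′∉ (there i) = All.lookup (++⁺ off₁ off₂) i (d2-active dz′)
    ... | qs , _ , _ , short = <⇒≱ short (≤-trans (≤-trans l≤ (≤-trans (m≤m+n (length as) (length ts)) (≤-reflexive (sym (length-++ as)))))
      (≤-trans (n≤1+n _) (m≤n+m _ (length qs))))

    -- If they met, the second cycle would contain a path from a vertex p of the first to z′ that
    -- leaves the first at once. Together with the longer arc from z to p it is an ear of H that is
    -- too long.
    satellites-disjoint : (C D : Cyc (Adj G)) → l ≤ size C → Satellite (support C) → Satellite (support D) →
                          Cyc.start C ≢ Cyc.start D → Disjoint (support C) (support D)
    satellites-disjoint (cyc {z} {zs} {y} w c u 2≤) (cyc {z′} {zs′} w′ _ u′ _) l≤ (dz , off) (dz′ , off′) z≢z′ (i , j)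
      with splitʷ w′ j
    ... | as′ , cs′ , refl , w′₁ , _ with reverseʷ (Graph.sym G) w′₁
    ... | rs , r , perm with lastHit (_∈? (z ∷ zs)) r i
    ... | p , rs₁ , ts , refl , r₁ , tail , p∈ , offₜ = finish
      where
      sub : ∀ {v} → v ∈ rs₁ ++ ts → v ∈ _ ∷ as′
      sub k = ∈-resp-↭ perm (there k)
      p≢z : p ≢ z
      p≢z refl with ∈-resp-↭ perm (∈-++⁺ˡ {xs = _ ∷ rs₁} (last∈ r₁))
      ... | here refl = z≢z′ refl
      ... | there k   = All.lookup off′ (∈-++⁺ˡ k) (d2-active dz)
      p∈zs : p ∈ zs
      p∈zs = Any.tail p≢z p∈
      p≢z′ : p ≢ z′
      p≢z′ refl = All.lookup off p∈zs (d2-active dz′)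
      uniq-rs : Unique (_ ∷ rs₁ ++ ts)
      uniq-rs = Unique-resp-↭ (↭-sym perm) (proj₁ (Unique-++⁻ (z′ ∷ as′) u′))
      finish : ⊥
      finish with unsnocʷ tail p≢z′
      ... | ts′ , _ , refl , _ , _ with splitʷ w (there p∈zs)
      ... | as , bs , refl , w₁ , w₂ = choose (l ≤? length as)
        where
        uts : Unique (ts′ ++ [ z′ ])
        uts = proj₁ (proj₂ (Unique-++⁻ (_ ∷ rs₁) uniq-rs))
        z′∉ts : z′ ∉ ts′
        z′∉ts k = proj₂ (proj₂ (Unique-++⁻ ts′ uts)) (k , here refl)
        off-ts : All (λ v → ¬ Active v) ts′
        off-ts = All.tabulate λ {v} k → case sub {v} (∈-++⁺ʳ rs₁ (∈-++⁺ˡ k)) of λ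
          { (here refl) → contradiction k z′∉ts ; (there q) → All.lookup off′ (∈-++⁺ˡ q) }
        disj : Disjoint (z ∷ as ++ bs) ts′
        disj (k , q) = All.lookup offₜ (∈-++⁺ˡ q) k
        -- The first cycle is long, hence longer than 6l by the gap, so one of its two arcs between
        -- z and p has at least l edges.
        choose : Dec (l ≤ length as) → ⊥
        choose (yes l≤as) = arc-ear dz dz′ w₁ (proj₁ (Unique-++⁻ (z ∷ as) u))
          (All.tabulate λ k → All.lookup off (∈-++⁺ˡ k)) l≤as tail (proj₁ (Unique-++⁻ ts′ uts)) off-ts
          (λ (k , q) → disj (∈-++⁺ˡ k , q)) z≢z′
        choose (no ¬l≤as) with reverseʷ (Graph.sym G) (w₂ ◅◅ (c ◅ ε))
        ... | es , w₃ , perm₂ = arc-ear dz dz′ w₃ (Unique-resp-↭ (↭-sym permE) (proj₁ (Unique-++⁻ (z ∷ p ∷ bs) uE)))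
          (All.tabulate λ k → All.lookup offE (∈-resp-↭ es↭ k)) l≤es tail (proj₁ (Unique-++⁻ ts′ uts)) off-ts
          (λ (k , q) → disj (inE (∈-resp-↭ permE k) , q)) z≢z′
          where
          open import Data.List.Relation.Binary.Permutation.Propositional.Properties using (drop-∷)
          permE : z ∷ es ↭ z ∷ p ∷ bs
          permE = ↭-trans perm₂ (↭-Solver.solve 3 (λ p bs z → p ⊕ (bs ⊕ z) ⊜ z ⊕ (p ⊕ bs)) ↭-refl [ p ] bs [ z ])
            where open ↭-Solver
          es↭ : es ↭ p ∷ bs
          es↭ = drop-∷ permE
          p∈as : p ∈ as
          p∈as = Any.tail p≢z (last∈ w₁)
          inE : ∀ {v} → v ∈ z ∷ p ∷ bs → v ∈ z ∷ as ++ bs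
          inE (here eq)           = here eq
          inE (there (here refl)) = there (∈-++⁺ˡ p∈as)
          inE (there (there k))   = there (∈-++⁺ʳ as k)
          offE : All (λ v → ¬ Active v) (p ∷ bs)
          offE = All.tabulate λ { (here refl) → All.lookup off (∈-++⁺ˡ p∈as) ; (there k) → All.lookup off (∈-++⁺ʳ as k) }
          uE : Unique ((z ∷ p ∷ bs) ++ [])
          uE = subst Unique (sym (++-identityʳ (z ∷ p ∷ bs))) (Unique-resp-⊑ (refl ∷ skip⊑ w₁ (p≢z ∘ sym)) u)
          6l≤ : 6 * l ≤ length (as ++ bs)
          6l≤ = ≮⇒≥ λ s< → <⇒≱ (gap (cyc w c u 2≤) s<) l≤
          l≤es : l ≤ length es
          l≤es = ≤-trans (+-cancelˡ-≤ l _ _ (begin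
            l + l                  ≤⟨ ≤-trans (+-monoʳ-≤ l (m≤m+n l (4 * l))) ≤-refl ⟩
            6 * l                  ≤⟨ 6l≤ ⟩
            length (as ++ bs)      ≡⟨ length-++ as ⟩
            length as + length bs  ≤⟨ +-monoˡ-≤ (length bs) (<⇒≤ (≰⇒> ¬l≤as)) ⟩
            l + length bs          ∎)) (≤-trans (n≤1+n _) (≤-reflexive (sym (↭-length es↭))))
            where open ≤-Reasoning

    satellites : ∀ {k} m (Cs : List (Cyc (Adj G))) → m + length Cs ≡ k → AllPairs (Disjoint on support) Cs →
                 All (λ C → l ≤ size C) Cs → All (λ C → Satellite (support C)) Cs →
                 LongFamily k ⊎ ∃ λ (Z : List (Fin n)) → length Z < k ×
                   ((C : Cyc (Adj G)) → l ≤ size C → Satellite (support C) → Cyc.start C ∈ Z)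
    satellites zero Cs refl dj long∀ _ = inj₁ (Cs , refl , dj , long∀)
    satellites (suc m) Cs refl dj long∀ sat
      with cycle? (adj? G) {λ xs → l ≤ length xs × Satellite xs × Fresh xs}
             (λ xs → (l ≤? length xs) ×-dec satellite? xs ×-dec fresh? xs)
      where
      Fresh : List (Fin n) → Set
      Fresh []       = ⊥
      Fresh (x ∷ _) = x ∉ map Cyc.start Cs
      fresh? : ∀ xs → Dec (Fresh xs)
      fresh? []      = no id
      fresh? (x ∷ _) = ¬? (x ∈? map Cyc.start Cs)
    ... | yes (C , l≤ , satC , new) = satellites m (C ∷ Cs) (+-suc m (length Cs))
      (All.tabulate (λ {D} D∈ → satellites-disjoint C D l≤ satC (All.lookup sat D∈)
        λ eq → new (subst (_∈ map Cyc.start Cs) (sym eq) (∈-map⁺ Cyc.start D∈))) ∷ dj) (l≤ ∷ long∀) (satC ∷ sat)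
      where open import Data.List.Membership.Propositional.Properties using (∈-map⁺)
    ... | no none = inj₂ (map Cyc.start Cs , ≤-trans (≤-reflexive (cong suc (length-map Cyc.start Cs))) (s≤s (m≤n+m _ m)) ,
      λ C l≤ satC → case Cyc.start C ∈? map Cyc.start Cs of λ
        { (yes i) → i ; (no new) → contradiction (C , l≤ , satC , new) none })
      where open import Data.List.Properties using (length-map)

    -- Long cycles that avoid the deleted vertices

    H-active : ∀ {x xs y} → Active x → Walk (Adj H) x xs y → All Active (x ∷ xs)
    H-active act ε       = act ∷ []
    H-active act (r ◅ w) = act ∷ H-active (adj-active (Graph.sym H r)) w

    LinkedH : Fin n → Fin n → Fin n → Fin n → Set
    LinkedH α β u w = Adj H u w × LinkedTo α β u w

    -- An ear closes up with a path of H to a short cycle, all of whose edges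
    -- are in one class.
    ear-links : ∀ {a b is} → d a ≡ 2 → d b ≡ 2 → Walk (Adj G) a (is ++ [ b ]) b → Unique (a ∷ is ++ [ b ]) →
                All (λ v → ¬ Active v) is →
                ∃₂ λ α β → Walk (LinkedTo α β) a (is ++ [ b ]) b × ∃ λ qs → Walk (LinkedH α β) b qs a × Unique (b ∷ qs)
    ear-links {a} {b} {is} da db w u off with stuck da db w u (All.map inactive off)
    ... | qs , q , uq , short with reverseʷ (Graph.sym H) q | walk-++⁻ is w
    ... | qs′ , q′ , perm | m , p , (e ◅ ε) with walk-++⁻ qs′ (linkCycle e (mapʷ within q′ ◅◅ p) uniq bound)
      where
      uniq : Unique (b ∷ qs′ ++ is)
      uniq = Unique.++⁺ (Unique-resp-↭ (↭-sym perm) uq) (proj₁ (Unique-++⁻ is (AllPairs.tail u)))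
        λ (i , j) → All.lookup off j (All.lookup (H-active (d2-active db) q′) i)
      bound : suc (length (qs′ ++ is)) < l
      bound = subst (_< l) (trans (+-suc (length qs) (length is))
        (cong suc (trans (cong (_+ length is) (sym (tail-↭ perm))) (sym (length-++ qs′))))) short
    ... | _ , k₁ , k₂ with walk-end k₁ q′
    ... | refl = m , b , k₂ ◅◅ ((e , same e refl refl) ◅ ε) , qs′ , zipʷ q′ k₁ , Unique-resp-↭ (↭-sym perm) uq

    inner-uncut : ∀ {α β x xs y v} → Walk (LinkedH α β) x xs y → Unique (x ∷ xs) → v ∈ xs → v ≢ y → ¬ Cut v
    inner-uncut (r ◅ ε) u (here refl) v≢y cv = v≢y refl
    inner-uncut ((h , _ , k) ◅ ((h′ , _ , k′) ◅ w)) u (here refl) v≢y cv =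
      cv _ _ (Graph.sym H h) h′ (λ { refl → ∉-head u (there (here refl)) }) (Link-trans (Link-sym (Link-flipʳ k)) k′)
    inner-uncut (r ◅ w) (_ ∷ u) (there i) v≢y cv = inner-uncut w u i v≢y cv

    inside : ∀ {B : Fin n → Bool} {x xs y} → Walk (Adj H) x xs y → (∀ {v} → v ∈ x ∷ xs → B v ≡ true) → Walk (Within B) x xs y
    inside ε       all = ε
    inside (r ◅ w) all = (r , all (here refl) , all (there (here refl))) ◅ inside w (all ∘ there)

    record Turn (C : Cyc (Adj G)) : Set where
      field
        {v w u}  : Fin n
        {zs}     : List (Fin n)
        out      : Adj G v w
        path     : Walk (Adj G) w zs u
        back     : Adj G u v
        perm     : support C ↭ v ∷ w ∷ zs
        unlinked : ¬ Link u v v w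

      unique : Unique (v ∷ w ∷ zs)
      unique = Unique-resp-↭ perm (Cyc.simple C)

    -- Going round, every edge is linked to the closing edge until the first unlinked pair of
    -- consecutive edges. Without such a pair the cycle lies in one class, against
    -- `monochromatic-short`.
    turn : (C : Cyc (Adj G)) → l ≤ size C → Turn C
    turn C@(cyc {x} {zs} {y} w c uq 2≤) l≤ = [ id , (λ k → contradiction l≤ (<⇒≱ (monochromatic-short k (c , same c refl refl) uq 2≤))) ]′
        (go w ε c (same c refl refl) (↭-reflexive (cong (x ∷_) (sym (++-identityʳ zs)))))
      where
      go : ∀ {u bs ds p} → Walk (Adj G) u bs y → Walk (Adj G) y ds p → Adj G p u → Link y x p u →
           support C ↭ u ∷ bs ++ ds → Turn C ⊎ Walk (LinkedTo y x) u bs y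
      go ε arc pu k perm = inj₂ ε
      go {u} {z ∷ bs} {ds} {p} (r ◅ w) arc pu k perm with link? p u u z
      ... | no unl = inj₁ record { out = r ; path = w ◅◅ arc ; back = pu ; perm = perm ; unlinked = unl }
      ... | yes k′ = [ inj₁ , (λ ks → inj₂ ((r , Link-trans k k′) ◅ ks)) ]′
        (go w (arc ◅◅ (pu ◅ ε)) r (Link-trans k k′)
          (↭-trans perm (↭-Solver.solve 4 (λ u z bs ds → u ⊕ (z ⊕ (bs ⊕ ds)) ⊜ z ⊕ (bs ⊕ (ds ⊕ u))) ↭-refl [ u ] [ z ] bs ds)))
        where open ↭-Solver

    -- Following a path away from v to its last active vertex.
    record Exit (v h : Fin n) (cs : List (Fin n)) (e : Fin n) : Set where
      field
        {q}      : Fin n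
        {hs ts}  : List (Fin n)
        split    : cs ≡ hs ++ ts
        head     : Walk (Adj G) h hs q
        tail     : Walk (Adj G) q ts e
        off      : All (λ v → ¬ Active v) ts
        active   : Active q
        {es is}  : List (Fin n)
        leave    : Walk (Adj G) v (e ∷ es) q
        leave≡   : e ∷ es ≡ is ++ [ q ]
        perm     : e ∷ es ↭ q ∷ ts

      inner : is ↭ ts
      inner = drop-∷ (↭-trans (++-comm [ q ] is) (↭-trans (↭-reflexive (sym leave≡)) perm))
        where open import Data.List.Relation.Binary.Permutation.Propositional.Properties using (drop-∷; ++-comm)

      offᵢ : All (λ v → ¬ Active v) is
      offᵢ = anti-mono (∈-resp-↭ inner) off

      q∈ : q ∈ h ∷ cs
      q∈ = subst (λ cs → q ∈ h ∷ cs) (sym split) (∈-++⁺ˡ (last∈ head))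

      ts⊆ : ∀ {x} → x ∈ q ∷ ts → x ∈ h ∷ cs
      ts⊆ (here refl) = q∈
      ts⊆ (there i)   = subst (λ cs → _ ∈ h ∷ cs) (sym split) (∈-++⁺ʳ (h ∷ hs) i)

      unique-leave : Unique (h ∷ cs) → v ∉ h ∷ cs → Unique (v ∷ e ∷ es)
      unique-leave u v∉ = ∉⇒Unique (λ i → v∉ (ts⊆ (∈-resp-↭ perm i))) (Unique-resp-↭ (↭-sym perm)
        (Unique-resp-⊑ (suffix⊑ head) (subst (λ cs → Unique (h ∷ cs)) split u)))

    exit : ∀ {v h cs e} → Walk (Adj G) h cs e → Active h → Adj G v e → v ∉ h ∷ cs → Exit v h cs e
    exit {v} {h} w act ve v∉ with lastHit active? w act
    ... | q , hs , ts , refl , w₁ , w₂ , actq , off with reverseʷ (Graph.sym G) w₂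
    ... | es , w₃ , perm with unsnocʷ (ve ◅ w₃) (λ { refl → v∉ (∈-++⁺ˡ (last∈ w₁)) })
    ... | is , _ , eq , _ , _ = record { split = refl ; head = w₁ ; tail = w₂ ; off = off ; active = actq
                                       ; leave = ve ◅ w₃ ; leave≡ = eq ; perm = perm }

    module _ {A : Fin n → Bool} (P : Pruned A) (saturated : ∀ v → ¬ Removable A v) where

      Ok : Fin n → Set
      Ok v = d v ≢ 3 × (Active v → A v ≡ true)

      ok-2 : ∀ {v} → Ok v → Active v → d v ≡ 2
      ok-2 {v} (≢3 , _) act with degrees v
      ... | inj₁ eq        = contradiction act (<⇒≱ (s≤s (≤-reflexive eq)))
      ... | inj₂ (inj₁ eq) = eq
      ... | inj₂ (inj₂ eq) = contradiction eq ≢3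

      uncut-kept : ∀ {v} → Active v → ¬ Cut v → A v ≡ true
      uncut-kept {v} act ¬c with A v in eq
      ... | true  = refl
      ... | false = contradiction (cut P act eq) ¬c

      Reach : Fin n → Fin n → Fin n → Set
      Reach v x y = ∃ λ xs → Walk (Within (A ∖ v)) x xs y

      back-reach : ∀ {v x y} → Reach v x y → Reach v y x
      back-reach (_ , p) = let ys , q , _ = reverseʷ Within-sym p in ys , q

      -- The ear from v to q closes up with a path of H in the same class. It enters v through a
      -- neighbour a, whose edge is therefore linked to vw. The rest of it avoids v, and its inner
      -- vertices are not cut vertices, so none of them was removed.
      first-leg : ∀ {v q w ws is} → d v ≡ 2 → Ok q → Active q → v ≢ q → Walk (Adj G) v (w ∷ ws) q → Unique (v ∷ w ∷ ws) →
                  w ∷ ws ≡ is ++ [ q ] → All (λ v → ¬ Active v) is →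
                  ∃ λ a → Adj H v a × Link v a v w × Reach v a q
      first-leg {v} {q} {w} {ws} {is} dv okq actq v≢q walk uq eq off
        with ear-links dv (ok-2 okq actq) (cast eq walk) (subst (λ xs → Unique (v ∷ xs)) eq uq) off
      ... | α , β , ks , qs , hs , uqs with cast (sym eq) ks | unsnocʷ hs (v≢q ∘ sym)
      ... | (_ , k) ◅ _ | qs′ , a , refl , hs′ , (av , _ , k′) =
        a , Graph.sym H av , Link-trans (Link-sym (Link-flipʳ k′)) k , back-reach (qs′ , inside (mapʷ proj₁ hs′) kept)
        where
        kept : ∀ {x} → x ∈ q ∷ qs′ → (A ∖ v) x ≡ true
        kept (here refl) = trans (∖-other A (v≢q ∘ sym)) (proj₂ okq actq)
        kept {x} (there i) = trans (∖-other A x≢v) (uncut-kept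
          (All.lookup (H-active actq (mapʷ proj₁ hs)) (there (∈-++⁺ˡ i))) (inner-uncut hs uqs (∈-++⁺ˡ i) x≢v))
          where
          x≢v : x ≢ v
          x≢v refl = proj₂ (proj₂ (Unique-++⁻ (q ∷ qs′) uqs)) (there i , here refl)

      -- Between consecutive active vertices the cycle runs along an ear, collected in `ls`, which
      -- is replaced by a linked path of H. Inner vertices of that path are not cut vertices: none
      -- was removed, and none is v.
      traverse : ∀ {v} → Cut v → ∀ {e ls c ts p} → Active e → Walk (Adj G) e ls c → All (λ v → ¬ Active v) ls →
                 Walk (Adj G) c ts p → Unique (e ∷ ls ++ ts) → (∀ {x} → x ∈ e ∷ ls ++ ts → Ok x × x ≢ v) → Active p → Reach v e p
      traverse cv acte leg off ε u ok actp with last∈ leg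
      ... | here refl = [] , ε
      ... | there i   = contradiction actp (All.lookup off i)
      traverse {v} cv {e} {ls} {c} {c′ ∷ ts} acte leg off (r ◅ rest) u ok actp with active? c′
      ... | no off′ = traverse cv acte (leg ◅◅ (r ◅ ε)) (++⁺ off (off′ ∷ [])) rest
        (subst (λ xs → Unique (e ∷ xs)) (sym (++-assoc ls [ c′ ] ts)) u)
        (λ {x} i → ok (subst (λ xs → x ∈ e ∷ xs) (++-assoc ls [ c′ ] ts) i)) actp
        where open import Data.List.Relation.Unary.All.Properties using (++⁺)
      ... | yes act′ with ear-links (ok-2 (proj₁ (ok (here refl))) acte) (ok-2 (proj₁ (ok (there (∈-++⁺ʳ ls (here refl))))) act′)
                            (leg ◅◅ (r ◅ ε)) (proj₁ (Unique-++⁻ (e ∷ ls ++ [ c′ ]) (subst (λ xs → Unique (e ∷ xs)) (sym (++-assoc ls [ c′ ] ts)) u))) off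
      ... | α , β , _ , qs , hs , uqs = _ , proj₂ (back-reach (qs , inside (mapʷ proj₁ hs) kept)) ◅◅ proj₂ onward
        where
        onward = traverse cv act′ ε [] rest (proj₁ (proj₂ (Unique-++⁻ (e ∷ ls) u))) (λ i → ok (∈-++⁺ʳ (e ∷ ls) i)) actp
        end : ∀ {x} → x ∈ e ∷ ls ++ c′ ∷ ts → Active x → (A ∖ v) x ≡ true
        end i act = trans (∖-other A (proj₂ (ok i))) (proj₂ (proj₁ (ok i)) act)
        kept : ∀ {x} → x ∈ c′ ∷ qs → (A ∖ v) x ≡ true
        kept (here refl) = end (∈-++⁺ʳ (e ∷ ls) (here refl)) act′
        kept {x} (there i) with x Fin.≟ e
        ... | yes refl = end (here refl) acte
        ... | no x≢e = trans (∖-other A λ { refl → uncut cv }) (uncut-kept (All.lookup (H-active act′ (mapʷ proj₁ hs)) (there i)) uncut)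
          where
          uncut = inner-uncut hs uqs i x≢e

      turn-impossible : (C : Cyc (Adj G)) → Turn C → All Ok (support C) →
                        ∀ {h h′} → h ∈ support C → h′ ∈ support C → h ≢ h′ → Active h → Active h′ → ⊥
      turn-impossible C T ok {h} {h′} h∈ h′∈ h≢h′ acth acth′ = cases (active? v)
        where
        open Turn T
        okT : ∀ {x} → x ∈ v ∷ w ∷ zs → Ok x
        okT i = All.lookup ok (∈-resp-↭ (↭-sym perm) i)
        -- From an active vertex h other than v the cycle is followed in both directions towards v,
        -- by `rs` to w and by `bs` to u.
        module At {h as bs rs} (acth : Active h) (zs≡ : zs ≡ as ++ bs) (w⇝h : Walk (Adj G) w as h)
                  (h⇝u : Walk (Adj G) h bs u) (h⇝w : Walk (Adj G) h rs w) (rs↭ : h ∷ rs ↭ w ∷ as) where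
          u-all : Unique ((w ∷ as) ++ bs)
          u-all = subst (λ zs → Unique (w ∷ zs)) zs≡ (AllPairs.tail unique)
          u-rs : Unique (h ∷ rs)
          u-rs = Unique-resp-↭ (↭-sym rs↭) (proj₁ (Unique-++⁻ (w ∷ as) u-all))
          u-bs : Unique (h ∷ bs)
          u-bs = ∉⇒Unique (λ i → proj₂ (proj₂ (Unique-++⁻ (w ∷ as) u-all)) (last∈ w⇝h , i)) (proj₁ (proj₂ (Unique-++⁻ (w ∷ as) u-all)))
          in-rs : ∀ {x} → x ∈ h ∷ rs → x ∈ w ∷ zs
          in-rs i = subst (λ zs → _ ∈ w ∷ zs) (sym zs≡) (∈-++⁺ˡ (∈-resp-↭ rs↭ i))
          in-bs : ∀ {x} → x ∈ h ∷ bs → x ∈ w ∷ zs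
          in-bs (here refl) = subst (λ zs → h ∈ w ∷ zs) (sym zs≡) (∈-++⁺ˡ (last∈ w⇝h))
          in-bs (there i)   = subst (λ zs → _ ∈ w ∷ zs) (sym zs≡) (∈-++⁺ʳ (w ∷ as) i)
          v∉ : v ∉ w ∷ zs
          v∉ = ∉-head unique
          meet : ∀ {x} → x ∈ h ∷ rs → x ∈ h ∷ bs → x ≡ h
          meet i (here eq) = eq
          meet i (there j) = ⊥-elim (proj₂ (proj₂ (Unique-++⁻ (w ∷ as) u-all)) (∈-resp-↭ rs↭ i , j))
          open Exit

          module _ (E₁ : Exit v h rs w) (E₂ : Exit v h bs u) where

            -- v is passed by an ear, whose edges are linked.
            off-H : ∀ {h′} → Active h′ → ¬ Active v → h′ ∈ w ∷ zs → h ≢ h′ → ⊥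
            off-H {h′} acth′ offv h′∈ h≢h′ = unlinked linked
              where
              -- Both exits can coincide only at h; then no other vertex of the cycle is active,
              -- contrary to the choice of `h′`.
              q₁≢q₂ : q E₁ ≢ q E₂
              q₁≢q₂ eq = alone (meet (q∈ E₁) (subst (_∈ h ∷ bs) (sym eq) (q∈ E₂)))
                where
                alone-in : ∀ {cs e} (E : Exit v h cs e) → q E ≡ h → Unique (h ∷ cs) → h′ ∈ h ∷ cs → ⊥
                alone-in E q≡h u i with subst (λ cs → h′ ∈ h ∷ cs) (split E) i
                ... | here eq = h≢h′ (sym eq)
                ... | there j with ∈-++⁻ (hs E) j
                ... | inj₂ k = All.lookup (off E) k acth′
                ... | inj₁ k with subst (h′ ∈_) hs≡[] k
                  where
                  hs≡[] = closed-trivial (subst (λ q → Walk (Adj G) h (hs E) q) q≡h (head E))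
                    (proj₁ (Unique-++⁻ (h ∷ hs E) (subst (λ cs → Unique (h ∷ cs)) (split E) u)))
                ... | ()
                alone : q E₁ ≡ h → ⊥
                alone q≡h with ∈-++⁻ (w ∷ as) (subst (λ zs → h′ ∈ w ∷ zs) zs≡ h′∈)
                ... | inj₁ i = alone-in E₁ q≡h u-rs (∈-resp-↭ (↭-sym rs↭) i)
                ... | inj₂ i = alone-in E₂ (trans (sym eq) q≡h) u-bs (there i)
              ear : Walk (Adj G) (q E₂) ((ts E₂ ++ v ∷ is E₁) ++ [ q E₁ ]) (q E₁)
              ear = cast (trans (cong (λ xs → ts E₂ ++ v ∷ xs) (leave≡ E₁)) (sym (++-assoc (ts E₂) (v ∷ is E₁) [ q E₁ ])))
                      (tail E₂ ◅◅ (back ◅ leave E₁))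
              list≡ : (ts E₂ ++ v ∷ is E₁) ++ [ q E₁ ] ≡ ts E₂ ++ v ∷ w ∷ es E₁
              list≡ = trans (++-assoc (ts E₂) (v ∷ is E₁) [ q E₁ ]) (cong (λ xs → ts E₂ ++ v ∷ xs) (sym (leave≡ E₁)))
              ear-unique : Unique (q E₂ ∷ (ts E₂ ++ v ∷ is E₁) ++ [ q E₁ ])
              ear-unique = subst (λ xs → Unique (q E₂ ∷ xs)) (sym list≡)
                (Unique.++⁺ (Unique-resp-↭ (perm E₂) (AllPairs.tail (unique-leave E₂ u-bs (v∉ ∘ in-bs)))) (unique-leave E₁ u-rs (v∉ ∘ in-rs)) disj)
                where
                disj : Disjoint (q E₂ ∷ ts E₂) (v ∷ w ∷ es E₁)
                disj (i , here refl) = v∉ (in-bs (ts⊆ E₂ i))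
                disj (i , there j) = clash (meet (ts⊆ E₁ (∈-resp-↭ (perm E₁) j)) (ts⊆ E₂ i)) i (∈-resp-↭ (perm E₁) j)
                  where
                  clash : ∀ {x} → x ≡ h → x ∈ q E₂ ∷ ts E₂ → x ∈ q E₁ ∷ ts E₁ → ⊥
                  clash eq (there k) _         = All.lookup (off E₂) k (subst Active (sym eq) acth)
                  clash eq (here _)  (there k) = All.lookup (off E₁) k (subst Active (sym eq) acth)
                  clash eq (here p)  (here p′) = q₁≢q₂ (trans (sym p′) p)
              ear-off : All (λ v → ¬ Active v) (ts E₂ ++ v ∷ is E₁)
              ear-off = ++⁺ (off E₂) (offv ∷ offᵢ E₁)
                where open import Data.List.Relation.Unary.All.Properties using (++⁺)
              linked : Link u v v w
              linked with ear-links (ok-2 (okT (there (in-bs (q∈ E₂)))) (active E₂)) (ok-2 (okT (there (in-rs (q∈ E₁)))) (active E₁)) ear ear-unique ear-off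
              ... | α , β , ks , _ with walk-++⁻ (ts E₂) (cast list≡ ks)
              ... | m , k₁ , k₂ with walk-end k₁ (tail E₂) | k₂
              ... | refl | (_ , k) ◅ ((_ , k′) ◅ _) = Link-trans (Link-sym k) k′

            -- v is a cut vertex of H, but the rest of the cycle reconnects its neighbours.
            on-H : Active v → ⊥
            on-H actv with first-leg dv (okT (there (in-rs (q∈ E₁)))) (active E₁) (λ eq → v∉ (subst (_∈ w ∷ zs) (sym eq) (in-rs (q∈ E₁)))) (leave E₁)
                             (unique-leave E₁ u-rs (v∉ ∘ in-rs)) (leave≡ E₁) (offᵢ E₁)
                         | first-leg dv (okT (there (in-bs (q∈ E₂)))) (active E₂) (λ eq → v∉ (subst (_∈ w ∷ zs) (sym eq) (in-bs (q∈ E₂)))) (leave E₂)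
                             (unique-leave E₂ u-bs (v∉ ∘ in-bs)) (leave≡ E₂) (offᵢ E₂)
              where
              dv : d v ≡ 2
              dv = ok-2 (okT (here refl)) actv
            ... | a , va , ka , a⇝q | b , vb , kb , b⇝p =
              saturated v (ok-2 (okT (here refl)) actv , proj₂ (okT (here refl)) actv , cv , a , b , a≢b , va , vb ,
                _ , proj₂ a⇝q ◅◅ (proj₂ (back-reach (middle E₁ u-rs in-rs)) ◅◅ (proj₂ (middle E₂ u-bs in-bs) ◅◅ proj₂ (back-reach b⇝p))))
              where
              apart : ¬ Link v a v b
              apart k = unlinked (Link-trans (Link-sym (Link-flipʳ kb)) (Link-trans (Link-sym k) ka))
              a≢b : a ≢ b
              a≢b refl = apart (same (within va) refl refl)
              cv : Cut v
              cv c e vc ve c≢e k with two-neighbours (ok-2 (okT (here refl)) actv) va vb a≢b vc | two-neighbours (ok-2 (okT (here refl)) actv) va vb a≢b ve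
              ... | inj₁ refl | inj₁ refl = c≢e refl
              ... | inj₁ refl | inj₂ refl = apart k
              ... | inj₂ refl | inj₁ refl = apart (Link-sym k)
              ... | inj₂ refl | inj₂ refl = c≢e refl
              middle : ∀ {cs e} (E : Exit v h cs e) → Unique (h ∷ cs) → (∀ {x} → x ∈ h ∷ cs → x ∈ w ∷ zs) → Reach v h (q E)
              middle E u within-T = traverse cv acth ε [] (head E)
                (proj₁ (Unique-++⁻ (h ∷ hs E) (subst (λ cs → Unique (h ∷ cs)) (split E) u)))
                (λ i → let j = within-T (subst (λ cs → _ ∈ h ∷ cs) (sym (split E)) (∈-++⁺ˡ i))
                       in okT (there j) , λ { refl → v∉ j })
                (active E)

          exit₁ : Exit v h rs w
          exit₁ = exit h⇝w acth out (v∉ ∘ in-rs)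
          exit₂ : Exit v h bs u
          exit₂ = exit h⇝u acth (Graph.sym G back) (v∉ ∘ in-bs)

        passing : ∀ {h h′} → Active h → h ∈ w ∷ zs → Active h′ → ¬ Active v → h′ ∈ w ∷ zs → h ≢ h′ → ⊥
        passing acth h∈ acth′ with splitʷ path h∈
        ... | _ , _ , zs≡ , w⇝h , h⇝u with reverseʷ (Graph.sym G) w⇝h
        ... | _ , h⇝w , rs↭ = let open At acth zs≡ w⇝h h⇝u h⇝w rs↭ in off-H exit₁ exit₂ acth′

        touching : ∀ {h} → Active h → h ∈ w ∷ zs → Active v → ⊥
        touching acth h∈ with splitʷ path h∈
        ... | _ , _ , zs≡ , w⇝h , h⇝u with reverseʷ (Graph.sym G) w⇝h
        ... | _ , h⇝w , rs↭ = let open At acth zs≡ w⇝h h⇝u h⇝w rs↭ in on-H exit₁ exit₂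

        cases : Dec (Active v) → ⊥
        cases (no offv) with ∈-resp-↭ perm h∈ | ∈-resp-↭ perm h′∈
        ... | here refl | _         = offv acth
        ... | there i   | here refl = offv acth′
        ... | there i   | there j   = passing acth i acth′ offv j h≢h′
        cases (yes actv) with ∈-resp-↭ perm h∈ | ∈-resp-↭ perm h′∈
        ... | there i   | _         = touching acth i actv
        ... | here refl | there j   = touching acth′ j actv
        ... | here refl | here eq   = h≢h′ (sym eq)

      rotate : (C : Cyc (Adj G)) → ∀ {v} → v ∈ support C → Σ[ C′ ∈ Cyc (Adj G) ] Cyc.start C′ ≡ v × support C ↭ support C′
      rotate C@(cyc {x} w c u 2≤) {v} i with x Fin.≟ v
      ... | yes refl = C , refl , ↭-refl
      ... | no x≢v with splitʷ w i
      ... | as , bs , refl , w₁ , w₂ with unsnocʷ w₁ x≢v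
      ... | as′ , m , refl , w₃ , e = cyc (w₂ ◅◅ (c ◅ w₃)) e (Unique-resp-↭ perm u)
              (subst (2 ≤_) (suc-injective (↭-length perm)) 2≤) , refl , perm
        where
        open ↭-Solver
        perm : x ∷ (as′ ++ [ v ]) ++ bs ↭ v ∷ bs ++ x ∷ as′
        perm = solve 4 (λ x as v bs → x ⊕ ((as ⊕ v) ⊕ bs) ⊜ v ⊕ (bs ⊕ (x ⊕ as))) ↭-refl [ x ] as′ [ v ] bs

      -- The cycle meets H. If it does so only once, it is a satellite and starts, after rotation,
      -- in `Z`. Otherwise it has two active vertices, as `turn-impossible` requires.
      no-long-cycle : Hitting → (Z : List (Fin n)) → ((C : Cyc (Adj G)) → l ≤ size C → Satellite (support C) → Cyc.start C ∈ Z) →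
                      (C : Cyc (Adj G)) → l ≤ size C → All (λ v → Ok v × v ∉ Z) (support C) → ⊥
      no-long-cycle hit Z Z-spec C l≤ ok with find (hit C l≤)
        where open import Data.List.Membership.Propositional using (find)
      ... | h , h∈ , acth with rotate C h∈
      ... | C′ , refl , perm with Any.any? active? (Cyc.rest C′)
      ... | no none = proj₂ (All.lookup ok h∈) (Z-spec C′ (subst (l ≤_) (↭-length perm) l≤)
              (ok-2 (proj₁ (All.lookup ok h∈)) acth , ¬Any⇒All¬ _ none))
        where open import Data.List.Relation.Unary.All.Properties using (¬Any⇒All¬)
      ... | yes some with find some
        where open import Data.List.Membership.Propositional using (find)
      ... | h′ , h′∈ , acth′ = turn-impossible C (turn C l≤) (All.map proj₁ ok) h∈ (∈-resp-↭ (↭-sym perm) (there h′∈))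
              (λ { refl → ∉-head (Cyc.simple C′) h′∈ }) acth acth′

-- Assembling the transversal

module _ {n : ℕ} (G : Graph (Fin n)) (l : ℕ) (3≤l : 3 ≤ l) where

  open Graph hiding (sym)
  open Construction G l 3≤l
  open State
  open import Data.List.Membership.DecPropositional (Fin._≟_ {n}) using (_∈?_)

  Transversal : ℕ → Set
  Transversal m = ∃ λ (X : List (Fin n)) → length X ≤ m × ((C : Cyc (Adj G)) → l ≤ size C → Any (_∈ X) (support C))

  -- There are fewer than 2t vertices in `U`, at most t + k in `removed` and fewer than k in `Z`.
  -- The count is carried out doubled because `removed-bound` is.
  transversal : ∀ {k t} → 1 ≤ t → (gap : (C : Cyc (Adj G)) → size C ≤ 6 * l → size C < l) →
                (S : State) → length (roots S) < k → Hitting S → Stuck S → branches S < 2 * t →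
                LongFamily k ⊎ Transversal (3 * t + 2 * k)
  transversal {k} {t} 1≤t gap S ρ< hit stuck few
    with prune (card ⟦ active? S ⟧) ⟦ active? S ⟧ ≤-refl initial | satellites stuck k [] (+-identityʳ k) [] [] []
       | elements (branches S) ⟦ branch? S ⟧ refl
    where open Final G l 3≤l gap S
  ... | _ | inj₁ family | _ = inj₁ family
  ... | A , P , saturated | inj₂ (Z , Z< , Z-spec) | U , U-len , U-spec = inj₂ (X , bound , meets)
    where
    open Final G l 3≤l gap S
    open Pruned P using (removed; gone)
    X : List (Fin n)
    X = U ++ removed ++ Z
    bound : length X ≤ 3 * t + 2 * k
    bound = *-cancelˡ-≤ 2 (begin
      2 * length X  ≡⟨ cong (2 *_) (trans (length-++ U) (cong₂ _+_ U-len (length-++ removed))) ⟩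
      2 * (branches S + (length removed + length Z))  ≡⟨ arith₁ (branches S) (length removed) (length Z) ⟩
      2 * branches S + 2 * length removed + 2 * length Z  ≤⟨ +-monoˡ-≤ (2 * length Z) (+-monoʳ-≤ (2 * branches S) (removed-bound P)) ⟩
      2 * branches S + (branches S + 2 * length (roots S)) + 2 * length Z  ≤⟨ +-mono-≤ (+-mono-≤ (*-monoʳ-≤ 2 (<⇒≤ few)) (+-mono-≤ (<⇒≤ few) (*-monoʳ-≤ 2 (<⇒≤ ρ<)))) (*-monoʳ-≤ 2 (<⇒≤ Z<)) ⟩
      2 * (2 * t) + (2 * t + 2 * k) + 2 * k  ≡⟨ arith₂ t k ⟩
      2 * (3 * t + 2 * k)  ∎)
      where
      open ≤-Reasoning
      arith₁ : ∀ b m z → 2 * (b + (m + z)) ≡ 2 * b + 2 * m + 2 * z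
      arith₁ = solve-∀
      arith₂ : ∀ t k → 2 * (2 * t) + (2 * t + 2 * k) + 2 * k ≡ 2 * (3 * t + 2 * k)
      arith₂ = solve-∀
    meets : (C : Cyc (Adj G)) → l ≤ size C → Any (_∈ X) (support C)
    meets C l≤ with Any.any? (_∈? X) (support C)
    ... | yes i = i
    ... | no none = ⊥-elim (no-long-cycle stuck P saturated hit Z Z-spec C l≤ (All.tabulate avoid))
      where
      avoid : ∀ {v} → v ∈ support C → (d S v ≢ 3 × (Active S v → A v ≡ true)) × v ∉ Z
      avoid {v} v∈ = ((λ d3 → miss (∈-++⁺ˡ (U-spec (⟦⟧-true (branch? S) d3)))) , kept) ,
                     λ z → miss (∈-++⁺ʳ U (∈-++⁺ʳ removed z))
        where
        miss : v ∉ X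
        miss i = none (lose v∈ i)
          where open import Data.List.Membership.Propositional using (lose)
        kept : Active S v → A v ≡ true
        kept act with A v in eq
        ... | true  = refl
        ... | false = contradiction (∈-++⁺ʳ U (∈-++⁺ˡ (gone act eq))) miss

  module _ (t ρ : ℕ → ℕ) (t-step : ∀ k → t k + (2 * ρ k + 3) ≤ t (suc k)) (ρ-large : ∀ k → 2 * t (suc k) + 5 < 3 * 2 ^ ρ k) where

    gapped : ∀ k → 1 ≤ t k → (gap : (C : Cyc (Adj G)) → size C ≤ 6 * l → size C < l) →
             LongFamily k ⊎ Transversal (3 * t k + 2 * k)
    gapped k 1≤t gap with rootPhase k emptyState [] (+-identityʳ k) refl [] [] []
    ... | inj₁ family = inj₁ family
    ... | inj₂ (S , ρ< , hit) with earPhase {2 * t k} (2 * t k) S (m≤n+m (2 * t k) (branches S)) hit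
    ... | S′ , eq , hit′ , end with 2 * t k ≤? branches S′
    ... | yes enough = inj₁ (manyBranches S′ t ρ t-step ρ-large k enough)
    ... | no ¬enough with end
    ... | inj₁ enough = contradiction enough ¬enough
    ... | inj₂ stuck = transversal 1≤t gap S′ (subst (λ rs → length rs < k) (sym eq) ρ<) hit′ stuck (≰⇒> ¬enough)

module _ {n : ℕ} (G : Graph (Fin n)) (xs : List (Fin n)) where
  open import Data.List.Membership.DecPropositional (Fin._≟_ {n}) using (_∈?_)
  open Graph G

  -- The vertex set stays `Fin n`, which suits the induction; the vertices in `xs` become isolated
  -- and lie on no cycle.
  delete : Graph (Fin n)
  delete = record
    { Adj    = λ u v → Adj u v × u ∉ xs × v ∉ xs
    ; adj?   = λ u v → adj? u v ×-dec ¬? (u ∈? xs) ×-dec ¬? (v ∈? xs)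
    ; sym    = λ (a , p , q) → Graph.sym G a , q , p
    ; irrefl = λ eq (a , _) → irrefl eq a
    }

  delete-misses : (C : Cyc (Graph.Adj delete)) → Disjoint (support C) xs
  delete-misses (cyc w (_ , _ , x∉) _ _) (i , j) = go x∉ w i j
    where
    go : ∀ {x ys y v} → x ∉ xs → Walk (Graph.Adj delete) x ys y → v ∈ x ∷ ys → v ∉ xs
    go x∉ w                  (here refl) = x∉
    go x∉ ((_ , _ , z∉) ◅ w) (there i)   = go z∉ w i

  undelete : Cyc (Graph.Adj delete) → Cyc Adj
  undelete = mapCyc proj₁

  survive : (C : Cyc Adj) → ¬ Any (_∈ xs) (support C) →
            Σ[ C′ ∈ Cyc (Graph.Adj delete) ] support C′ ≡ support C
  survive C@(cyc w c u 2≤) none = cyc (go w out) (c , out (last∈ w) , out (here refl)) u 2≤ , refl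
    where
    open import Data.List.Membership.Propositional using (lose)
    out : ∀ {v} → v ∈ support C → v ∉ xs
    out i j = none (lose i j)
    go : ∀ {x ys y} → Walk Adj x ys y → (∀ {v} → v ∈ x ∷ ys → v ∉ xs) → Walk (Graph.Adj delete) x ys y
    go ε       out = ε
    go (r ◅ w) out = (r , out (here refl) , out (there (here refl))) ◅ go w (out ∘ there)

-- Bounds

<2^suc⌊log₂⌋ : ∀ k → k < 2 ^ suc ⌊log₂ k ⌋
<2^suc⌊log₂⌋ k = ≰⇒> λ p → <⇒≱ (n<1+n ⌊log₂ k ⌋)
  (≤-trans (≤-reflexive (sym (⌊log₂[2^n]⌋≡n (suc ⌊log₂ k ⌋)))) (⌊log₂⌋-mono-≤ p))

2^⌊log₂⌋≤ : ∀ k → 1 ≤ k → 2 ^ ⌊log₂ k ⌋ ≤ k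
2^⌊log₂⌋≤ = <-rec _ step
  where
  open import Data.Nat.Induction using (<-rec)
  step : ∀ k → (∀ {m} → m < k → 1 ≤ m → 2 ^ ⌊log₂ m ⌋ ≤ m) → 1 ≤ k → 2 ^ ⌊log₂ k ⌋ ≤ k
  step 1 rec 1≤ = ≤-refl
  step k@(suc (suc j)) rec 1≤ = begin
    2 ^ ⌊log₂ k ⌋            ≡⟨ cong (2 ^_) (sym (trans (+-comm 1 _) (trans (cong (_+ 1) (⌊log₂⌊n/2⌋⌋≡⌊log₂n⌋∸1 k)) (m∸n+n≡m 1≤log)))) ⟩
    2 * 2 ^ ⌊log₂ ⌊ k /2⌋ ⌋  ≤⟨ *-monoʳ-≤ 2 (rec (⌊n/2⌋<n (suc j)) (s≤s z≤n)) ⟩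
    2 * ⌊ k /2⌋              ≡⟨ cong (⌊ k /2⌋ +_) (+-identityʳ _) ⟩
    ⌊ k /2⌋ + ⌊ k /2⌋        ≤⟨ +-monoʳ-≤ ⌊ k /2⌋ (⌊n/2⌋≤⌈n/2⌉ k) ⟩
    ⌊ k /2⌋ + ⌈ k /2⌉        ≡⟨ ⌊n/2⌋+⌈n/2⌉≡n k ⟩
    k                        ∎
    where
    open ≤-Reasoning
    1≤log : 1 ≤ ⌊log₂ k ⌋
    1≤log = ⌊log₂⌋-mono-≤ {2} {k} (s≤s (s≤s z≤n))

lg lglg : ℕ → ℕ
lg k   = ⌊log₂ k ⌋
lglg k = ⌊log₂ ⌊log₂ k ⌋ ⌋

-- By `threshold-step` one round raises the threshold by 2 * level + 3, so it is of order k times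
-- the level. The level must be about the logarithm of the threshold, that is, log k + log log k.
-- With s the sum of both logarithms, 2(s + 5) + 3 = 2s + 13 fits into 2(s + 7), which relates the
-- constants 5 and 7.
threshold level : ℕ → ℕ
threshold k = 2 * k * (lg k + lglg k + 7)
level k     = lg (suc k) + lglg (suc k) + 5

logs-mono : ∀ {j k} → j ≤ k → lg j + lglg j ≤ lg k + lglg k
logs-mono j≤k = +-mono-≤ (⌊log₂⌋-mono-≤ j≤k) (⌊log₂⌋-mono-≤ (⌊log₂⌋-mono-≤ j≤k))

threshold-step : ∀ k → threshold k + (2 * level k + 3) ≤ threshold (suc k)
threshold-step k = begin
  2 * k * (lg k + lglg k + 7) + (2 * (s + 5) + 3)  ≤⟨ +-monoˡ-≤ (2 * (s + 5) + 3) (*-monoʳ-≤ (2 * k) (+-monoˡ-≤ 7 (logs-mono (n≤1+n k)))) ⟩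
  2 * k * (s + 7) + (2 * (s + 5) + 3)  ≤⟨ n≤1+n _ ⟩
  suc (2 * k * (s + 7) + (2 * (s + 5) + 3))  ≡⟨ arith k s ⟩
  2 * suc k * (s + 7)  ∎
  where
  open ≤-Reasoning
  s = lg (suc k) + lglg (suc k)
  arith : ∀ k s → suc (2 * k * (s + 7) + (2 * (s + 5) + 3)) ≡ 2 * suc k * (s + 7)
  arith = solve-∀

-- With a = ⌊log₂ k⌋ and b = ⌊log₂ a⌋ we have k < 2ᵃ⁺¹ and a < 2ᵇ⁺¹.
level-large : ∀ k → 2 * threshold (suc k) + 5 < 3 * 2 ^ level k
level-large k′ = begin-strict
  2 * (2 * k * R) + 5           <⟨ +-monoʳ-< (2 * (2 * k * R)) (≤-trans (s≤s (s≤s (s≤s (s≤s (s≤s (s≤s z≤n)))))) (*-monoʳ-≤ 4 {7} {R} (m≤n+m 7 (a + b)))) ⟩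
  2 * (2 * k * R) + 4 * R       ≡⟨ arith₁ k R ⟩
  4 * suc k * R                 ≤⟨ *-mono-≤ (*-monoʳ-≤ 4 (<2^suc⌊log₂⌋ k)) R≤ ⟩
  4 * 2 ^ suc a * (12 * 2 ^ b)  ≡⟨ arith₂ (2 ^ a) (2 ^ b) ⟩
  3 * (2 ^ a * 2 ^ b * 2 ^ 5)   ≡⟨ cong (3 *_) (trans (cong (_* 2 ^ 5) (sym (^-distribˡ-+-* 2 a b))) (sym (^-distribˡ-+-* 2 (a + b) 5))) ⟩
  3 * 2 ^ (a + b + 5)           ∎
  where
  open ≤-Reasoning
  k = suc k′
  a = lg k
  b = lglg k
  R = a + b + 7
  arith₁ : ∀ k r → 2 * (2 * k * r) + 4 * r ≡ 4 * suc k * r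
  arith₁ = solve-∀
  arith₂ : ∀ x y → 4 * (2 * x) * (12 * y) ≡ 3 * (x * y * 32)
  arith₂ = solve-∀
  n<2^n : ∀ n → n < 2 ^ n
  n<2^n zero    = s≤s z≤n
  n<2^n (suc n) = ≤-trans (+-mono-≤ (≤-trans (s≤s z≤n) (n<2^n n)) (n<2^n n)) (≤-reflexive (cong (2 ^ n +_) (sym (+-identityʳ _))))
  -- The estimates add up to 10 * 2 ^ b. Rounding up to 12 turns 4 * 2 * 12 into 3 * 2 ^ 5, whence
  -- the 5 in `level`.
  R≤ : R ≤ 12 * 2 ^ b
  R≤ = begin
    a + b + 7                      ≤⟨ +-mono-≤ (+-mono-≤ (<⇒≤ (<2^suc⌊log₂⌋ a)) (<⇒≤ (n<2^n b))) (*-monoʳ-≤ 7 {1} (m^n>0 2 b)) ⟩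
    2 * 2 ^ b + 2 ^ b + 7 * 2 ^ b  ≤⟨ m≤m+n _ (2 * 2 ^ b) ⟩
    2 * 2 ^ b + 2 ^ b + 7 * 2 ^ b + 2 * 2 ^ b ≡⟨ arith₃ (2 ^ b) ⟩
    12 * 2 ^ b  ∎
    where
    arith₃ : ∀ x → 2 * x + x + 7 * x + 2 * x ≡ 12 * x
    arith₃ = solve-∀

-- This is `f` with both logarithms rounded down, hence at most `f`, so that all counting takes
-- place in ℕ.
bound : ℕ → ℕ → ℕ
bound l 0 = 0
bound l 1 = 0
bound l k@(suc (suc _)) = 6 * k * l + 10 * k * lg k + 40 * k + 10 * k * lglg k

-- The summand 6kl pays for a deleted cycle with at most 6l vertices, and the other summands are
-- monotone. From 1 to 2 the left side is just 6l, since the bound is 0 there.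
bound-step : ∀ l k → bound l (suc k) + 6 * l ≤ bound l (suc (suc k))
bound-step l zero = ≤-trans (*-monoˡ-≤ l {6} {12} (m≤m+n 6 6)) (≤-trans (m≤m+n _ _) (≤-trans (m≤m+n _ _) (m≤m+n _ _)))
bound-step l (suc k′) = begin
  6 * k * l + 10 * k * lg k + 40 * k + 10 * k * lglg k + 6 * l  ≡⟨ arith (6 * k * l) (10 * k * lg k) (40 * k) (10 * k * lglg k) (6 * l) ⟩
  6 * k * l + 6 * l + 10 * k * lg k + 40 * k + 10 * k * lglg k  ≤⟨ +-mono-≤ (+-mono-≤ (+-mono-≤ (≤-reflexive (step k l))
    (*-mono-≤ (*-monoʳ-≤ 10 (n≤1+n k)) (⌊log₂⌋-mono-≤ (n≤1+n k)))) (*-monoʳ-≤ 40 (n≤1+n k)))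
    (*-mono-≤ (*-monoʳ-≤ 10 (n≤1+n k)) (⌊log₂⌋-mono-≤ (⌊log₂⌋-mono-≤ (n≤1+n k)))) ⟩
  6 * suc k * l + 10 * suc k * lg (suc k) + 40 * suc k + 10 * suc k * lglg (suc k)  ∎
  where
  open ≤-Reasoning
  k = suc (suc k′)
  arith : ∀ a b c d e → a + b + c + d + e ≡ a + e + b + c + d
  arith = solve-∀
  step : ∀ k l → 6 * k * l + 6 * l ≡ 6 * suc k * l
  step = solve-∀

-- The left side is 6ka + 6kb + 44k with a and b the rounded logarithms. As k ≥ 2 gives a ≥ 1, the
-- surplus 4k is absorbed into 4ka, and 6kb is raised to 10kb; this produces the coefficients 10, 40
-- and 10.
threshold-fits : ∀ l k → 2 ≤ k → 3 * threshold k + 2 * k ≤ bound l k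
threshold-fits l 1 (s≤s ())
threshold-fits l k@(suc (suc _)) 2≤ = begin
  3 * (2 * k * (a + b + 7)) + 2 * k  ≡⟨ arith₁ k a b ⟩
  6 * k * a + 40 * k + 6 * k * b + 4 * k * 1  ≤⟨ +-mono-≤ (+-monoʳ-≤ (6 * k * a + 40 * k) (*-monoˡ-≤ b (*-monoˡ-≤ k {6} {10} (m≤m+n 6 4)))) (*-monoʳ-≤ (4 * k) (⌊log₂⌋-mono-≤ {2} {k} 2≤)) ⟩
  6 * k * a + 40 * k + 10 * k * b + 4 * k * a  ≡⟨ arith₂ k a b ⟩
  10 * k * a + 40 * k + 10 * k * b  ≤⟨ m≤n+m _ (6 * k * l) ⟩
  6 * k * l + (10 * k * a + 40 * k + 10 * k * b)  ≡⟨ arith₃ (6 * k * l) (10 * k * a) (40 * k) (10 * k * b) ⟩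
  6 * k * l + 10 * k * a + 40 * k + 10 * k * b  ∎
  where
  open ≤-Reasoning
  a = lg k
  b = lglg k
  arith₁ : ∀ k a b → 3 * (2 * k * (a + b + 7)) + 2 * k ≡ 6 * k * a + 40 * k + 6 * k * b + 4 * k * 1
  arith₁ = solve-∀
  arith₂ : ∀ k a b → 6 * k * a + 40 * k + 10 * k * b + 4 * k * a ≡ 10 * k * a + 40 * k + 10 * k * b
  arith₂ = solve-∀
  arith₃ : ∀ a b c d → a + (b + c + d) ≡ a + b + c + d
  arith₃ = solve-∀

module _ (l : ℕ) (3≤l : 3 ≤ l) where
  open Construction using (LongFamily)

  erdősPósa : ∀ k {n} (G : Graph (Fin n)) → LongFamily G l 3≤l (suc k) ⊎ Transversal G l 3≤l (bound l (suc k))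
  erdősPósa zero G with cycle? (Graph.adj? G) {λ xs → l ≤ length xs} (λ xs → l ≤? length xs)
  ... | yes (C , l≤) = inj₁ (C ∷ [] , refl , [] ∷ [] , l≤ ∷ [])
  ... | no none      = inj₂ ([] , z≤n , λ C l≤ → contradiction (C , l≤) none)
  erdősPósa (suc k) G with cycle? (Graph.adj? G) {λ xs → l ≤ length xs × length xs ≤ 6 * l} (λ xs → (l ≤? length xs) ×-dec (length xs ≤? 6 * l))
  ... | no none = [ inj₁ , (λ (X , len , meets) → inj₂ (X , ≤-trans len (threshold-fits l (suc (suc k)) (s≤s (s≤s z≤n))) , meets)) ]′
    (gapped G l 3≤l threshold level threshold-step level-large (suc (suc k)) (s≤s z≤n) gap)
    where
    gap : (C : Cyc (Graph.Adj G)) → size C ≤ 6 * l → size C < l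
    gap C ≤6l = ≰⇒> λ l≤ → none (C , l≤ , ≤6l)
  ... | yes (C , l≤ , ≤6l) with erdősPósa k (delete G (support C))
  ... | inj₁ (Cs , len , dj , long∀) = inj₁ (C ∷ map (undelete G (support C)) Cs ,
      cong suc (trans (length-map (undelete G (support C)) Cs) len) ,
      Allₚ.map⁺ (All.tabulate λ {D} _ (i , j) → delete-misses G (support C) D (j , i)) ∷ AllPairsₚ.map⁺ dj ,
      l≤ ∷ Allₚ.map⁺ long∀)
    where
    open import Data.List.Properties using (length-map)
    import Data.List.Relation.Unary.AllPairs.Properties as AllPairsₚ
    import Data.List.Relation.Unary.All.Properties as Allₚ
  ... | inj₂ (X , len , meets) = inj₂ (support C ++ X ,
      ≤-trans (≤-reflexive (trans (length-++ (support C)) (+-comm (size C) (length X))))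
        (≤-trans (+-mono-≤ len ≤6l) (bound-step l k)) , meets′)
    where
    open import Data.List.Membership.DecPropositional Fin._≟_ using (_∈?_)
    meets′ : (D : Cyc (Graph.Adj G)) → l ≤ size D → Any (_∈ support C ++ X) (support D)
    meets′ D l≤D with Any.any? (_∈? support C) (support D)
    ... | yes i = Any.map ∈-++⁺ˡ i
    ... | no none with survive G (support C) D none
    ... | D′ , eq = Any.map (∈-++⁺ʳ (support C)) (subst (Any (_∈ X)) eq (meets D′ (subst (λ xs → l ≤ length xs) (sym eq) l≤D)))

-- Comparison with the real bound

module Rational where
  open import Data.Integer.Base as ℤ using (+_; -[1+_])
  import Data.Integer.Properties as ℤ
  open import Data.Nat.Coprimality using (1-coprimeTo) renaming (sym to coprime-sym)
  open import Data.Rational.Base as ℚ using (ℚ; mkℚ; 1ℚ; ½)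
  import Data.Rational.Properties as ℚ
  open import Data.Rational.Unnormalised.Base as ℚᵘ using (mkℚᵘ; *≡*)
  import Data.Rational.Unnormalised.Properties as ℚᵘ

  ι : ℕ → ℚ
  ι n = + n ℚ./ 1

  ι≡ : ∀ n → ι n ≡ mkℚ (+ n) 0 (coprime-sym (1-coprimeTo n))
  ι≡ n = ℚ.↥p/↧p≡p (mkℚ (+ n) 0 (coprime-sym (1-coprimeTo n)))

  -- Operations of ℚ normalise by a gcd and do not reduce on variables. Between unnormalised
  -- fractions with denominator 1 the equation is one about integers.
  ι-homo : (_∙_ : ℚ → ℚ → ℚ) (_∙ᵘ_ : ℚᵘ.ℚᵘ → ℚᵘ.ℚᵘ → ℚᵘ.ℚᵘ) (_∙ₙ_ : ℕ → ℕ → ℕ) →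
           (∀ p q → ℚ.toℚᵘ (p ∙ q) ℚᵘ.≃ ℚ.toℚᵘ p ∙ᵘ ℚ.toℚᵘ q) →
           (∀ m n → mkℚᵘ (+ (m ∙ₙ n)) 0 ℚᵘ.≃ mkℚᵘ (+ m) 0 ∙ᵘ mkℚᵘ (+ n) 0) →
           ∀ m n → ι (m ∙ₙ n) ≡ ι m ∙ ι n
  ι-homo _∙_ _∙ᵘ_ _∙ₙ_ homo base m n rewrite ι≡ m | ι≡ n = ℚ.toℚᵘ-injective
    (ℚᵘ.≃-trans (ℚ.toℚᵘ-fromℚᵘ (mkℚᵘ (+ (m ∙ₙ n)) 0)) (ℚᵘ.≃-trans (base m n) (ℚᵘ.≃-sym (homo _ _))))

  ι-+ : ∀ m n → ι (m + n) ≡ ι m ℚ.+ ι n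
  ι-+ = ι-homo ℚ._+_ ℚᵘ._+_ _+_ ℚ.toℚᵘ-homo-+ λ m n →
    *≡* (cong (ℤ._* (+ 1)) (trans (ℤ.pos-+ m n) (sym (cong₂ ℤ._+_ (ℤ.*-identityʳ (+ m)) (ℤ.*-identityʳ (+ n))))))

  ι-* : ∀ m n → ι (m * n) ≡ ι m ℚ.* ι n
  ι-* = ι-homo ℚ._*_ ℚᵘ._*_ _*_ ℚ.toℚᵘ-homo-* λ m n → *≡* (cong (ℤ._* (+ 1)) (ℤ.pos-* m n))

  ι-mono : ∀ {m n} → m ≤ n → ι m ℚ.≤ ι n
  ι-mono {m} {n} m≤n rewrite ι≡ m | ι≡ n = ℚ.*≤* (ℤ.*-monoʳ-≤-nonNeg (+ 1) (ℤ.+≤+ m≤n))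

  ≤⇒≯ℚ : ∀ {p q} → p ℚ.≤ q → ¬ q ℚ.< p
  ≤⇒≯ℚ p≤q q<p = ℚ.<-irrefl refl (ℚ.<-≤-trans q<p p≤q)

  ι-cancel : ∀ {m n} → ι m ℚ.< ι n → m < n
  ι-cancel {m} {n} lt = ≰⇒> λ n≤m → ≤⇒≯ℚ (ι-mono n≤m) lt

  ι-nonNeg : ∀ n → ℚ.NonNegative (ι n)
  ι-nonNeg n = ℚ.nonNegative (ι-mono {0} {n} z≤n)

  ι-^ : ∀ m d → ι (m ^ d) ≡ ι m ^ℚ d
  ι-^ m zero    = refl
  ι-^ m (suc d) = trans (ι-* m (m ^ d)) (cong (ι m ℚ.*_) (ι-^ m d))

  ^ℚ-mono : ∀ m {r} d → ι m ℚ.≤ r → ι m ^ℚ d ℚ.≤ r ^ℚ d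
  ^ℚ-mono m zero    m≤r = ℚ.≤-refl
  ^ℚ-mono m {r} (suc d) m≤r = ℚ.≤-trans
    (ℚ.*-monoʳ-≤-nonNeg (ι m ^ℚ d) {{subst ℚ.NonNegative (ι-^ m d) (ι-nonNeg (m ^ d))}} m≤r)
    (ℚ.*-monoˡ-≤-nonNeg r {{ℚ.nonNegative (ℚ.≤-trans (ι-mono {0} {m} z≤n) m≤r)}} (^ℚ-mono m d m≤r))

  ½^≤1 : ∀ n → ½ ^ℚ n ℚ.≤ 1ℚ
  ½^≤1 zero    = ℚ.≤-refl
  ½^≤1 (suc n) = ℚ.≤-trans (ℚ.*-monoˡ-≤-nonNeg ½ (½^≤1 n)) (ℚ.*≤* (ℤ.+≤+ (s≤s z≤n)))

  -- If p/d is in the cut, some r ≥ 2^m satisfies r^d < 2^p, so 2^(md) < 2^p and m ≤ p/d. A negative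
  -- p would give r^d < 1, although r ≥ 1.
  ≤log₂ : ∀ (x : ℝ) m → (∀ {r} → x r → ι (2 ^ m) ℚ.≤ r) → ∀ {q} → log₂ x q → ι m ℚ.≤ q
  ≤log₂ x m 2^m≤x {q@(mkℚ (+ p) d-1 _)} (r , xr , _ , r^d<2^p) = subst (ℚ._≤ q) (sym (ι≡ m))
    (ℚ.*≤* (subst₂ ℤ._≤_ (ℤ.pos-* m (suc d-1)) (sym (ℤ.*-identityʳ (+ p))) (ℤ.+≤+ (≮⇒≥ p≮))))
    where
    exponent : 2 ^ (m * suc d-1) < 2 ^ p
    exponent = ι-cancel (ℚ.≤-<-trans
      (ℚ.≤-trans (ℚ.≤-reflexive (trans (cong ι (sym (^-*-assoc 2 m (suc d-1)))) (ι-^ (2 ^ m) (suc d-1)))) (^ℚ-mono (2 ^ m) (suc d-1) (2^m≤x xr)))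
      (subst (r ^ℚ suc d-1 ℚ.<_) (sym (ι-^ 2 p)) r^d<2^p))
    p≮ : ¬ (p < m * suc d-1)
    p≮ p< = <⇒≱ exponent (^-monoʳ-≤ 2 (<⇒≤ p<))
  ≤log₂ x m 2^m≤x {mkℚ -[1+ p ] d-1 _} (r , xr , _ , r^d<½^p) = ⊥-elim (≤⇒≯ℚ
    (ℚ.≤-trans (ℚ.≤-trans (ι-mono {1} {(2 ^ m) ^ suc d-1} (m^n>0 (2 ^ m) {{m^n≢0 2 m}} (suc d-1)))
      (ℚ.≤-reflexive (ι-^ (2 ^ m) (suc d-1)))) (^ℚ-mono (2 ^ m) (suc d-1) (2^m≤x xr)))
    (ℚ.<-≤-trans r^d<½^p (½^≤1 (suc p))))

  ≤· : ∀ (x : ℝ) c m → (∀ {r} → x r → ι m ℚ.≤ r) → ∀ {q} → (c · x) q → ι (c * m) ℚ.≤ q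
  ≤· x c m m≤x (r , xr , lt) = ℚ.≤-trans (ℚ.≤-reflexive (ι-* c m))
    (ℚ.≤-trans (ℚ.*-monoˡ-≤-nonNeg (ι c) {{ι-nonNeg c}} (m≤x xr)) (ℚ.<⇒≤ lt))

  -- Strictness comes from the definition of the sum of cuts; it is used for the outermost sum,
  -- because `fromℕ m` is an open cut.
  <+ᴿ : ∀ (x y : ℝ) m n → (∀ {r} → x r → ι m ℚ.≤ r) → (∀ {r} → y r → ι n ℚ.≤ r) → ∀ {q} → (x +ᴿ y) q → ι (m + n) ℚ.< q
  <+ᴿ x y m n m≤x n≤y (r , s , xr , ys , lt) =
    ℚ.≤-<-trans (ℚ.≤-trans (ℚ.≤-reflexive (ι-+ m n)) (ℚ.+-mono-≤ (m≤x xr) (n≤y ys))) lt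

  bound≤f : ∀ l k {m} → 1 ≤ k → m ≤ bound l k → fromℕ m ≤ᴿ f l k
  bound≤f l 1               _ m≤ p = ℚ.≤-<-trans (ι-mono m≤) p
  bound≤f l k@(suc (suc _)) 1≤ m≤ p = ℚ.≤-<-trans (ι-mono m≤)
    (<+ᴿ (A +ᴿ B +ᴿ C) D (a + b + c) d (ℚ.<⇒≤ ∘ <+ᴿ (A +ᴿ B) C (a + b) c (ℚ.<⇒≤ ∘ <+ᴿ A B a b ℚ.<⇒≤ B≤) ℚ.<⇒≤) D≤ p)
    where
    A B C D : ℝ
    A = fromℕ (6 * k * l)
    B = (10 * k) · log₂ (fromℕ k)
    C = fromℕ (40 * k)
    D = (10 * k) · log₂ (log₂ (fromℕ k))
    a b c d : ℕ
    a = 6 * k * l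
    b = 10 * k * lg k
    c = 40 * k
    d = 10 * k * lglg k
    lg≤ : ∀ {r} → log₂ (fromℕ k) r → ι (lg k) ℚ.≤ r
    lg≤ = ≤log₂ (fromℕ k) (lg k) λ lt → ℚ.≤-trans (ι-mono (2^⌊log₂⌋≤ k 1≤)) (ℚ.<⇒≤ lt)
    B≤ : ∀ {r} → B r → ι b ℚ.≤ r
    B≤ = ≤· (log₂ (fromℕ k)) (10 * k) (lg k) lg≤
    D≤ : ∀ {r} → D r → ι d ℚ.≤ r
    D≤ = ≤· (log₂ (log₂ (fromℕ k))) (10 * k) (lglg k) (≤log₂ (log₂ (fromℕ k)) (lglg k) λ lt →
      ℚ.≤-trans (ι-mono (2^⌊log₂⌋≤ (lg k) (⌊log₂⌋-mono-≤ {2} {k} (s≤s (s≤s z≤n))))) (lg≤ lt))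

-- Translation to the types of the statement

module _ {V : Set} {G : Graph V} where
  open Graph G using (Adj)
  open import Data.List.Relation.Unary.Linked using (Linked; [-]; _∷_)

  toCycle : Cyc Adj → Cycle G
  toCycle (cyc {x} {zs} w c u 2≤) = record
    { root = x ; rest = zs ; unique = u ; closed = linked w c ; length≥3 = s≤s 2≤ }
    where
    linked : ∀ {z zs y} → Walk Adj z zs y → Adj y x → Linked Adj (z ∷ zs ++ [ x ])
    linked ε       c = c ∷ [-]
    linked (r ◅ w) c = r ∷ linked w c

  fromLinked : ∀ {z zs x} → Linked Adj (z ∷ zs ++ [ x ]) → ∃ λ y → Walk Adj z zs y × Adj y x
  fromLinked {zs = []}     (a ∷ [-]) = _ , ε , a
  fromLinked {zs = z ∷ zs} (a ∷ as)  = let y , w , c = fromLinked as in y , a ◅ w , c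

toFamily : ∀ {n} (G : Graph (Fin n)) l (3≤l : 3 ≤ l) {k} → Construction.LongFamily G l 3≤l k → HasDisjointCycles≥ k l G
toFamily G l 3≤l (Cs , refl , dj , long∀) =
  toCycle {G = G} ∘ lookup Cs , (λ i → All.lookup long∀ (∈-lookup i)) , λ i j i≢j → pairs dj i j i≢j
  where
  open import Data.List.Base using (lookup)
  open import Data.List.Membership.Propositional.Properties using (∈-lookup)
  pairs : ∀ {Cs : List (Cyc (Graph.Adj G))} → AllPairs (Disjoint on support) Cs → ∀ i j → i ≢ j →
          Disjoint (support (lookup Cs i)) (support (lookup Cs j))
  pairs (p ∷ dj) zero    zero    i≢j = contradiction refl i≢j
  pairs (p ∷ dj) zero    (suc j) i≢j = All.lookup p (∈-lookup j)
  pairs (p ∷ dj) (suc i) zero    i≢j = λ (x , y) → All.lookup p (∈-lookup i) (y , x)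
  pairs (p ∷ dj) (suc i) (suc j) i≢j = pairs dj i j (i≢j ∘ cong suc)

module _ {n : ℕ} where
  open import Data.Fin.Subset as Subset using (inside; outside; ∁)
  import Data.Fin.Subset.Properties as Subset
  open import Data.Vec.Base using (_∷_; _[_]≔_; lookup)
  open import Data.Vec.Properties using ([]≔-updates; []≔-minimal)

  subset : List (Fin n) → Subset n
  subset []       = Subset.⊥
  subset (x ∷ xs) = subset xs [ x ]≔ inside

  ∈-subset : ∀ {x xs} → x ∈ xs → x Subset.∈ subset xs
  ∈-subset {x} {_ ∷ xs} (here refl) = []≔-updates (subset xs) x
  ∈-subset {x} {y ∷ xs} (there i) with x Fin.≟ y
  ... | yes refl = []≔-updates (subset xs) x
  ... | no x≢y   = []≔-minimal (subset xs) x y x≢y (∈-subset i)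

  ∣subset∣≤ : ∀ xs → ∣ subset xs ∣ ≤ length xs
  ∣subset∣≤ []       = ≤-reflexive (Subset.∣⊥∣≡0 n)
  ∣subset∣≤ (x ∷ xs) = ≤-trans (insert (subset xs) x) (s≤s (∣subset∣≤ xs))
    where
    insert : ∀ {m} (p : Subset m) x → ∣ p [ x ]≔ inside ∣ ≤ suc ∣ p ∣
    insert (inside  ∷ p) zero    = n≤1+n _
    insert (outside ∷ p) zero    = ≤-refl
    insert (inside  ∷ p) (suc x) = s≤s (insert p x)
    insert (outside ∷ p) (suc x) = insert p x

  outsideCycle : (G : Graph (Fin n)) (X : Subset n) (C : Cycle (G Defs.- X)) →
                 Σ[ D ∈ Cyc (Graph.Adj G) ] size D ≡ Defs.length C × All (λ v → v Subset.∉ X) (support D)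
  outsideCycle G X C = let y , w , c = fromLinked {G = G Defs.- X} (Cycle.closed C) in
    cyc (walk w) c (Uniqueₚ.map⁺ injective (Cycle.unique C)) (subst (2 ≤_) (sym (length-map proj₁ (Cycle.rest C))) (≤-pred (Cycle.length≥3 C))) ,
    length-map proj₁ (Defs.vertices C) ,
    Allₚ.map⁺ (All.universal (λ v → Subset.x∈∁p⇒x∉p (proj₂ v)) (Defs.vertices C))
    where
    open import Data.List.Properties using (length-map)
    import Data.List.Relation.Unary.All.Properties as Allₚ
    import Data.List.Relation.Unary.Unique.Propositional.Properties as Uniqueₚ
    open import Data.Vec.Properties.WithK using ([]=-irrelevant)
    walk : ∀ {x zs y} → Walk (Graph.Adj (G Defs.- X)) x zs y → Walk (Graph.Adj G) (proj₁ x) (map proj₁ zs) (proj₁ y)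
    walk ε       = ε
    walk (r ◅ w) = r ◅ walk w
    injective : ∀ {u v : ∃[ v ] v Subset.∈ ∁ X} → proj₁ u ≡ proj₁ v → u ≡ v
    injective {_ , p} {_ , q} refl = cong (_ ,_) ([]=-irrelevant p q)

theorem1 : ∀ (l k : ℕ) → 3 ≤ l → 1 ≤ k →
    ∀ {n : ℕ} (G : Graph (Fin n)) →
    HasDisjointCycles≥ k l G
    ⊎ (Σ[ X ∈ Subset n ] fromℕ ∣ X ∣ ≤ᴿ f l k × ¬ HasCycle≥ l (G - X))
theorem1 l (suc k) 3≤l 1≤k G with erdősPósa l 3≤l k G
... | inj₁ family = inj₁ (toFamily G l 3≤l family)
... | inj₂ (X , len , meets) = inj₂ (subset X , Rational.bound≤f l (suc k) 1≤k (≤-trans (∣subset∣≤ X) len) , none)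
  where
  none : ¬ HasCycle≥ l (G - subset X)
  none (C , l≤) with outsideCycle G (subset X) C
  ... | D , len , out = let v , v∈ , v∈X = find (meets D (subst (l ≤_) (sym len) l≤)) in All.lookup out v∈ (∈-subset v∈X)
    where open import Data.List.Membership.Propositional using (find)
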